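{- For every integer $k\ge 2$ there is a constant $C_k$ depending only on $k$ such that for every $k$-uniform hypergraph $\mathcal{H}$ on $n$ vertices with degree sequence $d_1,\dots,d_n$ and every $\alpha\in[0,1]$, with $\phi(s)=(k-1)^{n-1}\alpha^{s}\sum_{i=1}^{n}d_i^{s}$: (1) $\mathrm{Tr}_d(\mathcal{A}_\alpha(\mathcal{H}))=\phi(d)$ for $d=1,\dots,k-1$; (2) $\mathrm{Tr}_k(\mathcal{A}_\alpha(\mathcal{H}))=\phi(k)+(k-1)^{n-k}k^{k-1}(1-\alpha)^k|E(\mathcal{H})|$; (3) $\mathrm{Tr}_{k+1}(\mathcal{A}_\alpha(\mathcal{H}))=\phi(k+1)+(k+1)(k-1)^{n-k}\Big(k^{k-2}\alpha(1-\alpha)^k\sum_{i=1}^n d_i^2+(1-\alpha)^{k+1}C_k|\mathcal{K}_{k+1}|\Big)$, where $\mathcal{K}_{k+1}$ is the set of all complete $k$-uniform subhypergraphs of $\mathcal{H}$ with $k+1$ hyperedges (that is, on $k+1$ vertices).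
   Context: For a $k$-uniform hypergraph $\mathcal{H}$ on $[n]$ (every hyperedge has exactly $k$ vertices), the adjacency tensor $\mathcal{A}(\mathcal{H})$ is the $k$-order $n$-dimensional tensor with entry $\frac{1}{(k-1)!}$ at $(i_1,\dots,i_k)$ if $\{i_1,\dots,i_k\}\in E(\mathcal{H})$ and $0$ otherwise; $\mathcal{D}(\mathcal{H})$ is the diagonal tensor with $(i,\dots,i)$-entry the degree $d_i$ of $i$; and $\mathcal{A}_\alpha(\mathcal{H})=\alpha\mathcal{D}(\mathcal{H})+(1-\alpha)\mathcal{A}(\mathcal{H})$. For a $k$-order $n$-dimensional tensor $\mathcal{T}$ and $d\ge 1$, $$\mathrm{Tr}_{d}(\mathcal{T})=(k-1)^{n-1}\sum_{d_1+\cdots+d_n=d}\ \prod_{i=1}^{n}\frac{1}{(d_i(k-1))!}\Big(\sum_{\gamma\in[n]^{k-1}}(\mathcal{T})_{i\gamma}\frac{\partial}{\partial a_{i\gamma}}\Big)^{d_i}\mathrm{tr}\big(A^{d(k-1)}\big),$$ where $A=(a_{ij})$ is an $n\times n$ matrix of indeterminates, the $d_i$ in this formula are nonnegative integers, and $\frac{\partial}{\partial a_{i\gamma}}=\frac{\partial}{\partial a_{i i_2}}\cdots\frac{\partial}{\partial a_{i i_k}}$ for $\gamma=i_2\cdots i_k$. It equals the sum of the $d$-th powers of all $n(k-1)^{n-1}$ eigenvalues of $\mathcal{T}$ (roots of its characteristic polynomial, with multiplicity). -}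

module Defs where

open import Level using (Level; 0ℓ; _⊔_) renaming (suc to lsuc)
open import Algebra.Apartness.Bundles using (HeytingField; HeytingCommutativeRing)
open import Algebra.Bundles using (CommutativeRing; Semiring)
import Algebra.Definitions.RawSemiring as RawSemiringDefinitions
open import Data.Bool.Base using (if_then_else_; _∧_)
open import Data.Fin.Base using (Fin)
open import Data.Fin.Properties using (_≟_)
open import Data.Fin.Subset using (Subset; Side; inside; outside; ⁅_⁆; ⋃; ∣_∣; _∈_; _⊆_)
open import Data.Fin.Subset.Properties using (_∈?_; _⊆?_)
open import Data.Integer.Base using (ℤ; +_; -[1+_]; _⊖_)
open import Data.List.Base as List using (List; []; _∷_; allFin; upTo; filter; length; cartesianProductWith)
open import Data.List.Relation.Unary.All using (All; all?)
open import Data.Nat.Base as ℕ using (ℕ; zero; suc; _∸_; 2+; NonZero; NonTrivial; _!)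
open import Data.Nat.GeneralisedArithmetic using (fold)
open import Data.Nat.Properties as ℕₚ using (_!≢0)
open import Data.Product.Base using (_×_; proj₁)
open import Data.Sum.Base using (_⊎_; inj₂)
open import Data.Vec.Base as Vec using (Vec; []; _∷_)
import Data.Vec.Relation.Unary.All as VecAll
open import Function.Bundles using (_⇔_; Equivalence)
open import Relation.Binary.Core using (Rel)
open import Relation.Binary.PropositionalEquality.Core using (_≡_)
open import Relation.Binary.Structures using (IsStrictPartialOrder)
open import Relation.Nullary.Decidable using (does; _×-dec_; _→-dec_)
open import Relation.Nullary.Negation using (¬_)
open import Relation.Unary using (Pred; Decidable)

-- Ordered fields play the role of ℝ.  The order is only required to be a
-- strict partial order inducing the apartness relation (x # y iff x < y or
-- y < x), so that both the classical and the constructive reals qualify.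
record OrderedField c ℓ₁ ℓ₂ : Set (lsuc (c ⊔ ℓ₁ ⊔ ℓ₂)) where
  field
    heytingField : HeytingField c ℓ₁ ℓ₂

  open HeytingField heytingField public
  infix 4 _<_ _≤_

  field
    _<_                  : Rel Carrier ℓ₂
    isStrictPartialOrder : IsStrictPartialOrder _≈_ _<_
    #⇔<⊎>                : ∀ {x y} → (x # y) ⇔ (x < y ⊎ y < x)
    +-monoʳ-<            : ∀ x {y z} → y < z → x + y < x + z
    *-pos                : ∀ {x y} → 0# < x → 0# < y → 0# < x * y
    0<1                  : 0# < 1#

  _≤_ : Rel Carrier ℓ₂
  x ≤ y = ¬ (y < x)

  commutativeRing : CommutativeRing c ℓ₁
  commutativeRing = HeytingCommutativeRing.commutativeRing heytingCommutativeRing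

  open RawSemiringDefinitions
    (Semiring.rawSemiring (CommutativeRing.semiring commutativeRing)) public
    using (_^_; sum) renaming (_×_ to _·_)

  fromℕ : ℕ → Carrier
  fromℕ m = m · 1#

  fromℕ-pos : ∀ m → 0# < fromℕ (suc m)
  fromℕ-pos zero    = <-respʳ-≈ (sym (+-identityʳ 1#)) 0<1
    where open IsStrictPartialOrder isStrictPartialOrder using (<-respʳ-≈)
  fromℕ-pos (suc m) =
    <-trans 0<1 (<-respˡ-≈ (+-identityʳ 1#) (+-monoʳ-< 1# (fromℕ-pos m)))
    where open IsStrictPartialOrder isStrictPartialOrder
            using (<-respˡ-≈) renaming (trans to <-trans)

  -- `#⇒invertible` inverts the difference m - 0.
  1/_ : (m : ℕ) .{{_ : NonZero m}} → Carrier
  1/ suc m = proj₁ (#⇒invertible {fromℕ (suc m)} {0#}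
                      (Equivalence.from #⇔<⊎> (inj₂ (fromℕ-pos m))))

  1/!_ : ℕ → Carrier
  1/! m = 1/_ (m !) {{m !≢0}}

  -- (k - 1)^z for k ≥ 2; the exponents n - 1 and n - k may be negative.
  [_-1]^_ : (k : ℕ) .{{_ : NonTrivial k}} → ℤ → Carrier
  [ k    -1]^ (+ e)    = fromℕ (k ∸ 1) ^ e
  [ 2+ r -1]^ -[1+ e ] = (1/ suc r) ^ suc e

  ∑ : ∀ {a} {A : Set a} → List A → (A → Carrier) → Carrier
  ∑ xs f = List.foldr (λ x s → f x + s) 0# xs

tuples : ∀ {a} {A : Set a} → List A → (m : ℕ) → List (Vec A m)
tuples xs zero    = [] ∷ []
tuples xs (suc m) = cartesianProductWith _∷_ xs (tuples xs m)

-- All (d₁,…,dₙ) ∈ ℕⁿ with d₁ + ⋯ + dₙ = d.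
compositions : (n d : ℕ) → List (Vec ℕ n)
compositions n d = filter (λ ds → Vec.sum ds ℕₚ.≟ d) (tuples (upTo (suc d)) n)

subsets : (n : ℕ) → List (Subset n)
subsets n = tuples (inside ∷ outside ∷ []) n

record Hypergraph (k n : ℕ) : Set₁ where
  field
    Edge    : Pred (Subset n) 0ℓ
    edge?   : Decidable Edge
    uniform : ∀ {e} → Edge e → ∣ e ∣ ≡ k

  numEdges : ℕ
  numEdges = length (filter edge? (subsets n))

  degree : Fin n → ℕ
  degree i = length (filter (λ e → edge? e ×-dec (i ∈? e)) (subsets n))

  -- A complete k-uniform subhypergraph is determined by its vertex set S.
  Complete : Pred (Subset n) 0ℓ
  Complete S = All (λ e → e ⊆ S × ∣ e ∣ ≡ k → Edge e) (subsets n)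

  complete? : Decidable Complete
  complete? S = all?
    (λ e → ((e ⊆? S) ×-dec (∣ e ∣ ℕₚ.≟ k)) →-dec edge? e) (subsets n)

  -- |𝒦ₖ₊₁|
  numComplete : ℕ
  numComplete = length
    (filter (λ S → (∣ S ∣ ℕₚ.≟ suc k) ×-dec complete? S) (subsets n))

module Tensors {c ℓ₁ ℓ₂ : Level} (F : OrderedField c ℓ₁ ℓ₂) where
  open OrderedField F

  -- Polynomials over F in the n² indeterminates aᵢⱼ, as terms.
  infixl 6 _⊕_
  infixl 7 _⊗_
  data Poly (n : ℕ) : Set c where
    con     : Carrier → Poly n
    var     : Fin n → Fin n → Poly n
    _⊕_ _⊗_ : Poly n → Poly n → Poly n

  ∑ₚ : ∀ {a} {A : Set a} {n : ℕ} → List A → (A → Poly n) → Poly n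
  ∑ₚ xs f = List.foldr (λ x s → f x ⊕ s) (con 0#) xs

  ∂ : ∀ {n} → Fin n → Fin n → Poly n → Poly n
  ∂ i j (con _)   = con 0#
  ∂ i j (var p q) = if does (i ≟ p) ∧ does (j ≟ q) then con 1# else con 0#
  ∂ i j (f ⊕ g)   = ∂ i j f ⊕ ∂ i j g
  ∂ i j (f ⊗ g)   = (∂ i j f ⊗ g) ⊕ (f ⊗ ∂ i j g)

  constantTerm : ∀ {n} → Poly n → Carrier
  constantTerm (con x)   = x
  constantTerm (var _ _) = 0#
  constantTerm (f ⊕ g)   = constantTerm f + constantTerm g
  constantTerm (f ⊗ g)   = constantTerm f * constantTerm g

  Matrix : ℕ → Set c
  Matrix n = Fin n → Fin n → Poly n

  infixr 8 _^ᵐ_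
  _^ᵐ_ : ∀ {n} → Matrix n → ℕ → Matrix n
  (M ^ᵐ zero)      i j = if does (i ≟ j) then con 1# else con 0#
  _^ᵐ_ {n} M (suc m) i j = ∑ₚ (allFin n) (λ l → M i l ⊗ (M ^ᵐ m) l j)

  tr : ∀ {n} → Matrix n → Poly n
  tr {n} M = ∑ₚ (allFin n) (λ i → M i i)

  -- The entry at (i, i₂, …, iₖ) is indexed by i and γ = (i₂, …, iₖ).
  Tensor : (k n : ℕ) → Set c
  Tensor k n = Fin n → Vec (Fin n) (k ∸ 1) → Carrier

  -- ∂/∂a_{iγ} = ∂/∂a_{i i₂} ⋯ ∂/∂a_{i iₖ}
  ∂* : ∀ {n m} → Fin n → Vec (Fin n) m → Poly n → Poly n
  ∂* i γ f = Vec.foldr′ (∂ i) f γ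

  -- Σ_γ T_{iγ} ∂/∂a_{iγ}
  rowOperator : (k : ℕ) {n : ℕ} → Tensor k n → Fin n → Poly n → Poly n
  rowOperator k {n} T i f =
    ∑ₚ (tuples (allFin n) (k ∸ 1)) (λ γ → con (T i γ) ⊗ ∂* i γ f)

  -- ∏ᵢ 1/(dᵢ(k-1))! (Σ_γ T_{iγ} ∂/∂a_{iγ})^{dᵢ}
  operator : (k : ℕ) {n : ℕ} → Tensor k n → Vec ℕ n → Poly n → Poly n
  operator k {n} T ds f = List.foldr
    (λ i g → con (1/! (Vec.lookup ds i ℕ.* (k ∸ 1)))
               ⊗ fold g (rowOperator k T i) (Vec.lookup ds i))
    f (allFin n)

  -- For d₁ + ⋯ + dₙ = d the operator is homogeneous of order d(k-1), the degree
  -- of tr(A^{d(k-1)}), so its result is a constant polynomial; `constantTerm`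
  -- only reads that constant off.
  Tr : (k : ℕ) .{{_ : NonTrivial k}} {n : ℕ} → ℕ → Tensor k n → Carrier
  Tr k {n} d T =
    [ k -1]^ (n ⊖ 1) *
    ∑ (compositions n d)
      (λ ds → constantTerm (operator k T ds (tr (var ^ᵐ (d ℕ.* (k ∸ 1))))))

  module _ {k n : ℕ} (H : Hypergraph k n) where
    open Hypergraph H

    adjacencyTensor : Tensor k n
    adjacencyTensor i γ =
      if does (edge? (⋃ (List.map ⁅_⁆ (i ∷ Vec.toList γ))))
      then 1/! (k ∸ 1) else 0#

    degreeTensor : Tensor k n
    degreeTensor i γ =
      if does (VecAll.all? (i ≟_) γ) then fromℕ (degree i) else 0#

    A[_] : Carrier → Tensor k n
    A[ α ] i γ = α * degreeTensor i γ + (1# - α) * adjacencyTensor i γ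

{-# OPTIONS --safe #-}
module Submission where

-- Applied to tr(A^{d(k-1)}), a product of derivatives ∂/∂a_{ij} counts the closed walks that use
-- each arc (i , j) of the product exactly once.  Expanding the row operators therefore writes Tr_d
-- as a sum over configurations, which choose at every vertex dᵢ times either the diagonal entry
-- (k-1 loops) or an edge e through it (arcs to the other vertices of e).  Only balanced and
-- connected configurations contribute.  If a vertex chooses an edge, then by balance so does every
-- vertex of that edge; for d ≤ k + 1 this leaves
--   * d times the diagonal entry at a single vertex, which gives φ d;
--   * an edge chosen once by each of its vertices (d = k), possibly with a loop entry at one of
--     them (d = k + 1);
--   * for d = k + 1, the edges S ∖ {h v} for v in a (k+1)-set S, h a permutation of S without
--     fixed points; then S is complete, and the count depends on k only.
-- The walks of the second kind are counted by the BEST theorem and Cayley's formula.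

open import Defs
open import Algebra.Bundles using (CommutativeMonoid; CommutativeRing)
open import Data.Bool.Base using (Bool; true; false; if_then_else_)
open import Data.Fin.Base as Fin using (Fin)
open import Data.Fin.Properties as Finₚ using (_≟_)
open import Data.Fin.Subset as Subset using (Subset; inside; outside; ⁅_⁆; ⋃; ∣_∣)
open import Data.Fin.Subset.Properties as Subsetₚ using (_∈?_)
open import Data.Integer.Base using (_⊖_)
import Data.Integer.Properties as ℤₚ
open import Data.List.Base as List using (List; []; _∷_; _++_; map; concatMap; filter; allFin; cartesianProductWith; length; replicate; upTo)
import Data.List.Membership.DecPropositional
open import Data.List.Membership.Propositional using (_∈_; _∉_; find; lose)
open import Data.List.Membership.Propositional.Properties using (∈-∃++; ∈-++⁺ˡ; ∈-++⁺ʳ; ∈-++⁻; ∈-map⁻; ∈-map⁺; ∈-allFin; ∈-filter⁺; ∈-filter⁻; ∈-cartesianProductWith⁺; ∈-cartesianProductWith⁻; ∈-concatMap⁺; ∈-concatMap⁻; ∈-upTo⁺; ∈-lookup)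
import Data.List.Properties as Listₚ
open import Data.List.Relation.Binary.Permutation.Propositional as Perm using (_↭_)
open import Data.List.Relation.Binary.Permutation.Propositional.Properties using (shift; shifts; ∈-resp-↭; ↭-length; ++⁺ʳ; ++⁺ˡ) renaming (map⁺ to ↭-map⁺)
import Data.List.Relation.Binary.Permutation.Setoid.Properties as PermSetoid
open import Data.List.Relation.Unary.All as All using (All; []; _∷_)
open import Data.List.Relation.Unary.AllPairs using ([]; _∷_)
open import Data.List.Relation.Unary.Any as Any using (here; there)
import Data.List.Relation.Unary.Any.Properties as Anyₚ
open import Data.List.Relation.Unary.Unique.Propositional using (Unique)
open import Data.List.Relation.Unary.Unique.Propositional.Properties as Uniqueₚ using (Unique[x∷xs]⇒x∉xs; allFin⁺; filter⁺; map⁺; cartesianProductWith⁺)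
open import Data.Maybe.Base using (Maybe; nothing; just)
open import Data.Nat.Base as ℕ using (ℕ; suc; _∸_; NonTrivial)
open import Data.Nat.GeneralisedArithmetic using (fold)
import Data.Nat.Properties as ℕₚ
open import Data.Product.Base using (_×_; _,_; proj₁; proj₂; ∃-syntax; map₂)
open import Data.Sum.Base using (_⊎_; inj₁; inj₂; [_,_]′)
open import Data.Vec.Base as Vec using (Vec; []; _∷_; lookup; toList)
import Data.Vec.Properties as Vecₚ
import Data.Vec.Relation.Unary.All as VecAll
open import Function.Base using (id)
open import Function.Bundles using (mk⇔)
open import Level using (Level)
open import Relation.Binary.PropositionalEquality as ≡ using (_≡_; _≢_; refl)
open import Relation.Nullary.Decidable using (Dec; does; yes; no; dec-true; dec-false; does-⇔; ¬?; _×-dec_)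
open import Relation.Nullary.Negation using (¬_; contradiction)
open import Relation.Unary using (Pred; Decidable)

-- A closed walk through all arcs enters each vertex as often as it leaves it and meets every vertex
-- that has an arc. An edge in use therefore occupies a factor at each of its k vertices, and d ≤ k
-- + 1 leaves at most one factor to spare; the list of configurations is the list of places for it.
-- The obstacle is the count of walks: instead of determinants, spanning trees are defined by
-- contracting one vertex after another, which yields both the additivity in each row that the BEST
-- induction needs and a weighted Cayley formula. In an edge configuration a vertex with a outgoing
-- arcs brings (a-1)! from the walks against 1/a! from the operator, so 1/a remains. With a = k-1 at
-- all k vertices, k(k-1) arcs and k^(k-2) trees, the prefactor (k-1)^(n-1) becomes (k-1)^(n-k)
-- k^(k-1). A loop entry at `v` doubles a there, and the resulting 1/2 is made up for by the two
-- orders of loop entry and edge. The digraph of a clique is not complete, so no closed formula is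
-- sought: its walks are summed over all `h`, and `C` only adapts this number to the normalisation
-- of the statement.

Unique-resp-↭ : ∀ {a} {A : Set a} {xs ys : List A} → xs ↭ ys → Unique xs → Unique ys
Unique-resp-↭ {A = A} p = PermSetoid.Unique-resp-↭ (≡.setoid A) (Perm.↭⇒↭ₛ p)

-- Finite sums and products over lists in a commutative monoid

module BigOperator {c ℓ : Level} (M : CommutativeMonoid c ℓ) where
  open CommutativeMonoid M hiding (refl)
  open import Relation.Binary.Reasoning.Setoid setoid
  open import Algebra.Properties.CommutativeSemigroup commutativeSemigroup using (interchange; x∙yz≈y∙xz)

  ⨁ : ∀ {a} {A : Set a} → List A → (A → Carrier) → Carrier
  ⨁ xs f = List.foldr (λ x s → f x ∙ s) ε xs

  private
    variable
      a b d : Level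
      A : Set a
      B : Set b
      f g : A → Carrier

  ⨁-cong-∈ : ∀ (xs : List A) → (∀ {x} → x ∈ xs → f x ≈ g x) → ⨁ xs f ≈ ⨁ xs g
  ⨁-cong-∈ []       f≈g = reflexive refl
  ⨁-cong-∈ (x ∷ xs) f≈g = ∙-cong (f≈g (here refl)) (⨁-cong-∈ xs (λ x∈ → f≈g (there x∈)))

  ⨁-cong : ∀ (xs : List A) → (∀ x → f x ≈ g x) → ⨁ xs f ≈ ⨁ xs g
  ⨁-cong xs f≈g = ⨁-cong-∈ xs (λ {x} _ → f≈g x)

  ⨁-ε : ∀ (xs : List A) → (∀ {x} → x ∈ xs → f x ≈ ε) → ⨁ xs f ≈ ε
  ⨁-ε []       f≈ε = reflexive refl
  ⨁-ε (x ∷ xs) f≈ε = trans (∙-cong (f≈ε (here refl)) (⨁-ε xs (λ x∈ → f≈ε (there x∈)))) (identityˡ ε)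

  ⨁-++ : ∀ (xs ys : List A) f → ⨁ (xs ++ ys) f ≈ ⨁ xs f ∙ ⨁ ys f
  ⨁-++ []       ys f = sym (identityˡ _)
  ⨁-++ (x ∷ xs) ys f = trans (∙-congˡ (⨁-++ xs ys f)) (sym (assoc _ _ _))

  ⨁-map : ∀ (h : A → B) (xs : List A) f → ⨁ (map h xs) f ≈ ⨁ xs (λ x → f (h x))
  ⨁-map h []       f = reflexive refl
  ⨁-map h (x ∷ xs) f = ∙-congˡ (⨁-map h xs f)

  ⨁-tabulate : ∀ {m} (σ : Fin m → A) f → ⨁ (List.tabulate σ) f ≈ ⨁ (allFin m) (λ i → f (σ i))
  ⨁-tabulate {m = m} σ f = trans (reflexive (≡.cong (λ xs → ⨁ xs f) (≡.sym (Listₚ.map-tabulate (λ i → i) σ))))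
    (⨁-map σ (allFin m) f)

  ⨁-concatMap : ∀ (h : A → List B) (xs : List A) f →
                ⨁ (concatMap h xs) f ≈ ⨁ xs (λ x → ⨁ (h x) f)
  ⨁-concatMap h []       f = reflexive refl
  ⨁-concatMap h (x ∷ xs) f = trans (⨁-++ (h x) (concatMap h xs) f) (∙-congˡ (⨁-concatMap h xs f))

  ⨁-cartesian : ∀ {C : Set d} (h : A → B → C) (xs : List A) (ys : List B) f →
                ⨁ (cartesianProductWith h xs ys) f ≈ ⨁ xs (λ x → ⨁ ys (λ y → f (h x y)))
  ⨁-cartesian h []       ys f = reflexive refl
  ⨁-cartesian h (x ∷ xs) ys f =
    trans (⨁-++ (map (h x) ys) _ f) (∙-cong (⨁-map (h x) ys f) (⨁-cartesian h xs ys f))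

  ⨁-∙ : ∀ (xs : List A) f g → ⨁ xs (λ x → f x ∙ g x) ≈ ⨁ xs f ∙ ⨁ xs g
  ⨁-∙ []       f g = sym (identityˡ ε)
  ⨁-∙ (x ∷ xs) f g = trans (∙-congˡ (⨁-∙ xs f g)) (interchange _ _ _ _)

  ⨁-swap : ∀ (xs : List A) (ys : List B) (f : A → B → Carrier) →
           ⨁ xs (λ x → ⨁ ys (f x)) ≈ ⨁ ys (λ y → ⨁ xs (λ x → f x y))
  ⨁-swap []       ys f = sym (⨁-ε ys (λ _ → reflexive refl))
  ⨁-swap (x ∷ xs) ys f = trans (∙-congˡ (⨁-swap xs ys f)) (sym (⨁-∙ ys (f x) _))

  ⨁-↭ : ∀ {xs ys : List A} → xs ↭ ys → ∀ f → ⨁ xs f ≈ ⨁ ys f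
  ⨁-↭ Perm.refl         f = reflexive refl
  ⨁-↭ (Perm.prep x p)   f = ∙-congˡ (⨁-↭ p f)
  ⨁-↭ (Perm.swap x y p) f = trans (x∙yz≈y∙xz _ _ _) (∙-congˡ (∙-congˡ (⨁-↭ p f)))
  ⨁-↭ (Perm.trans p q)  f = trans (⨁-↭ p f) (⨁-↭ q f)

  ⨁-filter : ∀ {p} {P : Pred A p} (P? : Decidable P) (xs : List A) f →
             ⨁ (filter P? xs) f ≈ ⨁ xs (λ x → if does (P? x) then f x else ε)
  ⨁-filter P? []       f = reflexive refl
  ⨁-filter P? (x ∷ xs) f with does (P? x)
  ... | true  = ∙-congˡ (⨁-filter P? xs f)
  ... | false = trans (⨁-filter P? xs f) (sym (identityˡ _))

  -- Uniqueness lets each entry of `ys` be taken out of `xs` exactly once, and what is left over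
  -- consists of neutral terms. Every passage from a full enumeration to the few terms that matter
  -- goes through this lemma.
  ⨁-support : ∀ {xs ys : List A} → Unique xs → Unique ys → (∀ {y} → y ∈ ys → y ∈ xs) →
              (∀ {x} → x ∈ xs → x ∈ ys ⊎ f x ≈ ε) → ⨁ xs f ≈ ⨁ ys f
  ⨁-support {xs = xs} {[]} _ _ _ zero = ⨁-ε xs (λ x∈ → [ (λ ()) , (λ e → e) ]′ (zero x∈))
  ⨁-support {f = f} {xs = xs} {y ∷ ys} ux uy@(_ ∷ uys) sub zero
    with as , bs , refl ← ∈-∃++ (sub (here refl)) = begin
      ⨁ (as ++ y ∷ bs) f    ≈⟨ ⨁-↭ (shift y as bs) f ⟩
      f y ∙ ⨁ (as ++ bs) f  ≈⟨ ∙-congˡ (⨁-support uab uys sub′ zero′) ⟩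
      f y ∙ ⨁ ys f          ∎
    where
    u : Unique (y ∷ as ++ bs)
    u = Unique-resp-↭ (shift y as bs) ux
    uab : Unique (as ++ bs)
    uab with _ ∷ v ← u = v
    sub′ : ∀ {z} → z ∈ ys → z ∈ as ++ bs
    sub′ z∈ with ∈-resp-↭ (shift y as bs) (sub (there z∈))
    ... | here refl = contradiction z∈ (Unique[x∷xs]⇒x∉xs uy)
    ... | there z∈′ = z∈′
    zero′ : ∀ {z} → z ∈ as ++ bs → z ∈ ys ⊎ f z ≈ ε
    zero′ z∈ with zero (∈-resp-↭ (Perm.↭-sym (shift y as bs)) (there z∈))
    ... | inj₁ (here refl) = contradiction z∈ (Unique[x∷xs]⇒x∉xs u)
    ... | inj₁ (there z∈′) = inj₁ z∈′
    ... | inj₂ e = inj₂ e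

  ⨁-single : ∀ {xs : List A} {y} → Unique xs → y ∈ xs → (∀ {x} → x ∈ xs → x ≡ y ⊎ f x ≈ ε) →
             ⨁ xs f ≈ f y
  ⨁-single {f = f} {y = y} u y∈ zero =
    trans (⨁-support {ys = y ∷ []} u ([] ∷ []) (λ { (here refl) → y∈ })
             (λ x∈ → [ (λ { refl → inj₁ (here refl) }) , inj₂ ]′ (zero x∈)))
          (identityʳ (f y))

-- Weighted counts of spanning trees by contraction

module Trees where
  open import Data.Nat.Base using (ℕ; _+_; _*_; _^_)
  open import Data.Nat.Properties
    using (+-identityʳ; +-cancelˡ-≡; *-zeroʳ; *-identityˡ; *-distribˡ-+; *-distribʳ-+)
  open import Data.Nat.Tactic.RingSolver using (solve-∀)
  open ≡ using (cong; cong₂; sym; trans)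
  open ≡.≡-Reasoning
  module Sum = BigOperator ℕₚ.+-0-commutativeMonoid
  open Sum using () renaming (⨁ to ∑) public

  *-congˡ : ∀ {x y z} → y ≡ z → x * y ≡ x * z
  *-congˡ {x} = cong (x *_)

  *-congʳ : ∀ {x y z} → y ≡ z → y * x ≡ z * x
  *-congʳ {x} = cong (_* x)

  +-congˡ : ∀ {x y z} → y ≡ z → x + y ≡ x + z
  +-congˡ {x} = cong (x +_)

  +-congʳ : ∀ {x y z} → y ≡ z → y + x ≡ z + x
  +-congʳ {x} = cong (_+ x)

  ∑-*ˡ : ∀ {a} {A : Set a} (x : ℕ) (xs : List A) f → x * ∑ xs f ≡ ∑ xs (λ y → x * f y)
  ∑-*ˡ x []       f = *-zeroʳ x
  ∑-*ˡ x (y ∷ ys) f = trans (*-distribˡ-+ x (f y) _) (cong (x * f y +_) (∑-*ˡ x ys f))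

  ∑-*ʳ : ∀ {a} {A : Set a} (x : ℕ) (xs : List A) f → ∑ xs f * x ≡ ∑ xs (λ y → f y * x)
  ∑-*ʳ x []       f = refl
  ∑-*ʳ x (y ∷ ys) f = trans (*-distribʳ-+ x (f y) _) (cong (f y * x +_) (∑-*ʳ x ys f))

  module _ {n : ℕ} where
    δ : Fin n → Fin n → ℕ
    δ i j = if does (i ≟ j) then 1 else 0

    δ-refl : ∀ i → δ i i ≡ 1
    δ-refl i rewrite dec-true (i ≟ i) refl = refl

    δ-≢ : ∀ {i j} → i ≢ j → δ i j ≡ 0
    δ-≢ {i} {j} i≢j rewrite dec-false (i ≟ j) i≢j = refl

    δ-sym : ∀ i j → δ i j ≡ δ j i
    δ-sym i j with i ≟ j
    ... | yes refl = sym (δ-refl i)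
    ... | no i≢j   = sym (δ-≢ (λ e → i≢j (sym e)))

    ∑-δ : ∀ {xs j} → Unique xs → j ∈ xs → (f : Fin n → ℕ) → ∑ xs (λ i → δ i j * f i) ≡ f j
    ∑-δ {xs} {j} u j∈ f = trans (Sum.⨁-single u j∈ zero′) (trans (cong (_* f j) (δ-refl j)) (*-identityˡ (f j)))
      where
      zero′ : ∀ {i} → i ∈ xs → i ≡ j ⊎ δ i j * f i ≡ 0
      zero′ {i} _ with i ≟ j
      ... | yes i≡j = inj₁ i≡j
      ... | no _    = inj₂ refl

    Weights : Set
    Weights = Fin n → Fin n → ℕ

    -- The column of `u` may stay as it is: after the contraction `u` has left the list of vertices,
    -- so `trees` no longer reads it.
    contract : Fin n → Fin n → Weights → Weights
    contract u w e i j = e i j + δ j w * e i u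

    -- The weighted number of spanning trees of U ∪ {v} oriented towards v: after choosing the
    -- successor w of u, the arcs into u become arcs into w.
    trees : Fin n → List (Fin n) → Weights → ℕ
    trees v []      e = 1
    trees v (u ∷ U) e = ∑ (v ∷ U) (λ w → e u w * trees v U (contract u w e))

    trees-cong : ∀ {v} U {e e′ : Weights} → (∀ {i} → i ∈ U → ∀ j → e i j ≡ e′ i j) →
                 trees v U e ≡ trees v U e′
    trees-cong []      eq = refl
    trees-cong {v} (u ∷ U) eq = Sum.⨁-cong (v ∷ U) λ w →
      cong₂ _*_ (eq (here refl) w)
        (trees-cong U λ i∈ j → cong₂ _+_ (eq (there i∈) j) (cong (δ j w *_) (eq (there i∈) u)))

    -- Each tree uses exactly one arc leaving `u`, so the count is additive in row `u`. In the
    -- recursion, contracting another vertex changes row `u` only by entries of row `u`, and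
    -- linearly; this plays the part of the multilinearity of a determinant.
    trees-+ : ∀ {v U u} {e e₁ e₂ : Weights} → Unique U → u ∈ U →
              (∀ j → e u j ≡ e₁ u j + e₂ u j) →
              (∀ i → i ≢ u → ∀ j → e i j ≡ e₁ i j × e i j ≡ e₂ i j) →
              trees v U e ≡ trees v U e₁ + trees v U e₂
    trees-+ {v} {u ∷ U} {u} {e} {e₁} {e₂} uu (here refl) row other = begin
      ∑ (v ∷ U) (λ w → e u w * trees v U (contract u w e))
        ≡⟨ Sum.⨁-cong (v ∷ U) (λ w → trans (*-congʳ (row w)) (trans (*-distribʳ-+ _ (e₁ u w) _)
             (cong₂ _+_ (cong (e₁ u w *_) (same proj₁ w)) (cong (e₂ u w *_) (same proj₂ w))))) ⟩
      ∑ (v ∷ U) (λ w → e₁ u w * trees v U (contract u w e₁) + e₂ u w * trees v U (contract u w e₂))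
        ≡⟨ Sum.⨁-∙ (v ∷ U) (λ w → e₁ u w * trees v U (contract u w e₁)) _ ⟩
      _ ∎
      where
      same : ∀ {e′ : Weights} → (∀ {i j} → e i j ≡ e₁ i j × e i j ≡ e₂ i j → e i j ≡ e′ i j) →
             ∀ w → trees v U (contract u w e) ≡ trees v U (contract u w e′)
      same pr w = trees-cong U λ {i} i∈ j →
        let i≢u = λ { refl → Unique[x∷xs]⇒x∉xs uu i∈ } in
        cong₂ _+_ (pr (other i i≢u j)) (cong (δ j w *_) (pr (other i i≢u u)))
    trees-+ {v} {u′ ∷ U} {u} {e} {e₁} {e₂} uu@(_ ∷ uU) (there u∈) row other = begin
      ∑ (v ∷ U) (λ w → e u′ w * trees v U (contract u′ w e))
        ≡⟨ Sum.⨁-cong (v ∷ U) (λ w → trans (cong (e u′ w *_) (ih w)) (trans (*-distribˡ-+ (e u′ w) _ _)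
             (cong₂ _+_ (*-congʳ (proj₁ (other u′ u′≢u w))) (*-congʳ (proj₂ (other u′ u′≢u w)))))) ⟩
      ∑ (v ∷ U) (λ w → e₁ u′ w * trees v U (contract u′ w e₁) + e₂ u′ w * trees v U (contract u′ w e₂))
        ≡⟨ Sum.⨁-∙ (v ∷ U) (λ w → e₁ u′ w * trees v U (contract u′ w e₁)) _ ⟩
      _ ∎
      where
      u′≢u : u′ ≢ u
      u′≢u refl = Unique[x∷xs]⇒x∉xs uu u∈
      lem : ∀ a b c d x → a + b + x * (c + d) ≡ a + x * c + (b + x * d)
      lem = solve-∀
      ih : ∀ w → trees v U (contract u′ w e) ≡ trees v U (contract u′ w e₁) + trees v U (contract u′ w e₂)
      ih w = trees-+ uU u∈
        (λ j → trans (cong₂ (λ x y → x + δ j w * y) (row j) (row u′)) (lem (e₁ u j) (e₂ u j) _ _ (δ j w)))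
        (λ i i≢u j → cong₂ (λ x y → x + δ j w * y) (proj₁ (other i i≢u j)) (proj₁ (other i i≢u u′))
                   , cong₂ (λ x y → x + δ j w * y) (proj₂ (other i i≢u j)) (proj₂ (other i i≢u u′)))

    -- A zero row is the sum of two copies of itself, so by additivity the count equals its own
    -- double.
    trees-zero-row : ∀ {v U u} {e : Weights} → Unique U → u ∈ U → (∀ j → e u j ≡ 0) → trees v U e ≡ 0
    trees-zero-row {v} {U} {u} {e} uU u∈ row = +-cancelˡ-≡ (trees v U e) _ _ (sym (trans (+-identityʳ _)
      (trees-+ uU u∈ (λ j → trans (row j) (sym (cong₂ _+_ (row j) (row j)))) (λ _ _ _ → refl , refl))))

    setRow : Fin n → (Fin n → ℕ) → Weights → Weights
    setRow u r e i j = if does (i ≟ u) then r j else e i j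

    setRow-≡ : ∀ u r e j → setRow u r e u j ≡ r j
    setRow-≡ u r e j rewrite dec-true (u ≟ u) refl = refl

    setRow-≢ : ∀ {u i} r e j → i ≢ u → setRow u r e i j ≡ e i j
    setRow-≢ {u} {i} r e j i≢u rewrite dec-false (i ≟ u) i≢u = refl

    -- With no arcs into it, `u` is a leaf of every tree, and its outgoing arc can be chosen freely.
    -- In the induction the vertex `x` before `u` is contracted into some `w`; this diverts the arc
    -- from `u` to `x` towards `w` and preserves the row sum of `u`.
    trees-drop : ∀ {v} xs {u ys} {e : Weights} → Unique (v ∷ xs ++ u ∷ ys) →
                 (∀ {i} → i ∈ xs ++ ys → e i u ≡ 0) →
                 trees v (xs ++ u ∷ ys) e ≡ ∑ (v ∷ xs ++ ys) (e u) * trees v (xs ++ ys) e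
    trees-drop {v} [] {u} {ys} {e} un col = begin
      ∑ (v ∷ ys) (λ w → e u w * trees v ys (contract u w e))
        ≡⟨ Sum.⨁-cong (v ∷ ys) (λ w → cong (e u w *_) (trees-cong ys λ {i} i∈ j →
             trans (cong (λ x → e i j + δ j w * x) (col i∈))
                   (trans (cong (e i j +_) (*-zeroʳ (δ j w))) (+-identityʳ _)))) ⟩
      ∑ (v ∷ ys) (λ w → e u w * trees v ys e)
        ≡⟨ ∑-*ʳ _ (v ∷ ys) (e u) ⟨
      _ ∎
    trees-drop {v} (x ∷ xs) {u} {ys} {e} un@(v∉ ∷ x∉ ∷ uxs) col = begin
      ∑ (v ∷ xs ++ u ∷ ys) T
        ≡⟨ Sum.⨁-↭ (shift u (v ∷ xs) ys) T ⟩
      T u + ∑ (v ∷ xs ++ ys) T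
        ≡⟨ cong (_+ ∑ (v ∷ xs ++ ys) T) (*-congʳ (col (here refl))) ⟩
      ∑ (v ∷ xs ++ ys) T
        ≡⟨ Sum.⨁-cong-∈ (v ∷ xs ++ ys) term ⟩
      ∑ (v ∷ xs ++ ys) (λ w → R * (e x w * trees v (xs ++ ys) (contract x w e)))
        ≡⟨ ∑-*ˡ R (v ∷ xs ++ ys) (λ w → e x w * trees v (xs ++ ys) (contract x w e)) ⟨
      R * trees v (x ∷ xs ++ ys) e
        ∎
      where
      T : Fin n → ℕ
      T w = e x w * trees v (xs ++ u ∷ ys) (contract x w e)
      R : ℕ
      R = ∑ (v ∷ x ∷ xs ++ ys) (e u)
      un′ : Unique (v ∷ xs ++ u ∷ ys)
      un′ = All.tail v∉ ∷ uxs
      un″ : Unique (u ∷ v ∷ xs ++ ys)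
      un″ = Unique-resp-↭ (shift u (v ∷ xs) ys) un′
      uvxy : Unique (v ∷ xs ++ ys)
      uvxy with _ ∷ q ← un″ = q
      lem : ∀ a b c → a + (b + c) ≡ a + c + b
      lem = solve-∀
      lem₂ : ∀ a b c → a * (b * c) ≡ b * (a * c)
      lem₂ = solve-∀
      row-sum : ∀ {w} → w ∈ v ∷ xs ++ ys → ∑ (v ∷ xs ++ ys) (contract x w e u) ≡ R
      row-sum {w} w∈ = begin
        ∑ (v ∷ xs ++ ys) (λ z → e u z + δ z w * e u x)
          ≡⟨ Sum.⨁-∙ (v ∷ xs ++ ys) (e u) _ ⟩
        e u v + ∑ (xs ++ ys) (e u) + ∑ (v ∷ xs ++ ys) (λ z → δ z w * e u x)
          ≡⟨ cong (e u v + ∑ (xs ++ ys) (e u) +_) (∑-δ uvxy w∈ (λ _ → e u x)) ⟩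
        e u v + ∑ (xs ++ ys) (e u) + e u x
          ≡⟨ lem (e u v) (e u x) _ ⟨
        R ∎
      term : ∀ {w} → w ∈ v ∷ xs ++ ys → T w ≡ R * (e x w * trees v (xs ++ ys) (contract x w e))
      term {w} w∈ = begin
        e x w * trees v (xs ++ u ∷ ys) (contract x w e)
          ≡⟨ cong (e x w *_) (trees-drop xs {e = contract x w e} un′ λ {i} i∈ →
               cong₂ _+_ (col (there i∈)) (cong (_* e i x) (δ-≢ {u} {w} λ { refl → Unique[x∷xs]⇒x∉xs un″ w∈ }))) ⟩
        e x w * (∑ (v ∷ xs ++ ys) (contract x w e u) * trees v (xs ++ ys) (contract x w e))
          ≡⟨ cong (λ r → e x w * (r * trees v (xs ++ ys) (contract x w e))) (row-sum w∈) ⟩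
        e x w * (R * trees v (xs ++ ys) (contract x w e))
          ≡⟨ lem₂ (e x w) R _ ⟩
        _ ∎

    -- The step from `u` to the root has weight 0. A step to another vertex `w` redirects arcs to
    -- `w` only, so the column of the root stays zero down to the last vertex, which has nowhere but
    -- the root to go.
    trees-isolated : ∀ {v u U} {e : Weights} → Unique (v ∷ u ∷ U) → (∀ {i} → i ∈ u ∷ U → e i v ≡ 0) →
                     trees v (u ∷ U) e ≡ 0
    trees-isolated {v} {u} {U} {e} ((_ ∷ v∉) ∷ _ ∷ uU) col =
      Sum.⨁-ε (v ∷ U) (λ { (here refl) → *-congʳ (col (here refl)) ; (there w∈) → step U uU v∉ (λ i∈ → col (there i∈)) w∈ })
      where
      step : ∀ U → Unique U → All (v ≢_) U → (∀ {i} → i ∈ U → e i v ≡ 0) →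
             ∀ {w} → w ∈ U → e u w * trees v U (contract u w e) ≡ 0
      step (x ∷ U) uU v∉ col {w} w∈ = trans (cong (e u w *_) (trees-isolated {e = contract u w e} (v∉ ∷ uU)
        (λ {i} i∈ → cong₂ _+_ (col i∈) (cong (_* e i u) (δ-≢ (All.lookup v∉ w∈)))))) (*-zeroʳ (e u w))

    -- Cayley's formula with weights at the heads of the arcs. The weights are needed for the
    -- induction: contracting `u` into `w` adds the weight of `u` to that of `w`, which keeps both
    -- the form of the hypothesis and the total weight.
    trees-uniform : ∀ {v u U} {e : Weights} {c : Fin n → ℕ} → Unique (v ∷ u ∷ U) →
                    (∀ {i j} → i ∈ u ∷ U → j ∈ v ∷ u ∷ U → i ≢ j → e i j ≡ c j) →
                    trees v (u ∷ U) e ≡ c v * ∑ (v ∷ u ∷ U) c ^ length U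
    trees-uniform {v} {u} {[]} {e} {c} ((v≢u ∷ []) ∷ _) eq =
      trans (+-identityʳ _) (*-congʳ (eq (here refl) (here refl) (λ { refl → v≢u refl })))
    trees-uniform {v} {u} {U@(x ∷ U′)} {e} {c} un@((v≢u ∷ v∉) ∷ u∉ ∷ uU) eq = begin
      ∑ (v ∷ U) (λ w → e u w * trees v U (contract u w e))
        ≡⟨ Sum.⨁-cong-∈ (v ∷ U) term ⟩
      ∑ (v ∷ U) (λ w → (c w * c v + δ w v * (c w * c u)) * s ^ length U′)
        ≡⟨ ∑-*ʳ _ (v ∷ U) (λ w → c w * c v + δ w v * (c w * c u)) ⟨
      ∑ (v ∷ U) (λ w → c w * c v + δ w v * (c w * c u)) * s ^ length U′
        ≡⟨ cong (_* s ^ length U′) (trans (Sum.⨁-∙ (v ∷ U) (λ w → c w * c v) _)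
             (cong₂ _+_ (sym (∑-*ʳ (c v) (v ∷ U) c)) (∑-δ (v∉ ∷ uU) (here refl) (λ w → c w * c u)))) ⟩
      (∑ (v ∷ U) c * c v + c v * c u) * s ^ length U′
        ≡⟨ lem (c v) (∑ U c) (c u) (s ^ length U′) ⟩
      c v * (s * s ^ length U′) ∎
      where
      s : ℕ
      s = ∑ (v ∷ u ∷ U) c
      lem : ∀ a b d p → ((a + b) * a + a * d) * p ≡ a * ((a + (d + b)) * p)
      lem = solve-∀
      lem₂ : ∀ a b d q t → a * ((b + q * d) * t) ≡ (a * b + q * (a * d)) * t
      lem₂ = solve-∀
      lem₃ : ∀ a b d → a + b + d ≡ a + (d + b)
      lem₃ = solve-∀
      u∉vU : ∀ {w} → w ∈ v ∷ U → u ≢ w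
      u∉vU (here refl) = λ { refl → v≢u refl }
      u∉vU (there w∈)  = All.lookup u∉ w∈
      ⊂ : ∀ {w} → w ∈ v ∷ U → w ∈ v ∷ u ∷ U
      ⊂ (here refl) = here refl
      ⊂ (there w∈)  = there (there w∈)
      term : ∀ {w} → w ∈ v ∷ U →
             e u w * trees v U (contract u w e) ≡ (c w * c v + δ w v * (c w * c u)) * s ^ length U′
      term {w} w∈ = begin
        e u w * trees v U (contract u w e)
          ≡⟨ cong₂ _*_ (eq (here refl) (⊂ w∈) (u∉vU w∈))
               (trees-uniform {c = λ j → c j + δ j w * c u} (v∉ ∷ uU) λ {i} {j} i∈ j∈ i≢j →
                  cong₂ (λ p q → p + δ j w * q) (eq (there i∈) (⊂ j∈) i≢j)
                    (eq (there i∈) (there (here refl)) (λ { refl → All.lookup u∉ i∈ refl }))) ⟩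
        c w * ((c v + δ v w * c u) * ∑ (v ∷ U) (λ j → c j + δ j w * c u) ^ length U′)
          ≡⟨ cong (λ p → c w * ((c v + δ v w * c u) * p ^ length U′))
               (trans (Sum.⨁-∙ (v ∷ U) c _) (trans (cong (∑ (v ∷ U) c +_) (∑-δ (v∉ ∷ uU) w∈ (λ _ → c u)))
                 (lem₃ (c v) (∑ U c) (c u)))) ⟩
        c w * ((c v + δ v w * c u) * s ^ length U′)
          ≡⟨ cong (λ q → c w * ((c v + q * c u) * s ^ length U′)) (δ-sym v w) ⟩
        c w * ((c v + δ w v * c u) * s ^ length U′)
          ≡⟨ lem₂ (c w) (c v) (c u) (δ w v) _ ⟩
        _ ∎

-- Walks through a list of arcs: balance, reachability, removal of an arc

module Walks where
  open Trees
  open import Data.Nat.Base using (ℕ; zero; suc; _+_; _*_)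
  open import Data.Nat.Properties
    using (+-assoc; +-comm; +-cancelˡ-≡; *-zeroʳ; *-identityˡ; *-distribˡ-+; m+n≡0⇒m≡0; m+n≡0⇒n≡0)
  open import Data.Nat.Tactic.RingSolver using (solve-∀)
  open ≡ using (cong; cong₂; sym; trans)
  open ≡.≡-Reasoning
  module Prod = BigOperator ℕₚ.*-1-commutativeMonoid
  open Prod using () renaming (⨁ to ∏) public

  ∑≡0⇒≡0 : ∀ {a} {A : Set a} {xs : List A} {f : A → ℕ} → ∑ xs f ≡ 0 → ∀ {x} → x ∈ xs → f x ≡ 0
  ∑≡0⇒≡0 {xs = x ∷ xs} {f} eq (here refl) = m+n≡0⇒m≡0 (f x) eq
  ∑≡0⇒≡0 {xs = x ∷ xs} {f} eq (there x∈)  = ∑≡0⇒≡0 (m+n≡0⇒n≡0 (f x) eq) x∈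

  picks : ∀ {a} {A : Set a} → List A → List (A × List A)
  picks []       = []
  picks (x ∷ xs) = (x , xs) ∷ map (map₂ (x ∷_)) (picks xs)

  module _ {a} {A : Set a} where
    picks-↭ : ∀ {xs ys : List A} {x} → (x , ys) ∈ picks xs → x ∷ ys ↭ xs
    picks-↭ {_ ∷ xs} (here refl) = Perm.refl
    picks-↭ {z ∷ xs} {x = x} (there p) with (_ , ws) , q , refl ← ∈-map⁻ (map₂ (z ∷_)) p =
      Perm.trans (Perm.swap x z Perm.refl) (Perm.prep z (picks-↭ q))

    ∑-picks : ∀ (xs : List A) (f : A → ℕ) → ∑ (picks xs) (λ x → f (proj₁ x)) ≡ ∑ xs f
    ∑-picks []       f = refl
    ∑-picks (x ∷ xs) f = cong (f x +_) (trans (Sum.⨁-map (map₂ (x ∷_)) (picks xs) _) (∑-picks xs f))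

    ∑-picks-resp-↭ : ∀ {xs ys : List A} → xs ↭ ys → (g : A × List A → ℕ) →
                     (∀ x {zs ws} → zs ↭ ws → g (x , zs) ≡ g (x , ws)) →
                     ∑ (picks xs) g ≡ ∑ (picks ys) g
    ∑-picks-resp-↭ Perm.refl g resp = refl
    ∑-picks-resp-↭ (Perm.prep {xs} {ys} x p) g resp = cong₂ _+_ (resp x p) (begin
      ∑ (map (map₂ (x ∷_)) (picks xs)) g        ≡⟨ Sum.⨁-map (map₂ (x ∷_)) (picks xs) g ⟩
      ∑ (picks xs) (λ y → g (map₂ (x ∷_) y))    ≡⟨ ∑-picks-resp-↭ p _ (λ y q → resp y (Perm.prep x q)) ⟩
      ∑ (picks ys) (λ y → g (map₂ (x ∷_) y))    ≡⟨ Sum.⨁-map (map₂ (x ∷_)) (picks ys) g ⟨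
      ∑ (map (map₂ (x ∷_)) (picks ys)) g        ∎)
    ∑-picks-resp-↭ (Perm.swap {xs} {ys} x y p) g resp = begin
      g (x , y ∷ xs) + (g (y , x ∷ xs) + ∑ (map (map₂ (x ∷_)) (map (map₂ (y ∷_)) (picks xs))) g)
        ≡⟨ cong₂ _+_ (resp x (Perm.prep y p)) (cong₂ _+_ (resp y (Perm.prep x p)) (begin
             ∑ (map (map₂ (x ∷_)) (map (map₂ (y ∷_)) (picks xs))) g
               ≡⟨ two x y xs ⟩
             ∑ (picks xs) (λ z → g (map₂ (λ zs → x ∷ y ∷ zs) z))
               ≡⟨ ∑-picks-resp-↭ p _ (λ z q → resp z (Perm.prep x (Perm.prep y q))) ⟩
             ∑ (picks ys) (λ z → g (map₂ (λ zs → x ∷ y ∷ zs) z))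
               ≡⟨ Sum.⨁-cong (picks ys) (λ z → resp (proj₁ z) (Perm.swap x y Perm.refl)) ⟩
             ∑ (picks ys) (λ z → g (map₂ (λ zs → y ∷ x ∷ zs) z))
               ≡⟨ two y x ys ⟨
             _ ∎)) ⟩
      g (x , y ∷ ys) + (g (y , x ∷ ys) + rest)
        ≡⟨ lem (g (x , y ∷ ys)) (g (y , x ∷ ys)) rest ⟩
      g (y , x ∷ ys) + (g (x , y ∷ ys) + rest) ∎
      where
      rest : ℕ
      rest = ∑ (map (map₂ (y ∷_)) (map (map₂ (x ∷_)) (picks ys))) g
      lem : ∀ a b c → a + (b + c) ≡ b + (a + c)
      lem = solve-∀
      two : ∀ x y xs → ∑ (map (map₂ (x ∷_)) (map (map₂ (y ∷_)) (picks xs))) g ≡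
                       ∑ (picks xs) (λ z → g (map₂ (λ zs → x ∷ y ∷ zs) z))
      two x y xs = trans (Sum.⨁-map (map₂ (x ∷_)) (map (map₂ (y ∷_)) (picks xs)) g)
                         (Sum.⨁-map (map₂ (y ∷_)) (picks xs) _)
    ∑-picks-resp-↭ (Perm.trans p q) g resp =
      trans (∑-picks-resp-↭ p g resp) (∑-picks-resp-↭ q g resp)

  Arc : ℕ → Set
  Arc n = Fin n × Fin n

  module _ {n : ℕ} where
    outdegree indegree : List (Arc n) → Fin n → ℕ
    outdegree D i = ∑ D (λ a → δ i (proj₁ a))
    indegree  D i = ∑ D (λ a → δ i (proj₂ a))

    mult : List (Arc n) → Weights {n}
    mult D i j = ∑ D (λ a → δ i (proj₁ a) * δ j (proj₂ a))

    -- The number of walks from u to v of length N traversing every arc of D exactly once,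
    -- where parallel arcs are told apart.
    walks : ℕ → List (Arc n) → Fin n → Fin n → ℕ
    walks zero    []      u v = δ u v
    walks zero    (_ ∷ _) u v = 0
    walks (suc N) D       u v =
      ∑ (picks D) (λ x → δ u (proj₁ (proj₁ x)) * walks N (proj₂ x) (proj₂ (proj₁ x)) v)

    closedWalks : ℕ → List (Arc n) → ℕ
    closedWalks N D = ∑ (allFin n) (λ i → walks N D i i)

    δ-case : ∀ (i j : Fin n) {x y : ℕ} → (i ≡ j → x ≡ y) → δ i j * x ≡ δ i j * y
    δ-case i j f with i ≟ j
    ... | yes i≡j = cong (1 *_) (f i≡j)
    ... | no _    = refl

    δ-case-0 : ∀ (i j : Fin n) {x : ℕ} → (i ≡ j → x ≡ 0) → δ i j * x ≡ 0
    δ-case-0 i j f = trans (δ-case i j f) (*-zeroʳ (δ i j))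

    walks-↭ : ∀ N {D E : List (Arc n)} → D ↭ E → ∀ u v → walks N D u v ≡ walks N E u v
    walks-↭ zero {[]}    {[]}    p u v = refl
    walks-↭ zero {[]}    {_ ∷ _} p u v with () ← ↭-length p
    walks-↭ zero {_ ∷ _} {[]}    p u v with () ← ↭-length p
    walks-↭ zero {_ ∷ _} {_ ∷ _} p u v = refl
    walks-↭ (suc N) p u v = ∑-picks-resp-↭ p _ (λ a q → cong (δ u (proj₁ a) *_) (walks-↭ N q (proj₂ a) v))

    -- One additional arc from `v` back to `u` would make the two degrees of every vertex agree.
    Balanced : Fin n → Fin n → List (Arc n) → Set
    Balanced u v D = ∀ i → outdegree D i + δ i v ≡ indegree D i + δ i u

    outdegree-pick : ∀ {D D′ a} → (a , D′) ∈ picks D → ∀ i → outdegree D i ≡ δ i (proj₁ a) + outdegree D′ i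
    outdegree-pick p i = sym (Sum.⨁-↭ (picks-↭ p) _)

    indegree-pick : ∀ {D D′ a} → (a , D′) ∈ picks D → ∀ i → indegree D i ≡ δ i (proj₂ a) + indegree D′ i
    indegree-pick p i = sym (Sum.⨁-↭ (picks-↭ p) _)

    mult-pick : ∀ {D D′ a} → (a , D′) ∈ picks D → ∀ i j →
                mult D i j ≡ δ i (proj₁ a) * δ j (proj₂ a) + mult D′ i j
    mult-pick p i j = sym (Sum.⨁-↭ (picks-↭ p) _)

    balanced-pick : ∀ {D D′ u w v} → ((u , w) , D′) ∈ picks D → Balanced u v D → Balanced w v D′
    balanced-pick {D} {D′} {u} {w} {v} p bal i = +-cancelˡ-≡ (δ i u) _ _ (begin
      δ i u + (outdegree D′ i + δ i v)  ≡⟨ +-assoc (δ i u) _ _ ⟨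
      δ i u + outdegree D′ i + δ i v    ≡⟨ cong (_+ δ i v) (outdegree-pick p i) ⟨
      outdegree D i + δ i v             ≡⟨ bal i ⟩
      indegree D i + δ i u              ≡⟨ cong (_+ δ i u) (indegree-pick p i) ⟩
      δ i w + indegree D′ i + δ i u     ≡⟨ lem (δ i w) _ (δ i u) ⟩
      δ i u + (indegree D′ i + δ i w)   ∎)
      where
      lem : ∀ a b c → a + b + c ≡ c + (b + a)
      lem = solve-∀

    balanced-unpick : ∀ {D D′ u w v} → ((u , w) , D′) ∈ picks D → Balanced w v D′ → Balanced u v D
    balanced-unpick {D} {D′} {u} {w} {v} p bal i = begin
      outdegree D i + δ i v             ≡⟨ cong (_+ δ i v) (outdegree-pick p i) ⟩
      δ i u + outdegree D′ i + δ i v    ≡⟨ +-assoc (δ i u) _ _ ⟩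
      δ i u + (outdegree D′ i + δ i v)  ≡⟨ cong (δ i u +_) (bal i) ⟩
      δ i u + (indegree D′ i + δ i w)   ≡⟨ lem (δ i w) _ (δ i u) ⟨
      δ i w + indegree D′ i + δ i u     ≡⟨ cong (_+ δ i u) (indegree-pick p i) ⟨
      indegree D i + δ i u              ∎
      where
      lem : ∀ a b c → a + b + c ≡ c + (b + a)
      lem = solve-∀

    -- Balance is decidable and passes back from the rest of the arcs to the whole list, so if it
    -- fails for `D` it fails after every possible first arc.
    walks≡0⊎balanced : ∀ N D u v → walks N D u v ≡ 0 ⊎ Balanced u v D
    walks≡0⊎balanced zero [] u v with u ≟ v
    ... | yes refl = inj₂ (λ i → refl)
    ... | no u≢v   = inj₁ refl
    walks≡0⊎balanced zero (_ ∷ _) u v = inj₁ refl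
    walks≡0⊎balanced (suc N) D u v
      with Finₚ.all? (λ i → outdegree D i + δ i v ℕₚ.≟ indegree D i + δ i u)
    ... | yes bal = inj₂ bal
    ... | no ¬bal = inj₁ (Sum.⨁-ε (picks D) (λ {x} x∈ → δ-case-0 u (proj₁ (proj₁ x)) λ { refl →
            [ (λ e → e) , (λ bal → contradiction (balanced-unpick x∈ bal) ¬bal) ]′
              (walks≡0⊎balanced N (proj₂ x) (proj₂ (proj₁ x)) v) }))

    -- A walk that starts inside `P` cannot leave it, hence never gets to traverse `a`.
    walks-unreachable : ∀ {p} {P : Fin n → Set p} N D u v →
                        (∀ {a} → a ∈ D → P (proj₁ a) → P (proj₂ a)) → P u →
                        ∀ {a} → a ∈ D → ¬ P (proj₁ a) → walks N D u v ≡ 0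
    walks-unreachable zero (_ ∷ _) u v closed Pu a∈ ¬Pa = refl
    walks-unreachable {P = P} (suc N) D u v closed Pu {a} a∈ ¬Pa =
      Sum.⨁-ε (picks D) λ {x} x∈ → δ-case-0 u (proj₁ (proj₁ x)) λ { refl →
        walks-unreachable N (proj₂ x) _ v (λ b∈ → closed (∈-resp-↭ (picks-↭ x∈) (there b∈)))
          (closed (∈-resp-↭ (picks-↭ x∈) (here refl)) Pu) (keep x∈ Pu (∈-resp-↭ (Perm.↭-sym (picks-↭ x∈)) a∈)) ¬Pa }
      where
      keep : ∀ {x} → x ∈ picks D → P (proj₁ (proj₁ x)) → a ∈ proj₁ x ∷ proj₂ x → a ∈ proj₂ x
      keep _ Px (here refl) = contradiction Px ¬Pa
      keep _ Px (there a∈′) = a∈′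

    -- Row `u` of `mult D` is the sum of one unit row for each arc leaving `u`, so additivity in
    -- that row applies arc by arc; the zero row ends the induction.
    trees-setRow-mult : ∀ {v U u e} → Unique U → u ∈ U → ∀ D →
      ∑ D (λ a → δ u (proj₁ a) * trees v U (setRow u (λ j → δ j (proj₂ a)) e)) ≡ trees v U (setRow u (mult D u) e)
    trees-setRow-mult {v} {U} {u} {e} uU u∈ [] = sym (trees-zero-row uU u∈ (setRow-≡ u (λ _ → 0) e))
    trees-setRow-mult {v} {U} {u} {e} uU u∈ ((p , q) ∷ D) =
      trans (cong (δ u p * trees v U (setRow u (λ j → δ j q) e) +_) (trees-setRow-mult uU u∈ D)) (add p)
      where
      add : ∀ p → δ u p * trees v U (setRow u (λ j → δ j q) e) + trees v U (setRow u (mult D u) e) ≡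
                  trees v U (setRow u (mult ((p , q) ∷ D) u) e)
      add p with u ≟ p
      ... | no _     = refl
      ... | yes refl = trans (+-congʳ (*-identityˡ (trees v U (setRow u r₁ e)))) (sym (trees-+ uU u∈
        (λ j → trans (setRow-≡ u r e j) (sym (cong₂ _+_ (trans (setRow-≡ u r₁ e j) (sym (*-identityˡ (δ j q)))) (setRow-≡ u (mult D u) e j))))
        (λ i i≢u j → trans (setRow-≢ r e j i≢u) (sym (setRow-≢ r₁ e j i≢u))
                   , trans (setRow-≢ r e j i≢u) (sym (setRow-≢ (mult D u) e j i≢u)))))
        where
        r r₁ : Fin n → ℕ
        r₁ j = δ j q
        r  j = 1 * δ j q + mult D u j

    trees-setRow-self : ∀ {v u} U (e : Weights {n}) → trees v U (setRow u (e u) e) ≡ trees v U e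
    trees-setRow-self {v} {u} U e = trees-cong U λ {i} _ j → self i j
      where
      self : ∀ i j → setRow u (e u) e i j ≡ e i j
      self i j with i ≟ u
      ... | yes refl = refl
      ... | no _     = refl

    -- For a fixed arc leaving `u`, `trees-+` splits the count into the trees without this arc and
    -- those with it. The second parts add up to all trees by `trees-setRow-mult`. The equation is
    -- kept additive because subtraction on ℕ truncates.
    trees-picks : ∀ {v U u} → Unique U → u ∈ U → ∀ D →
      ∑ (picks D) (λ x → δ u (proj₁ (proj₁ x)) * trees v U (mult (proj₂ x))) + trees v U (mult D) ≡
      outdegree D u * trees v U (mult D)
    trees-picks {v} {U} {u} uU u∈ D = sym (begin
      outdegree D u * T
        ≡⟨ ∑-*ʳ T D (λ a → δ u (proj₁ a)) ⟩
      ∑ D (λ a → δ u (proj₁ a) * T)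
        ≡⟨ ∑-picks D _ ⟨
      ∑ (picks D) (λ x → δ u (proj₁ (proj₁ x)) * T)
        ≡⟨ Sum.⨁-cong-∈ (picks D) (λ {x} x∈ → trans (δ-case u (proj₁ (proj₁ x)) (split x∈))
             (*-distribˡ-+ (δ u (proj₁ (proj₁ x))) (trees v U (mult (proj₂ x))) _)) ⟩
      ∑ (picks D) (λ x → δ u (proj₁ (proj₁ x)) * trees v U (mult (proj₂ x)) + h (proj₁ x))
        ≡⟨ Sum.⨁-∙ (picks D) (λ x → δ u (proj₁ (proj₁ x)) * trees v U (mult (proj₂ x))) _ ⟩
      ∑ (picks D) (λ x → δ u (proj₁ (proj₁ x)) * trees v U (mult (proj₂ x))) + ∑ (picks D) (λ x → h (proj₁ x))
        ≡⟨ +-congˡ (trans (∑-picks D h) (trans (trees-setRow-mult uU u∈ D) (trees-setRow-self U (mult D)))) ⟩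
      _ ∎)
      where
      T : ℕ
      T = trees v U (mult D)
      h : Arc n → ℕ
      h a = δ u (proj₁ a) * trees v U (setRow u (λ j → δ j (proj₂ a)) (mult D))
      split : ∀ {x} → x ∈ picks D → u ≡ proj₁ (proj₁ x) →
              T ≡ trees v U (mult (proj₂ x)) + trees v U (setRow u (λ j → δ j (proj₂ (proj₁ x))) (mult D))
      split {(_ , w) , D′} x∈ refl = trans (trees-+ uU u∈
        (λ j → trans (mult-pick x∈ u j) (trans
           (cong (_+ mult D′ u j) (trans (cong (_* δ j w) (δ-refl u)) (*-identityˡ (δ j w))))
           (cong (_+ mult D′ u j) (sym (setRow-≡ u (λ j → δ j w) (mult D) j)))))
        (λ i i≢u j → sym (setRow-≢ (λ j → δ j w) (mult D) j i≢u)
                   , trans (mult-pick x∈ i j) (cong (_+ mult D′ i j) (cong (_* δ j w) (δ-≢ i≢u)))))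
        (+-comm (trees v U (setRow u (λ j → δ j w) (mult D))) _)

  -- Carries the walks of a clique over to a digraph on a fixed vertex set, which is why their
  -- number is the same for every clique.
  walks-relabel : ∀ {n n′} (σ : Fin n → Fin n′) → (∀ {i j} → σ i ≡ σ j → i ≡ j) → ∀ N D u v →
                  walks N (map (λ a → σ (proj₁ a) , σ (proj₂ a)) D) (σ u) (σ v) ≡ walks N D u v
  walks-relabel {n} {n′} σ inj = go
    where
    δ-σ : ∀ i j → δ (σ i) (σ j) ≡ δ i j
    δ-σ i j with i ≟ j
    ... | yes refl = δ-refl (σ i)
    ... | no i≢j   = δ-≢ (λ e → i≢j (inj e))
    σ² : Arc n → Arc n′
    σ² a = σ (proj₁ a) , σ (proj₂ a)
    ∑-picks-map : ∀ D (g : Arc n′ × List (Arc n′) → ℕ) →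
                  ∑ (picks (map σ² D)) g ≡ ∑ (picks D) (λ x → g (σ² (proj₁ x) , map σ² (proj₂ x)))
    ∑-picks-map []      g = refl
    ∑-picks-map (a ∷ D) g = +-congˡ (begin
      ∑ (map (map₂ (σ² a ∷_)) (picks (map σ² D))) g
        ≡⟨ Sum.⨁-map (map₂ (σ² a ∷_)) (picks (map σ² D)) g ⟩
      ∑ (picks (map σ² D)) (λ x → g (map₂ (σ² a ∷_) x))
        ≡⟨ ∑-picks-map D (λ x → g (map₂ (σ² a ∷_) x)) ⟩
      ∑ (picks D) (λ x → g (σ² (proj₁ x) , σ² a ∷ map σ² (proj₂ x)))
        ≡⟨ Sum.⨁-map (map₂ (a ∷_)) (picks D) _ ⟨
      _ ∎)
    go : ∀ N D u v → walks N (map σ² D) (σ u) (σ v) ≡ walks N D u v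
    go zero    []      u v = δ-σ u v
    go zero    (_ ∷ _) u v = refl
    go (suc N) D       u v = trans (∑-picks-map D _) (Sum.⨁-cong (picks D) λ x →
      cong₂ _*_ (δ-σ u (proj₁ (proj₁ x))) (go N (proj₂ x) (proj₂ (proj₁ x)) v))

-- The BEST theorem and its case of a complete digraph

module Euler where
  open Trees
  open Walks
  open import Data.Nat.Base using (ℕ; zero; suc; _+_; _*_; _^_; _∸_; _!)
  open import Data.Nat.Properties
    using (+-identityʳ; +-comm; +-cancelʳ-≡; *-assoc; *-zeroʳ; *-identityˡ; *-identityʳ; suc-injective)
  open import Data.Nat.Tactic.RingSolver using (solve-∀)
  open ≡ using (cong; cong₂; sym; trans)
  open ≡.≡-Reasoning

  ∑-1 : ∀ {a} {A : Set a} (xs : List A) → ∑ xs (λ _ → 1) ≡ length xs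
  ∑-1 []       = refl
  ∑-1 (x ∷ xs) = cong suc (∑-1 xs)

  module _ {n : ℕ} where
    outdegree≡0 : ∀ {D : List (Arc n)} {i} → outdegree D i ≡ 0 → ∀ {a} → a ∈ D → proj₁ a ≢ i
    outdegree≡0 {i = i} eq a∈ refl with () ← trans (sym (δ-refl i)) (∑≡0⇒≡0 eq a∈)

    indegree≡0 : ∀ {D : List (Arc n)} {i} → indegree D i ≡ 0 → ∀ {a} → a ∈ D → proj₂ a ≢ i
    indegree≡0 {i = i} eq a∈ refl with () ← trans (sym (δ-refl i)) (∑≡0⇒≡0 eq a∈)

    indegree≡0⇒mult≡0 : ∀ (D : List (Arc n)) {j} → indegree D j ≡ 0 → ∀ i → mult D i j ≡ 0
    indegree≡0⇒mult≡0 D eq i = Sum.⨁-ε D λ {a} a∈ →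
      trans (cong (δ i (proj₁ a) *_) (∑≡0⇒≡0 eq a∈)) (*-zeroʳ (δ i (proj₁ a)))

    ∑-picks-δ : ∀ (D : List (Arc n)) u x → ∑ (picks D) (λ y → δ u (proj₁ (proj₁ y)) * x) ≡ outdegree D u * x
    ∑-picks-δ D u x = trans (∑-picks D (λ a → δ u (proj₁ a) * x)) (sym (∑-*ʳ x D (λ a → δ u (proj₁ a))))

    length-pick : ∀ {N} {D D′ : List (Arc n)} {a} → (a , D′) ∈ picks D → length D ≡ suc N → length D′ ≡ N
    length-pick p eq = suc-injective (trans (↭-length (picks-↭ p)) eq)

    -- The BEST theorem, by induction on the length: removing an arc leaving u subtracts from the
    -- tree count the trees using that arc, and these add up to all trees.
    euler : ∀ N (D : List (Arc n)) U u v → length D ≡ N → Unique (v ∷ U) → u ∈ v ∷ U →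
            (∀ {a} → a ∈ D → proj₁ a ∈ v ∷ U × proj₂ a ∈ v ∷ U) →
            (∀ {i} → i ∈ U → outdegree D i ≢ 0) → Balanced u v D →
            walks N D u v ≡ outdegree D v ! * ∏ U (λ i → (outdegree D i ∸ 1) !) * trees v U (mult D)
    euler zero [] []      u v len un (here refl) arcs pos bal = δ-refl v
    euler zero [] (x ∷ U) u v len un u∈ arcs pos bal = contradiction refl (pos (here refl))
    -- From the root: the arcs leaving `v` lie in no tree, so removing the first arc changes only
    -- the factorial of `v`.
    euler (suc N) D U u v len un@(v∉ ∷ uU) (here refl) arcs pos bal = begin
      walks (suc N) D v v
        ≡⟨ Sum.⨁-cong-∈ (picks D) (λ {x} x∈ → δ-case v (proj₁ (proj₁ x)) (term x∈)) ⟩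
      ∑ (picks D) (λ x → δ v (proj₁ (proj₁ x)) * ((outdegree D v ∸ 1) ! * Π * T))
        ≡⟨ ∑-picks-δ D v _ ⟩
      outdegree D v * ((outdegree D v ∸ 1) ! * Π * T)
        ≡⟨ final (outdegree D v) refl ⟩
      outdegree D v ! * Π * T ∎
      where
      Π T : ℕ
      Π = ∏ U (λ i → (outdegree D i ∸ 1) !)
      T = trees v U (mult D)
      term : ∀ {x} → x ∈ picks D → v ≡ proj₁ (proj₁ x) →
             walks N (proj₂ x) (proj₂ (proj₁ x)) v ≡ (outdegree D v ∸ 1) ! * Π * T
      term {(_ , w) , D′} x∈ refl = begin
        walks N D′ w v
          ≡⟨ euler N D′ U w v (length-pick x∈ len) un (proj₂ (arcs (∈-resp-↭ (picks-↭ x∈) (here refl))))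
               (λ a∈ → arcs (∈-resp-↭ (picks-↭ x∈) (there a∈)))
               (λ i∈ e → pos i∈ (trans (same i∈) e)) (balanced-pick x∈ bal) ⟩
        outdegree D′ v ! * ∏ U (λ i → (outdegree D′ i ∸ 1) !) * trees v U (mult D′)
          ≡⟨ cong₂ _*_ (cong₂ (λ o p → (o ∸ 1) ! * p) (sym out-v) (Prod.⨁-cong-∈ U (λ i∈ → cong (λ o → (o ∸ 1) !) (sym (same i∈)))))
               (trees-cong U (λ {i} i∈ j → sym (trans (mult-pick x∈ i j) (+-congʳ (*-congʳ (δ-≢ (i≢v i∈))))))) ⟩
        (outdegree D v ∸ 1) ! * Π * T ∎
        where
        i≢v : ∀ {i} → i ∈ U → i ≢ v
        i≢v i∈ refl = Unique[x∷xs]⇒x∉xs un i∈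
        same : ∀ {i} → i ∈ U → outdegree D i ≡ outdegree D′ i
        same {i} i∈ = trans (outdegree-pick x∈ i) (+-congʳ (δ-≢ (i≢v i∈)))
        out-v : outdegree D v ≡ suc (outdegree D′ v)
        out-v = trans (outdegree-pick x∈ v) (+-congʳ (δ-refl v))
      final : ∀ o → outdegree D v ≡ o → o * ((o ∸ 1) ! * Π * T) ≡ o ! * Π * T
      final (suc o) _  = trans (sym (*-assoc (suc o) (o ! * Π) T)) (*-congʳ (sym (*-assoc (suc o) (o !) Π)))
      -- Without arcs leaving the root there is no walk, and the tree count has to vanish as well:
      -- by balance no arc enters the root, while the nonempty `D` supplies another vertex, so
      -- `trees-isolated` applies.
      final zero    eq = sym (trans (cong ((1 * Π) *_) (dead U uU v∉ (λ a∈ → arcs a∈))) (*-zeroʳ (1 * Π)))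
        where
        source : ∀ U → (∀ {a} → a ∈ D → proj₁ a ∈ v ∷ U × proj₂ a ∈ v ∷ U) → ∃[ i ] i ∈ U
        source U arcs = go D len (λ a∈ → arcs a∈) (outdegree≡0 eq)
          where
          go : ∀ D → length D ≡ suc N → (∀ {a} → a ∈ D → proj₁ a ∈ v ∷ U × proj₂ a ∈ v ∷ U) →
               (∀ {a} → a ∈ D → proj₁ a ≢ v) → ∃[ i ] i ∈ U
          go (a ∷ _) _ arcs ≢v with proj₁ (arcs (here refl))
          ... | here e   = contradiction e (≢v (here refl))
          ... | there i∈ = proj₁ a , i∈
        dead : ∀ U → Unique U → All (v ≢_) U → (∀ {a} → a ∈ D → proj₁ a ∈ v ∷ U × proj₂ a ∈ v ∷ U) →
               trees v U (mult D) ≡ 0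
        dead []      uU v∉ arcs with () ← proj₂ (source [] arcs)
        dead (x ∷ U) uU v∉ arcs = trees-isolated {e = mult D} (v∉ ∷ uU) (λ {i} _ →
          indegree≡0⇒mult≡0 D {v} (trans (sym (+-cancelʳ-≡ (δ v v) _ _ (bal v))) eq) i)
    euler (suc N) D U u v len un@(v∉ ∷ uU) (there u∈) arcs pos bal
      with xs , ys , refl ← ∈-∃++ u∈ = go (outdegree D u) refl
      where
      u≢v : u ≢ v
      u≢v refl = Unique[x∷xs]⇒x∉xs un u∈
      vU′ : List (Fin n)
      vU′ = v ∷ xs ++ ys
      un′ : Unique (u ∷ vU′)
      un′ = Unique-resp-↭ (shift u (v ∷ xs) ys) un
      uvU′ : Unique vU′
      uvU′ with _ ∷ q ← un′ = q
      ∈vU′ : ∀ {i} → i ∈ v ∷ U → i ≢ u → i ∈ vU′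
      ∈vU′ i∈ i≢u with ∈-resp-↭ (shift u (v ∷ xs) ys) i∈
      ... | here e = contradiction e i≢u
      ... | there i∈′ = i∈′
      ∈U : ∀ {i} → i ∈ xs ++ ys → i ∈ U
      ∈U i∈ = ∈-resp-↭ (Perm.↭-sym (shift u xs ys)) (there i∈)
      Π : ℕ
      Π = ∏ (xs ++ ys) (λ i → (outdegree D i ∸ 1) !)
      i≢u : ∀ {i} → i ∈ vU′ → i ≢ u
      i≢u i∈ refl = Unique[x∷xs]⇒x∉xs un′ i∈
      bal-u : outdegree D u ≡ suc (indegree D u)
      bal-u = begin
        outdegree D u           ≡⟨ +-identityʳ _ ⟨
        outdegree D u + 0       ≡⟨ +-congˡ {outdegree D u} (δ-≢ u≢v) ⟨
        outdegree D u + δ u v   ≡⟨ bal u ⟩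
        indegree D u + δ u u    ≡⟨ +-congˡ {indegree D u} (δ-refl u) ⟩
        indegree D u + 1        ≡⟨ +-comm _ 1 ⟩
        suc (indegree D u)      ∎
      module _ {w D′} (x∈ : ((u , w) , D′) ∈ picks D) where
        same : ∀ {i} → i ≢ u → outdegree D i ≡ outdegree D′ i
        same {i} i≢u = trans (outdegree-pick x∈ i) (+-congʳ (δ-≢ i≢u))
        out-u : outdegree D u ≡ suc (outdegree D′ u)
        out-u = trans (outdegree-pick x∈ u) (+-congʳ (δ-refl u))
        Π-same : ∏ (xs ++ ys) (λ i → (outdegree D′ i ∸ 1) !) ≡ Π
        Π-same = Prod.⨁-cong-∈ (xs ++ ys) λ i∈ → cong (λ o → (o ∸ 1) !) (sym (same (i≢u (there i∈))))
      go : ∀ o → outdegree D u ≡ o →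
           walks (suc N) D u v ≡
             outdegree D v ! * ∏ (xs ++ u ∷ ys) (λ i → (outdegree D i ∸ 1) !) * trees v (xs ++ u ∷ ys) (mult D)
      go zero ou = contradiction ou (pos u∈)
      -- Balance forces indegree 0 at `u`, so the walk never returns and `u` is struck off the list
      -- of vertices. In the tree count this is matched by `trees-drop`, whose row sum is the
      -- outdegree of `u`.
      go (suc zero) ou = begin
        walks (suc N) D u v
          ≡⟨ Sum.⨁-cong-∈ (picks D) (λ {x} x∈ → δ-case u (proj₁ (proj₁ x)) (term x∈)) ⟩
        ∑ (picks D) (λ x → δ u (proj₁ (proj₁ x)) * (outdegree D v ! * Π * trees v (xs ++ ys) (mult D)))
          ≡⟨ ∑-picks-δ D u _ ⟩
        outdegree D u * (outdegree D v ! * Π * trees v (xs ++ ys) (mult D))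
          ≡⟨ lem (outdegree D u) (outdegree D v !) Π _ ⟩
        outdegree D v ! * (1 * Π) * (outdegree D u * trees v (xs ++ ys) (mult D))
          ≡⟨ cong₂ (λ o t → outdegree D v ! * ((o ∸ 1) ! * Π) * t) (sym ou)
               (trans (*-congʳ (sym row)) (sym (trees-drop xs {e = mult D} un (λ {i} _ → indegree≡0⇒mult≡0 D {u} in-u i)))) ⟩
        outdegree D v ! * ((outdegree D u ∸ 1) ! * Π) * trees v (xs ++ u ∷ ys) (mult D)
          ≡⟨ cong (λ p → outdegree D v ! * p * trees v (xs ++ u ∷ ys) (mult D)) (Prod.⨁-↭ (shift u xs ys) (λ i → (outdegree D i ∸ 1) !)) ⟨
        _ ∎
        where
        lem : ∀ o a p t → o * (a * p * t) ≡ a * (1 * p) * (o * t)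
        lem = solve-∀
        in-u : indegree D u ≡ 0
        in-u = suc-injective (trans (sym bal-u) ou)
        row : ∑ vU′ (mult D u) ≡ outdegree D u
        row = trans (Sum.⨁-swap vU′ D _) (Sum.⨁-cong-∈ D λ {a} a∈ → begin
          ∑ vU′ (λ w → δ u (proj₁ a) * δ w (proj₂ a))  ≡⟨ ∑-*ˡ (δ u (proj₁ a)) vU′ (λ w → δ w (proj₂ a)) ⟨
          δ u (proj₁ a) * ∑ vU′ (λ w → δ w (proj₂ a))
            ≡⟨ cong (δ u (proj₁ a) *_) (trans (Sum.⨁-cong vU′ (λ w → sym (*-identityʳ (δ w (proj₂ a)))))
                 (∑-δ uvU′ (∈vU′ (proj₂ (arcs a∈)) (indegree≡0 in-u a∈)) (λ _ → 1))) ⟩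
          δ u (proj₁ a) * 1                             ≡⟨ *-identityʳ _ ⟩
          δ u (proj₁ a)                                 ∎)
        term : ∀ {x} → x ∈ picks D → u ≡ proj₁ (proj₁ x) →
               walks N (proj₂ x) (proj₂ (proj₁ x)) v ≡ outdegree D v ! * Π * trees v (xs ++ ys) (mult D)
        term {(_ , w) , D′} x∈ refl = begin
          walks N D′ w v
            ≡⟨ euler N D′ (xs ++ ys) w v (length-pick x∈ len) uvU′
                 (∈vU′ (proj₂ (arcs (up (here refl)))) (indegree≡0 in-u (up (here refl))))
                 (λ a∈ → ∈vU′ (proj₁ (arcs (up (there a∈)))) (outdegree≡0 (suc-injective (trans (sym (out-u x∈)) ou)) a∈)
                       , ∈vU′ (proj₂ (arcs (up (there a∈)))) (indegree≡0 in-u (up (there a∈))))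
                 (λ i∈ e → pos (∈U i∈) (trans (same x∈ (i≢u (there i∈))) e))
                 (balanced-pick x∈ bal) ⟩
          outdegree D′ v ! * ∏ (xs ++ ys) (λ i → (outdegree D′ i ∸ 1) !) * trees v (xs ++ ys) (mult D′)
            ≡⟨ cong₂ _*_ (cong₂ _*_ (cong _! (sym (same x∈ (λ e → u≢v (sym e))))) (Π-same x∈))
                 (trees-cong (xs ++ ys) (λ {i} i∈ j → sym (trans (mult-pick x∈ i j) (+-congʳ (*-congʳ (δ-≢ (i≢u (there i∈)))))))) ⟩
          outdegree D v ! * Π * trees v (xs ++ ys) (mult D) ∎
          where
          up : ∀ {a} → a ∈ (u , w) ∷ D′ → a ∈ D
          up = ∈-resp-↭ (picks-↭ x∈)
      -- Here `u` still has arcs after the step and remains a vertex. Cancelling one copy of the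
      -- tree count from the o + 2 copies of `trees-picks` leaves the factor that turns `o !` into
      -- `suc o !`.
      go (suc (suc o)) ou = begin
        walks (suc N) D u v
          ≡⟨ Sum.⨁-cong-∈ (picks D) (λ {x} x∈ → trans (δ-case u (proj₁ (proj₁ x)) (term x∈))
               (lem₁ (δ u (proj₁ (proj₁ x))) (outdegree D v !) (o !) Π (trees v U (mult (proj₂ x))))) ⟩
        ∑ (picks D) (λ x → outdegree D v ! * (o ! * Π) * (δ u (proj₁ (proj₁ x)) * trees v U (mult (proj₂ x))))
          ≡⟨ ∑-*ˡ (outdegree D v ! * (o ! * Π)) (picks D) (λ x → δ u (proj₁ (proj₁ x)) * trees v U (mult (proj₂ x))) ⟨
        outdegree D v ! * (o ! * Π) * ∑ (picks D) (λ x → δ u (proj₁ (proj₁ x)) * trees v U (mult (proj₂ x)))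
          ≡⟨ cong (outdegree D v ! * (o ! * Π) *_) (+-cancelʳ-≡ (trees v U (mult D)) _ _ (begin
               _ ≡⟨ trees-picks uU u∈ D ⟩
               outdegree D u * trees v U (mult D) ≡⟨ *-congʳ ou ⟩
               suc (suc o) * trees v U (mult D)   ≡⟨ +-comm (trees v U (mult D)) _ ⟩
               _ ∎)) ⟩
        outdegree D v ! * (o ! * Π) * (suc o * trees v U (mult D))
          ≡⟨ lem₂ (outdegree D v !) (o !) Π (suc o) _ ⟩
        outdegree D v ! * (suc o ! * Π) * trees v U (mult D)
          ≡⟨ cong (λ o → outdegree D v ! * ((o ∸ 1) ! * Π) * trees v U (mult D)) ou ⟨
        outdegree D v ! * ((outdegree D u ∸ 1) ! * Π) * trees v U (mult D)
          ≡⟨ cong (λ p → outdegree D v ! * p * trees v (xs ++ u ∷ ys) (mult D)) (Prod.⨁-↭ (shift u xs ys) (λ i → (outdegree D i ∸ 1) !)) ⟨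
        _ ∎
        where
        lem₁ : ∀ d a f p t → d * (a * (f * p) * t) ≡ a * (f * p) * (d * t)
        lem₁ = solve-∀
        lem₂ : ∀ a f p s t → a * (f * p) * (s * t) ≡ a * (s * f * p) * t
        lem₂ = solve-∀
        term : ∀ {x} → x ∈ picks D → u ≡ proj₁ (proj₁ x) →
               walks N (proj₂ x) (proj₂ (proj₁ x)) v ≡ outdegree D v ! * (o ! * Π) * trees v U (mult (proj₂ x))
        term {(_ , w) , D′} x∈ refl = begin
          walks N D′ w v
            ≡⟨ euler N D′ U w v (length-pick x∈ len) un (proj₂ (arcs (up (here refl))))
                 (λ a∈ → arcs (up (there a∈))) pos′ (balanced-pick x∈ bal) ⟩
          outdegree D′ v ! * ∏ (xs ++ u ∷ ys) (λ i → (outdegree D′ i ∸ 1) !) * trees v U (mult D′)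
            ≡⟨ *-congʳ (cong₂ _*_ (cong _! (sym (same x∈ (λ e → u≢v (sym e)))))
                 (trans (Prod.⨁-↭ (shift u xs ys) (λ i → (outdegree D′ i ∸ 1) !)) (cong₂ _*_ (cong (λ o → (o ∸ 1) !) out′) (Π-same x∈)))) ⟩
          outdegree D v ! * (o ! * Π) * trees v U (mult D′) ∎
          where
          up : ∀ {a} → a ∈ (u , w) ∷ D′ → a ∈ D
          up = ∈-resp-↭ (picks-↭ x∈)
          out′ : outdegree D′ u ≡ suc o
          out′ = suc-injective (trans (sym (out-u x∈)) ou)
          pos′ : ∀ {i} → i ∈ U → outdegree D′ i ≢ 0
          pos′ {i} i∈ e with i ≟ u
          ... | yes refl with () ← trans (sym out′) e
          ... | no i≢u = pos i∈ (trans (same x∈ i≢u) e)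

    ∑-outdegree : ∀ D → ∑ (allFin n) (outdegree D) ≡ length D
    ∑-outdegree []      = Sum.⨁-ε (allFin n) (λ _ → refl)
    ∑-outdegree (a ∷ D) = trans (Sum.⨁-∙ (allFin n) (λ i → δ i (proj₁ a)) _)
      (cong₂ _+_ (trans (Sum.⨁-cong (allFin n) (λ i → sym (*-identityʳ _)))
                   (∑-δ (allFin⁺ n) (∈-allFin (proj₁ a)) (λ _ → 1)))
                 (∑-outdegree D))

    -- The power of r + 2 is Cayley's count of the spanning trees on r + 2 vertices.
    closedWalks-complete : ∀ {N} {D : List (Arc n)} {es r} → length D ≡ suc N → Unique es → length es ≡ suc (suc r) →
      (∀ {a} → a ∈ D → proj₁ a ∈ es × proj₂ a ∈ es) →
      (∀ {i} → i ∈ es → outdegree D i ≢ 0) →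
      (∀ i → outdegree D i ≡ indegree D i) →
      (∀ {i j} → i ∈ es → j ∈ es → i ≢ j → mult D i j ≡ 1) →
      closedWalks (suc N) D ≡ suc N * suc (suc r) ^ r * ∏ es (λ i → (outdegree D i ∸ 1) !)
    closedWalks-complete {N} {D} {es} {r} len ues len-es arcs pos bal one = begin
      ∑ (allFin n) (λ v → walks (suc N) D v v)
        -- The walks from `v` number `outdegree D v` times a quantity free of `v`, because every
        -- root has equally many trees. Summing the outdegrees gives the number of arcs.
        ≡⟨ Sum.⨁-cong (allFin n) from ⟩
      ∑ (allFin n) (λ v → outdegree D v * (suc (suc r) ^ r * Π))
        ≡⟨ ∑-*ʳ _ (allFin n) (outdegree D) ⟨
      ∑ (allFin n) (outdegree D) * (suc (suc r) ^ r * Π)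
        ≡⟨ cong (_* (suc (suc r) ^ r * Π)) (trans (∑-outdegree D) len) ⟩
      suc N * (suc (suc r) ^ r * Π)
        ≡⟨ *-assoc (suc N) (suc (suc r) ^ r) Π ⟨
      suc N * suc (suc r) ^ r * Π ∎
      where
      Π : ℕ
      Π = ∏ es (λ i → (outdegree D i ∸ 1) !)
      from : ∀ v → walks (suc N) D v v ≡ outdegree D v * (suc (suc r) ^ r * Π)
      from v with Data.List.Membership.DecPropositional._∈?_ _≟_ v es
      ... | no v∉ = trans (Sum.⨁-ε (picks D) (λ {x} x∈ → δ-case-0 v (proj₁ (proj₁ x))
                             (λ { refl → contradiction (proj₁ (arcs (∈-resp-↭ (picks-↭ x∈) (here refl)))) v∉ })))
                          (sym (*-congʳ (Sum.⨁-ε D (λ {a} a∈ → δ-≢ {i = v} {proj₁ a} (λ { refl → v∉ (proj₁ (arcs a∈)) })))))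
      ... | yes v∈ with xs , ys , refl ← ∈-∃++ v∈ = begin
        walks (suc N) D v v
          ≡⟨ euler (suc N) D (xs ++ ys) v v len un (here refl)
               (λ a∈ → ∈-resp-↭ p (proj₁ (arcs a∈)) , ∈-resp-↭ p (proj₂ (arcs a∈)))
               (λ i∈ → pos (∈-resp-↭ (Perm.↭-sym p) (there i∈))) (λ i → cong (_+ δ i v) (bal i)) ⟩
        outdegree D v ! * ∏ (xs ++ ys) (λ i → (outdegree D i ∸ 1) !) * trees v (xs ++ ys) (mult D)
          ≡⟨ cong₂ _*_ (fact (outdegree D v) (pos v∈)) (cayley (xs ++ ys) un len′ λ i∈ j∈ →
               one (∈-resp-↭ (Perm.↭-sym p) (there i∈)) (∈-resp-↭ (Perm.↭-sym p) j∈)) ⟩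
        outdegree D v * ((outdegree D v ∸ 1) ! * ∏ (xs ++ ys) (λ i → (outdegree D i ∸ 1) !)) * suc (suc r) ^ r
          ≡⟨ cong (λ q → outdegree D v * q * suc (suc r) ^ r) (Prod.⨁-↭ p (λ i → (outdegree D i ∸ 1) !)) ⟨
        outdegree D v * Π * suc (suc r) ^ r
          ≡⟨ lem (outdegree D v) Π _ ⟩
        outdegree D v * (suc (suc r) ^ r * Π) ∎
        where
        p : xs ++ v ∷ ys ↭ v ∷ xs ++ ys
        p = shift v xs ys
        un : Unique (v ∷ xs ++ ys)
        un = Unique-resp-↭ p ues
        len′ : length (xs ++ ys) ≡ suc r
        len′ = suc-injective (trans (sym (↭-length p)) len-es)
        lem : ∀ a b c → a * b * c ≡ a * (c * b)
        lem = solve-∀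
        fact : ∀ o {p} → o ≢ 0 → o ! * p ≡ o * ((o ∸ 1) ! * p)
        fact zero    o≢0 = contradiction refl o≢0
        fact (suc o) o≢0 = *-assoc (suc o) (o !) _
        cayley : ∀ U → Unique (v ∷ U) → length U ≡ suc r →
                 (∀ {i j} → i ∈ U → j ∈ v ∷ U → i ≢ j → mult D i j ≡ 1) →
                 trees v U (mult D) ≡ suc (suc r) ^ r
        cayley (x ∷ U) un eq one = trans (trees-uniform {c = λ _ → 1} un one) (trans (*-identityˡ _)
          (cong₂ _^_ (trans (∑-1 (v ∷ x ∷ U)) (cong suc eq)) (suc-injective eq)))

-- Arithmetic of natural numbers and reciprocals in the field

module FieldLemmas {c ℓ₁ ℓ₂ : Level} (F : OrderedField c ℓ₁ ℓ₂) where
  open OrderedField F hiding (refl)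
  open Trees using () renaming (∑ to ∑ℕ)
  open import Data.Nat.Base using (ℕ; zero; suc; _!; NonZero)
  module K = CommutativeRing commutativeRing
  open import Algebra.Properties.Monoid.Mult K.+-monoid public using (×-homo-+)
  open import Algebra.Properties.Semiring.Mult K.semiring public using (×1-homo-*)
  open import Algebra.Properties.Semiring.Exp K.semiring public using (^-congˡ; ^-homo-*)
  open import Algebra.Properties.CommutativeSemiring.Exp K.commutativeSemiring public using (^-distrib-*)
  open import Algebra.Properties.Ring K.ring using (-0#≈0#)
  open import Relation.Binary.Reasoning.Setoid K.setoid
  open import Algebra.Solver.Ring.NaturalCoefficients.Default K.commutativeSemiring public using (solve; _:*_; _:+_; _:=_)

  module SumF = BigOperator K.+-commutativeMonoid
  module ProdF = BigOperator K.*-commutativeMonoid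
  open ProdF using () renaming (⨁ to ∏F) public

  ∑F-*ˡ : ∀ {a} {A : Set a} x (xs : List A) f → x * ∑ xs f ≈ ∑ xs (λ y → x * f y)
  ∑F-*ˡ x []       f = zeroʳ x
  ∑F-*ˡ x (y ∷ ys) f = trans (distribˡ x (f y) _) (+-congˡ (∑F-*ˡ x ys f))

  fromℕ-+ : ∀ m n → fromℕ (m ℕ.+ n) ≈ fromℕ m + fromℕ n
  fromℕ-+ = ×-homo-+ 1#

  fromℕ-* : ∀ m n → fromℕ (m ℕ.* n) ≈ fromℕ m * fromℕ n
  fromℕ-* = ×1-homo-*

  fromℕ-1 : fromℕ 1 ≈ 1#
  fromℕ-1 = +-identityʳ 1#

  fromℕ-^ : ∀ m n → fromℕ (m ℕ.^ n) ≈ fromℕ m ^ n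
  fromℕ-^ m zero    = fromℕ-1
  fromℕ-^ m (suc n) = trans (fromℕ-* m (m ℕ.^ n)) (*-congˡ (fromℕ-^ m n))

  fromℕ-∑ : ∀ {a} {A : Set a} (xs : List A) f → fromℕ (∑ℕ xs f) ≈ ∑ xs (λ x → fromℕ (f x))
  fromℕ-∑ []       f = refl′
    where
    refl′ : 0# ≈ 0#
    refl′ = K.refl
  fromℕ-∑ (x ∷ xs) f = trans (fromℕ-+ (f x) _) (+-congˡ (fromℕ-∑ xs f))

  fromℕ-∏ : ∀ {a} {A : Set a} (xs : List A) f → fromℕ (Walks.∏ xs f) ≈ ∏F xs (λ x → fromℕ (f x))
  fromℕ-∏ []       f = fromℕ-1
  fromℕ-∏ (x ∷ xs) f = trans (fromℕ-* (f x) _) (*-congˡ (fromℕ-∏ xs f))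

  ∑F-const : ∀ {a} {A : Set a} (xs : List A) x → ∑ xs (λ _ → x) ≈ fromℕ (length xs) * x
  ∑F-const []       x = sym (zeroˡ x)
  ∑F-const (_ ∷ xs) x = trans (+-cong (sym (*-identityˡ x)) (∑F-const xs x)) (sym (distribʳ x 1# _))

  ∏F-const : ∀ {a} {A : Set a} (xs : List A) x → ∏F xs (λ _ → x) ≈ x ^ length xs
  ∏F-const []       x = K.refl
  ∏F-const (_ ∷ xs) x = *-congˡ (∏F-const xs x)

  1/-inverse : ∀ m .{{_ : NonZero m}} → (1/ m) * fromℕ m ≈ 1#
  1/-inverse (suc m) = trans (*-congˡ (sym (trans (+-congˡ -0#≈0#) (+-identityʳ (fromℕ (suc m))))))
    (proj₁ (proj₂ (#⇒invertible {fromℕ (suc m)} {0#} _)))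

  1/!-inverse : ∀ m → (1/! m) * fromℕ (m !) ≈ 1#
  1/!-inverse m = 1/-inverse (m !) {{ m ℕₚ.!≢0 }}

  1/!0 : 1/! 0 ≈ 1#
  1/!0 = trans (trans (sym (*-identityʳ _)) (*-congˡ (sym fromℕ-1))) (1/!-inverse 0)

-- Derivatives of traces of matrix powers as counts of closed walks

module PolySemantics {c ℓ₁ ℓ₂ : Level} (F : OrderedField c ℓ₁ ℓ₂) where
  open OrderedField F hiding (refl)
  open Tensors F
  open FieldLemmas F
  open Trees using (δ)
  open Walks
  open import Data.Nat.Base using (ℕ; zero; suc)
  open import Relation.Binary.Reasoning.Setoid K.setoid

  module _ {n : ℕ} where
    -- ∂_D f at 0, the list D of index pairs standing for a product of indeterminates.
    coeff : Poly n → List (Arc n) → Carrier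
    coeff f []            = constantTerm f
    coeff f ((i , j) ∷ D) = coeff (∂ i j f) D

    coeff-con : ∀ x i j D → coeff (con x) ((i , j) ∷ D) ≈ 0#
    coeff-con x i j []            = K.refl
    coeff-con x i j ((_ , _) ∷ D) = coeff-con 0# i j D

    coeff-⊕ : ∀ f g D → coeff (f ⊕ g) D ≈ coeff f D + coeff g D
    coeff-⊕ f g []            = K.refl
    coeff-⊕ f g ((i , j) ∷ D) = coeff-⊕ (∂ i j f) (∂ i j g) D

    coeff-0# : ∀ D → coeff (con 0#) D ≈ 0#
    coeff-0# []            = K.refl
    coeff-0# ((i , j) ∷ D) = coeff-0# D

    coeff-∑ : ∀ {a} {A : Set a} (xs : List A) f D → coeff (∑ₚ xs f) D ≈ ∑ xs (λ x → coeff (f x) D)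
    coeff-∑ []       f D = coeff-0# D
    coeff-∑ (x ∷ xs) f D = trans (coeff-⊕ (f x) _ D) (+-congˡ (coeff-∑ xs f D))

    coeff-con⊗ : ∀ x f D → coeff (con x ⊗ f) D ≈ x * coeff f D
    coeff-con⊗ x f []            = K.refl
    coeff-con⊗ x f ((i , j) ∷ D) = begin
      coeff ((con 0# ⊗ f) ⊕ (con x ⊗ ∂ i j f)) D          ≈⟨ coeff-⊕ (con 0# ⊗ f) (con x ⊗ ∂ i j f) D ⟩
      coeff (con 0# ⊗ f) D + coeff (con x ⊗ ∂ i j f) D    ≈⟨ +-cong (coeff-con⊗ 0# f D) (coeff-con⊗ x (∂ i j f) D) ⟩
      0# * coeff f D + x * coeff (∂ i j f) D              ≈⟨ +-congʳ (zeroˡ _) ⟩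
      0# + x * coeff (∂ i j f) D                          ≈⟨ +-identityˡ _ ⟩
      x * coeff (∂ i j f) D                               ∎

    -- At 0 the factor `var p q` survives only if exactly one derivative falls on it, and the right
    -- one; the Leibniz rule sums over the choice of this derivative.
    coeff-var⊗ : ∀ p q g D → coeff (var p q ⊗ g) D ≈
                 ∑ (picks D) (λ x → fromℕ (δ (proj₁ (proj₁ x)) p ℕ.* δ (proj₂ (proj₁ x)) q) * coeff g (proj₂ x))
    coeff-var⊗ p q g []            = zeroˡ _
    coeff-var⊗ p q g ((i , j) ∷ D) = begin
      coeff ((∂ i j (var p q) ⊗ g) ⊕ (var p q ⊗ ∂ i j g)) D
        ≈⟨ coeff-⊕ (∂ i j (var p q) ⊗ g) (var p q ⊗ ∂ i j g) D ⟩
      coeff (∂ i j (var p q) ⊗ g) D + coeff (var p q ⊗ ∂ i j g) D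
        ≈⟨ +-cong head (trans (coeff-var⊗ p q (∂ i j g) D) (sym (SumF.⨁-map (map₂ ((i , j) ∷_)) (picks D) _))) ⟩
      _ ∎
      where
      head : coeff (∂ i j (var p q) ⊗ g) D ≈ fromℕ (δ i p ℕ.* δ j q) * coeff g D
      head with does (i ≟ p) | does (j ≟ q)
      ... | true  | true  = trans (coeff-con⊗ 1# g D) (*-congʳ (sym fromℕ-1))
      ... | true  | false = coeff-con⊗ 0# g D
      ... | false | _     = coeff-con⊗ 0# g D

    -- The derivative absorbed by the first matrix factor is the first arc of the walk, and its head
    -- fixes the summation index `l`. A derivative left over at the end annihilates the constant, so
    -- every arc has to be used.
    coeff-^ᵐ : ∀ N u v D → coeff ((var ^ᵐ N) u v) D ≈ fromℕ (walks N D u v)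
    coeff-^ᵐ zero u v [] with does (u ≟ v)
    ... | true  = sym fromℕ-1
    ... | false = K.refl
    coeff-^ᵐ zero u v ((i , j) ∷ D) with does (u ≟ v)
    ... | true  = coeff-con 1# i j D
    ... | false = coeff-con 0# i j D
    coeff-^ᵐ (suc N) u v D = begin
      coeff (∑ₚ (allFin n) (λ l → var u l ⊗ (var ^ᵐ N) l v)) D
        ≈⟨ coeff-∑ (allFin n) _ D ⟩
      ∑ (allFin n) (λ l → coeff (var u l ⊗ (var ^ᵐ N) l v) D)
        ≈⟨ SumF.⨁-cong (allFin n) (λ l → trans (coeff-var⊗ u l ((var ^ᵐ N) l v) D)
             (SumF.⨁-cong (picks D) (λ x → *-congˡ (coeff-^ᵐ N l v (proj₂ x))))) ⟩
      ∑ (allFin n) (λ l → ∑ (picks D) (λ x → term l x))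
        ≈⟨ SumF.⨁-swap (allFin n) (picks D) term ⟩
      ∑ (picks D) (λ x → ∑ (allFin n) (λ l → term l x))
        ≈⟨ SumF.⨁-cong (picks D) (λ x → trans (SumF.⨁-single (allFin⁺ n) (∈-allFin (proj₂ (proj₁ x))) (other x)) (self x)) ⟩
      ∑ (picks D) (λ x → fromℕ (δ u (proj₁ (proj₁ x)) ℕ.* walks N (proj₂ x) (proj₂ (proj₁ x)) v))
        ≈⟨ fromℕ-∑ (picks D) _ ⟨
      fromℕ (walks (suc N) D u v) ∎
      where
      term : Fin n → Arc n × List (Arc n) → Carrier
      term l x = fromℕ (δ (proj₁ (proj₁ x)) u ℕ.* δ (proj₂ (proj₁ x)) l) * fromℕ (walks N (proj₂ x) l v)
      other : ∀ x {l} → l ∈ allFin n → l ≡ proj₂ (proj₁ x) ⊎ term l x ≈ 0#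
      other ((p , q) , D′) {l} _ with q ≟ l
      ... | yes refl = inj₁ refl
      ... | no q≢l   = inj₂ (trans (*-congʳ (K.reflexive (≡.cong fromℕ (ℕₚ.*-zeroʳ (δ p u))))) (zeroˡ _))
      self : ∀ x → term (proj₂ (proj₁ x)) x ≈ fromℕ (δ u (proj₁ (proj₁ x)) ℕ.* walks N (proj₂ x) (proj₂ (proj₁ x)) v)
      self ((p , q) , D′) = trans (sym (fromℕ-* (δ p u ℕ.* δ q q) (walks N D′ q v)))
        (K.reflexive (≡.cong (λ z → fromℕ (z ℕ.* walks N D′ q v))
          (≡.trans (≡.cong (δ p u ℕ.*_) (Trees.δ-refl q)) (≡.trans (ℕₚ.*-identityʳ (δ p u)) (Trees.δ-sym p u)))))

    coeff-tr : ∀ N D → coeff (tr (var ^ᵐ N)) D ≈ fromℕ (closedWalks N D)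
    coeff-tr N D = trans (coeff-∑ (allFin n) _ D)
      (trans (SumF.⨁-cong (allFin n) (λ i → coeff-^ᵐ N i i D)) (sym (fromℕ-∑ (allFin n) (λ i → walks N D i i))))

-- Duplicate-free lists, enumerations and subsets

module Lists where
  open import Data.Nat.Base using (ℕ; zero; suc; _≤_)
  open ≡ using (cong; sym; trans; subst)

  module _ {a} {A : Set a} where
    ⊆⇒↭++ : ∀ {xs ys : List A} → Unique xs → (∀ {x} → x ∈ xs → x ∈ ys) → ∃[ zs ] ys ↭ xs ++ zs
    ⊆⇒↭++ {[]}     {ys} u sub = ys , Perm.refl
    ⊆⇒↭++ {x ∷ xs} {ys} u@(_ ∷ uxs) sub with as , bs , refl ← ∈-∃++ (sub (here refl)) =
      let zs , p = ⊆⇒↭++ uxs sub′ in zs , Perm.trans (shift x as bs) (Perm.prep x p)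
      where
      sub′ : ∀ {z} → z ∈ xs → z ∈ as ++ bs
      sub′ z∈ with ∈-resp-↭ (shift x as bs) (sub (there z∈))
      ... | here refl = contradiction z∈ (Unique[x∷xs]⇒x∉xs u)
      ... | there z∈′ = z∈′

    ⊆-length : ∀ {xs ys : List A} → Unique xs → (∀ {x} → x ∈ xs → x ∈ ys) → length xs ≤ length ys
    ⊆-length {xs} u sub with zs , p ← ⊆⇒↭++ u sub =
      subst (length xs ≤_) (sym (trans (↭-length p) (Listₚ.length-++ xs))) (ℕₚ.m≤m+n (length xs) (length zs))

    cover-↭ : ∀ {xs ys : List A} → Unique xs → (∀ {x} → x ∈ xs → x ∈ ys) → length ys ≤ length xs → ys ↭ xs
    cover-↭ {xs} {ys} u sub le with ⊆⇒↭++ u sub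
    ... | []     , p = Perm.trans p (Perm.↭-reflexive (Listₚ.++-identityʳ xs))
    ... | z ∷ zs , p = contradiction (subst (_≤ length xs) (trans (↭-length p) (Listₚ.length-++ xs)) le)
                                     (ℕₚ.m+1+n≰m (length xs))

    unique-↭ : ∀ {xs ys : List A} → Unique xs → Unique ys →
               (∀ {x} → x ∈ xs → x ∈ ys) → (∀ {x} → x ∈ ys → x ∈ xs) → ys ↭ xs
    unique-↭ ux uy sub sup = cover-↭ ux sub (⊆-length uy sup)

    ∈-tuples : ∀ {xs : List A} {m} (v : Vec A m) → (∀ i → lookup v i ∈ xs) → v ∈ tuples xs m
    ∈-tuples []      all = here refl
    ∈-tuples (x ∷ v) all = ∈-cartesianProductWith⁺ _∷_ (all Fin.zero) (∈-tuples v (λ i → all (Fin.suc i)))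

    tuples-unique : ∀ {xs : List A} m → Unique xs → Unique (tuples xs m)
    tuples-unique zero    u = [] ∷ []
    tuples-unique (suc m) u = cartesianProductWith⁺ _∷_ Vecₚ.∷-injective u (tuples-unique m u)

    -- The function `key` reads off from an entry the index of its block, which makes the blocks
    -- disjoint.
    concatMap-unique : ∀ {b} {B : Set b} {h : B → List A} {ys} (key : A → B) → Unique ys →
                       (∀ {y} → y ∈ ys → Unique (h y)) → (∀ {x y} → y ∈ ys → x ∈ h y → key x ≡ y) →
                       Unique (concatMap h ys)
    concatMap-unique {h = h} {[]}     key u uh eq = []
    concatMap-unique {h = h} {y ∷ ys} key u@(_ ∷ uys) uh eq =
      Uniqueₚ.++⁺ (uh (here refl)) (concatMap-unique key uys (λ y∈ → uh (there y∈)) (λ y∈ → eq (there y∈)))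
        λ { (x∈ , x∈′) → let z , z∈ , x∈z = find (∈-concatMap⁻ h {xs = ys} x∈′) in
              Unique[x∷xs]⇒x∉xs u (subst (_∈ ys) (trans (sym (eq (there z∈) x∈z)) (eq (here refl) x∈)) z∈) }

    map-unique : ∀ {b} {B : Set b} {h : B → A} {ys} → Unique ys →
                 (∀ {x y} → x ∈ ys → y ∈ ys → h x ≡ h y → x ≡ y) → Unique (map h ys)
    map-unique {ys = []}     u inj = []
    map-unique {h = h} {y ∷ ys} u@(_ ∷ uys) inj =
      All.tabulate (λ {z} z∈ e → let w , w∈ , z≡ = ∈-map⁻ h z∈ in
        Unique[x∷xs]⇒x∉xs u (subst (_∈ ys) (sym (inj (here refl) (there w∈) (trans e z≡))) w∈))
      ∷ map-unique uys (λ x∈ y∈ → inj (there x∈) (there y∈))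

  subsets-unique : ∀ n → Unique (subsets n)
  subsets-unique n = tuples-unique n (((λ ()) ∷ []) ∷ [] ∷ [])

  ∈-subsets : ∀ {n} (p : Subset n) → p ∈ subsets n
  ∈-subsets p = ∈-tuples p λ i → side (lookup p i)
    where
    side : ∀ s → s ∈ inside ∷ outside ∷ []
    side true  = here refl
    side false = there (here refl)

  module _ {n : ℕ} where
    elements : Subset n → List (Fin n)
    elements p = filter (_∈? p) (allFin n)

    elements-unique : ∀ p → Unique (elements p)
    elements-unique p = filter⁺ (_∈? p) (allFin⁺ n)

    ∈-elements⁺ : ∀ {p i} → i Subset.∈ p → i ∈ elements p
    ∈-elements⁺ {p} {i} i∈ = ∈-filter⁺ (_∈? p) (∈-allFin i) i∈

    ∈-elements⁻ : ∀ {p i} → i ∈ elements p → i Subset.∈ p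
    ∈-elements⁻ {p} i∈ = proj₂ (∈-filter⁻ (_∈? p) {xs = allFin n} i∈)

    others : Subset n → Fin n → List (Fin n)
    others p i = filter (λ j → ¬? (j ≟ i)) (elements p)

    others-unique : ∀ p i → Unique (others p i)
    others-unique p i = filter⁺ (λ j → ¬? (j ≟ i)) (elements-unique p)

    ∈-others⁺ : ∀ {p i j} → j Subset.∈ p → j ≢ i → j ∈ others p i
    ∈-others⁺ {p} {i} j∈ j≢i = ∈-filter⁺ (λ j → ¬? (j ≟ i)) (∈-elements⁺ j∈) j≢i

    ∈-others⁻ : ∀ {p i j} → j ∈ others p i → j Subset.∈ p × j ≢ i
    ∈-others⁻ {p} {i} j∈ = let q , j≢i = ∈-filter⁻ (λ j → ¬? (j ≟ i)) {xs = elements p} j∈ in ∈-elements⁻ q , j≢i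

    elements-↭-others : ∀ {p i} → i Subset.∈ p → elements p ↭ i ∷ others p i
    elements-↭-others {p} {i} i∈ = unique-↭ (All.tabulate (λ j∈ e → proj₂ (∈-others⁻ j∈) (sym e)) ∷ others-unique p i)
      (elements-unique p) (λ { (here refl) → ∈-elements⁺ i∈ ; (there j∈) → ∈-elements⁺ (proj₁ (∈-others⁻ j∈)) }) sup
      where
      sup : ∀ {j} → j ∈ elements p → j ∈ i ∷ others p i
      sup {j} j∈ with j ≟ i
      ... | yes refl = here refl
      ... | no j≢i   = there (∈-others⁺ (∈-elements⁻ j∈) j≢i)

    ∈-⋃⁺ : ∀ {xs : List (Fin n)} {i} → i ∈ xs → i Subset.∈ ⋃ (map ⁅_⁆ xs)
    ∈-⋃⁺ (here refl) = Subsetₚ.x∈p∪q⁺ (inj₁ (Subsetₚ.x∈⁅x⁆ _))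
    ∈-⋃⁺ (there i∈)  = Subsetₚ.x∈p∪q⁺ (inj₂ (∈-⋃⁺ i∈))

    ∈-⋃⁻ : ∀ {xs : List (Fin n)} {i} → i Subset.∈ ⋃ (map ⁅_⁆ xs) → i ∈ xs
    ∈-⋃⁻ {[]}     i∈ = contradiction i∈ Subsetₚ.∉⊥
    ∈-⋃⁻ {x ∷ xs} i∈ with Subsetₚ.x∈p∪q⁻ ⁅ x ⁆ (⋃ (map ⁅_⁆ xs)) i∈
    ... | inj₁ i∈x = here (Subsetₚ.x∈⁅y⁆⇒x≡y x i∈x)
    ... | inj₂ i∈s = there (∈-⋃⁻ i∈s)

  length-elements : ∀ {n} (p : Subset n) → length (elements p) ≡ ∣ p ∣
  length-elements {n} p = trans (trans (sym (Euler.∑-1 (elements p))) (Trees.Sum.⨁-filter (_∈? p) (allFin n) _)) (go p)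
    where
    go : ∀ {n} (p : Subset n) → Trees.∑ (allFin n) (λ i → if does (i ∈? p) then 1 else 0) ≡ ∣ p ∣
    go []            = refl
    go (inside  ∷ p) = cong suc (trans (Trees.Sum.⨁-tabulate Fin.suc (λ i → if does (i ∈? inside ∷ p) then 1 else 0)) (go p))
    go (outside ∷ p) = trans (Trees.Sum.⨁-tabulate Fin.suc (λ i → if does (i ∈? outside ∷ p) then 1 else 0)) (go p)

  length-others : ∀ {n m} {p : Subset n} {i} → i Subset.∈ p → ∣ p ∣ ≡ suc m → length (others p i) ≡ m
  length-others {p = p} i∈ eq =
    ℕₚ.suc-injective (trans (sym (↭-length (elements-↭-others i∈))) (trans (length-elements p) eq))

-- Row operators regrouped by the support of the index tuple

module RowOperators {c ℓ₁ ℓ₂ : Level} (F : OrderedField c ℓ₁ ℓ₂) where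
  open OrderedField F hiding (refl)
  open Tensors F
  open FieldLemmas F
  open Lists
  open import Data.Nat.Base using (ℕ; zero; suc; _!)
  open import Relation.Binary.Reasoning.Setoid K.setoid

  module _ {n : ℕ} where
    open import Data.List.Membership.DecPropositional (_≟_ {n}) using () renaming (_∈?_ to _∈ₗ?_)

    covers? : (xs ys : List (Fin n)) → Dec (All (_∈ ys) xs)
    covers? xs ys = All.all? (_∈ₗ? ys) xs

    -- A tuple of the length of xs that covers xs is one of the m ! arrangements of xs.
    ∑-covers : ∀ m {xs : List (Fin n)} → Unique xs → length xs ≡ m → (H : List (Fin n) → Carrier) →
               (∀ {ys zs} → ys ↭ zs → H ys ≈ H zs) →
               ∑ (tuples (allFin n) m) (λ γ → if does (covers? xs (toList γ)) then H (toList γ) else 0#)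
                 ≈ fromℕ (m !) * H xs
    ∑-covers zero    {[]} u eq H resp = trans (+-identityʳ (H [])) (trans (sym (*-identityˡ (H []))) (*-congʳ (sym fromℕ-1)))
    ∑-covers (suc m) {xs} u eq H resp = begin
      ∑ (tuples (allFin n) (suc m)) G
        ≈⟨ SumF.⨁-cartesian _∷_ (allFin n) (tuples (allFin n) m) G ⟩
      ∑ (allFin n) (λ j → ∑ (tuples (allFin n) m) (λ γ → G (j ∷ γ)))
        ≈⟨ SumF.⨁-support (allFin⁺ n) u (λ {j} _ → ∈-allFin j) (λ {j} _ → outer j) ⟩
      ∑ xs (λ j → ∑ (tuples (allFin n) m) (λ γ → G (j ∷ γ)))
        ≈⟨ SumF.⨁-cong-∈ xs inner ⟩
      ∑ xs (λ _ → fromℕ (m !) * H xs)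
        ≈⟨ ∑F-const xs _ ⟩
      fromℕ (length xs) * (fromℕ (m !) * H xs)
        ≈⟨ *-assoc _ _ _ ⟨
      fromℕ (length xs) * fromℕ (m !) * H xs
        ≈⟨ *-congʳ (trans (K.reflexive (≡.cong (λ l → fromℕ l * fromℕ (m !)) eq)) (sym (fromℕ-* (suc m) (m !)))) ⟩
      fromℕ (suc m !) * H xs ∎
      where
      G : Vec (Fin n) (suc m) → Carrier
      G γ = if does (covers? xs (toList γ)) then H (toList γ) else 0#
      outer : ∀ j → j ∈ xs ⊎ ∑ (tuples (allFin n) m) (λ γ → G (j ∷ γ)) ≈ 0#
      outer j with j ∈ₗ? xs
      ... | yes j∈ = inj₁ j∈
      -- A first entry outside `xs` is wasted: the remaining m entries cannot cover m + 1 distinct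
      -- vertices.
      ... | no j∉  = inj₂ (SumF.⨁-ε (tuples (allFin n) m) λ {γ} _ → K.reflexive
        (≡.cong (λ b → if b then H (j ∷ toList γ) else 0#) (dec-false (covers? xs (j ∷ toList γ)) λ all →
          ℕₚ.<⇒≱ (ℕₚ.≤-reflexive (≡.trans (≡.cong suc (Vecₚ.length-toList γ)) (≡.sym eq)))
            (⊆-length u (λ {x} x∈ → drop γ (All.lookup all x∈) (λ { refl → j∉ x∈ }))))))
        where
        drop : ∀ {x} (γ : Vec (Fin n) m) → x ∈ j ∷ toList γ → x ≢ j → x ∈ toList γ
        drop γ (here e)   x≢j = contradiction e x≢j
        drop γ (there x∈) x≢j = x∈
      inner : ∀ {j} → j ∈ xs → ∑ (tuples (allFin n) m) (λ γ → G (j ∷ γ)) ≈ fromℕ (m !) * H xs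
      inner {j} j∈ with as , bs , refl ← ∈-∃++ j∈ = begin
        ∑ (tuples (allFin n) m) (λ γ → G (j ∷ γ))
          ≈⟨ SumF.⨁-cong (tuples (allFin n) m) (λ γ → K.reflexive (≡.cong
               (λ b → if b then H (j ∷ toList γ) else 0#)
               (does-⇔ (mk⇔ (to γ) (from γ)) (covers? (as ++ j ∷ bs) (j ∷ toList γ)) (covers? (as ++ bs) (toList γ))))) ⟩
        ∑ (tuples (allFin n) m) (λ γ → if does (covers? (as ++ bs) (toList γ)) then H (j ∷ toList γ) else 0#)
          ≈⟨ ∑-covers m u″ (ℕₚ.suc-injective (≡.trans (≡.sym (↭-length p)) eq)) (λ ys → H (j ∷ ys)) (λ q → resp (Perm.prep j q)) ⟩
        fromℕ (m !) * H (j ∷ as ++ bs)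
          ≈⟨ *-congˡ (resp (Perm.↭-sym p)) ⟩
        fromℕ (m !) * H (as ++ j ∷ bs) ∎
        where
        p : as ++ j ∷ bs ↭ j ∷ as ++ bs
        p = shift j as bs
        u′ : Unique (j ∷ as ++ bs)
        u′ = Unique-resp-↭ p u
        u″ : Unique (as ++ bs)
        u″ with _ ∷ q ← u′ = q
        to : ∀ (γ : Vec (Fin n) m) → All (_∈ j ∷ toList γ) (as ++ j ∷ bs) → All (_∈ toList γ) (as ++ bs)
        to γ all = All.tabulate λ {x} x∈ → drop x∈ (All.lookup all (∈-resp-↭ (Perm.↭-sym p) (there x∈)))
          where
          drop : ∀ {x} → x ∈ as ++ bs → x ∈ j ∷ toList γ → x ∈ toList γ
          drop x∈ (here refl) = contradiction x∈ (Unique[x∷xs]⇒x∉xs u′)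
          drop x∈ (there x∈′) = x∈′
        from : ∀ (γ : Vec (Fin n) m) → All (_∈ toList γ) (as ++ bs) → All (_∈ j ∷ toList γ) (as ++ j ∷ bs)
        from γ all = All.tabulate λ x∈ → add (∈-resp-↭ p x∈)
          where
          add : ∀ {x} → x ∈ j ∷ as ++ bs → x ∈ j ∷ toList γ
          add (here e)   = here e
          add (there x∈) = there (All.lookup all x∈)

  Choice : ℕ → Set
  Choice n = Maybe (Subset n)

  module Rows {r n : ℕ} (G : Hypergraph (suc (suc r)) n) (α : Carrier) where
    open Hypergraph G

    -- After grouping the tuples γ by their support, a term of the row operator of i is either the
    -- diagonal entry (nothing) or an edge e through i (just e).
    choices : List (Choice n)
    choices = nothing ∷ map just (subsets n)

    -- The entry 1/(k-1)! of the adjacency tensor has been used up by the (k-1)! tuples with the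
    -- same support. Since `choices` offers every subset, those that are not edges through `i`
    -- receive weight 0.
    weight : Fin n → Choice n → Carrier
    weight i nothing  = α * fromℕ (degree i)
    weight i (just e) = if does (edge? e ×-dec (i ∈? e)) then 1# - α else 0#

    targets : Fin n → Choice n → List (Fin n)
    targets i nothing  = replicate (suc r) i
    targets i (just e) = others e i

    private
      Γ : List (Vec (Fin n) (suc r))
      Γ = tuples (allFin n) (suc r)
      support : Fin n → Vec (Fin n) (suc r) → Subset n
      support i γ = ⋃ (List.map ⁅_⁆ (i ∷ toList γ))

    module _ (i : Fin n) (H : List (Fin n) → Carrier) (resp : ∀ {ys zs} → ys ↭ zs → H ys ≈ H zs) where
      loop-sum : ∑ Γ (λ γ → degreeTensor G i γ * H (toList γ)) ≈ fromℕ (degree i) * H (replicate (suc r) i)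
      loop-sum = begin
        ∑ Γ (λ γ → degreeTensor G i γ * H (toList γ))
          ≈⟨ SumF.⨁-single (tuples-unique (suc r) (allFin⁺ n)) (∈-tuples (Vec.replicate (suc r) i) (λ j → ∈-allFin _))
               (λ {γ} _ → other γ) ⟩
        degreeTensor G i (Vec.replicate (suc r) i) * H (toList (Vec.replicate (suc r) i))
          ≈⟨ *-cong (K.reflexive (≡.cong (λ b → if b then fromℕ (degree i) else 0#)
                      (dec-true (VecAll.all? (i ≟_) (Vec.replicate (suc r) i)) (rep (suc r)))))
                    (K.reflexive (≡.cong H (Vecₚ.toList-replicate (suc r) i))) ⟩
        fromℕ (degree i) * H (replicate (suc r) i) ∎
        where
        rep : ∀ m → VecAll.All (i ≡_) (Vec.replicate m i)
        rep zero    = VecAll.[]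
        rep (suc m) = refl VecAll.∷ rep m
        const : ∀ {m} {γ : Vec (Fin n) m} → VecAll.All (i ≡_) γ → γ ≡ Vec.replicate m i
        const VecAll.[]           = refl
        const (refl VecAll.∷ all) = ≡.cong (i ∷_) (const all)
        other : ∀ γ → γ ≡ Vec.replicate (suc r) i ⊎ degreeTensor G i γ * H (toList γ) ≈ 0#
        other γ = pick (VecAll.all? (i ≟_) γ)
          where
          pick : (d : Dec (VecAll.All (i ≡_) γ)) →
                 γ ≡ Vec.replicate (suc r) i ⊎ (if does d then fromℕ (degree i) else 0#) * H (toList γ) ≈ 0#
          pick (yes all) = inj₁ (const all)
          pick (no _)    = inj₂ (zeroˡ _)

      private
        -- The share of `e` in the entry at `γ`. The decision is an argument so that the expression
        -- reduces in each of its cases.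
        ⟦_⟧ : ∀ {e} (γ : Vec (Fin n) (suc r)) → Dec (Edge e × i Subset.∈ e) → Carrier
        ⟦_⟧ {e} γ d = if does d then (if does (covers? (others e i) (toList γ)) then (1/! suc r) * H (toList γ) else 0#) else 0#

        edge-size : ∀ {e} → Edge e → i Subset.∈ e → length (others e i) ≡ suc r
        edge-size E i∈ = length-others i∈ (uniform E)

        -- The tuple has k - 1 entries and covers the k - 1 further vertices of `e`, so there is no
        -- room for an entry outside `e`.
        same-support : ∀ {e} γ → Edge e → i Subset.∈ e → All (_∈ toList γ) (others e i) → e ≡ support i γ
        same-support {e} γ E i∈ all = Subsetₚ.⊆-antisym
          (λ {j} j∈ → ∈-⋃⁺ (fwd (∈-resp-↭ (elements-↭-others i∈) (∈-elements⁺ j∈))))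
          (λ {j} j∈ → bwd (∈-⋃⁻ {xs = i ∷ toList γ} j∈))
          where
          fwd : ∀ {j} → j ∈ i ∷ others e i → j ∈ i ∷ toList γ
          fwd (here eq)  = here eq
          fwd (there j∈) = there (All.lookup all j∈)
          bwd : ∀ {j} → j ∈ i ∷ toList γ → j Subset.∈ e
          bwd (here refl) = i∈
          bwd (there j∈)  = proj₁ (∈-others⁻ (∈-resp-↭ (cover-↭ (others-unique e i) (All.lookup all)
            (ℕₚ.≤-reflexive (≡.trans (Vecₚ.length-toList γ) (≡.sym (edge-size E i∈))))) j∈))

        -- At most one `e` contributes to the sum, namely the support of `γ`. Written as a sum over
        -- subsets, the entry allows `edge-sum` to exchange the summations and count the tuples of
        -- each edge.
        expand : ∀ γ → adjacencyTensor G i γ * H (toList γ) ≈ ∑ (subsets n) (λ e → ⟦_⟧ {e} γ (edge? e ×-dec (i ∈? e)))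
        expand γ = sym (trans (SumF.⨁-single (subsets-unique n) (∈-subsets (support i γ)) (λ {e} _ → other e (edge? e ×-dec (i ∈? e))))
          (self (edge? (support i γ)) (i ∈? support i γ)))
          where
          other : ∀ e (d : Dec (Edge e × i Subset.∈ e)) → e ≡ support i γ ⊎ ⟦ γ ⟧ d ≈ 0#
          other e (no _) = inj₂ K.refl
          other e (yes (E , i∈)) = pick (covers? (others e i) (toList γ))
            where
            pick : (d : Dec (All (_∈ toList γ) (others e i))) →
                   e ≡ support i γ ⊎ (if does d then (1/! suc r) * H (toList γ) else 0#) ≈ 0#
            pick (yes all) = inj₁ (same-support γ E i∈ all)
            pick (no _)    = inj₂ K.refl
          i∈s : i Subset.∈ support i γ
          i∈s = ∈-⋃⁺ {xs = i ∷ toList γ} (here refl)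
          cov : All (_∈ toList γ) (others (support i γ) i)
          cov = All.tabulate λ {j} j∈ → let j∈s , j≢i = ∈-others⁻ {p = support i γ} j∈ in strip (∈-⋃⁻ {xs = i ∷ toList γ} j∈s) j≢i
            where
            strip : ∀ {j} → j ∈ i ∷ toList γ → j ≢ i → j ∈ toList γ
            strip (here e)   j≢i = contradiction e j≢i
            strip (there j∈) _   = j∈
          self : (d : Dec (Edge (support i γ))) (d′ : Dec (i Subset.∈ support i γ)) →
                 ⟦ γ ⟧ (d ×-dec d′) ≈ (if does d then 1/! suc r else 0#) * H (toList γ)
          self (no _)  d′       = sym (zeroˡ _)
          self (yes E) (no i∉)  = contradiction i∈s i∉
          self (yes E) (yes i∈) = K.reflexive (≡.cong (λ b → if b then (1/! suc r) * H (toList γ) else 0#)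
            (dec-true (covers? (others (support i γ) i) (toList γ)) cov))

      edge-sum : ∑ Γ (λ γ → adjacencyTensor G i γ * H (toList γ)) ≈
                 ∑ (subsets n) (λ e → if does (edge? e ×-dec (i ∈? e)) then H (others e i) else 0#)
      edge-sum = begin
        ∑ Γ (λ γ → adjacencyTensor G i γ * H (toList γ))
          ≈⟨ SumF.⨁-cong Γ expand ⟩
        ∑ Γ (λ γ → ∑ (subsets n) (λ e → ⟦_⟧ {e} γ (edge? e ×-dec (i ∈? e))))
          ≈⟨ SumF.⨁-swap Γ (subsets n) _ ⟩
        ∑ (subsets n) (λ e → ∑ Γ (λ γ → ⟦_⟧ {e} γ (edge? e ×-dec (i ∈? e))))
          ≈⟨ SumF.⨁-cong (subsets n) (λ e → collect e (edge? e ×-dec (i ∈? e))) ⟩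
        _ ∎
        where
        collect : ∀ e (d : Dec (Edge e × i Subset.∈ e)) → ∑ Γ (λ γ → ⟦ γ ⟧ d) ≈ (if does d then H (others e i) else 0#)
        collect e (no _)         = SumF.⨁-ε Γ (λ _ → K.refl)
        collect e (yes (E , i∈)) = begin
          ∑ Γ (λ γ → if does (covers? (others e i) (toList γ)) then (1/! suc r) * H (toList γ) else 0#)
            ≈⟨ ∑-covers (suc r) (others-unique e i) (edge-size E i∈) (λ ys → (1/! suc r) * H ys) (λ p → *-congˡ (resp p)) ⟩
          fromℕ (suc r !) * ((1/! suc r) * H (others e i))
            ≈⟨ *-assoc _ _ _ ⟨
          fromℕ (suc r !) * (1/! suc r) * H (others e i)
            ≈⟨ *-congʳ (trans (*-comm _ _) (1/!-inverse (suc r))) ⟩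
          1# * H (others e i)
            ≈⟨ *-identityˡ _ ⟩
          H (others e i) ∎

      row-sum : ∑ Γ (λ γ → A[ G ] α i γ * H (toList γ)) ≈ ∑ choices (λ x → weight i x * H (targets i x))
      row-sum = begin
        ∑ Γ (λ γ → A[ G ] α i γ * H (toList γ))
          ≈⟨ SumF.⨁-cong Γ (λ γ → trans (distribʳ _ _ _) (+-cong (*-assoc _ _ _) (*-assoc _ _ _))) ⟩
        ∑ Γ (λ γ → α * (degreeTensor G i γ * H (toList γ)) + (1# - α) * (adjacencyTensor G i γ * H (toList γ)))
          ≈⟨ SumF.⨁-∙ Γ (λ γ → α * (degreeTensor G i γ * H (toList γ))) _ ⟩
        _ ≈⟨ +-cong (sym (∑F-*ˡ α Γ (λ γ → degreeTensor G i γ * H (toList γ))))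
                    (sym (∑F-*ˡ (1# - α) Γ (λ γ → adjacencyTensor G i γ * H (toList γ)))) ⟩
        _ ≈⟨ +-cong (*-congˡ loop-sum) (*-congˡ edge-sum) ⟩
        _ ≈⟨ +-cong (sym (*-assoc α _ _)) (trans (∑F-*ˡ (1# - α) (subsets n) (λ e → if does (edge? e ×-dec (i ∈? e)) then H (others e i) else 0#))
               (trans (SumF.⨁-cong (subsets n) (λ e → move (does (edge? e ×-dec (i ∈? e))) (H (others e i))))
                      (sym (SumF.⨁-map just (subsets n) (λ x → weight i x * H (targets i x)))))) ⟩
        _ ∎
        where
        move : ∀ b x → (1# - α) * (if b then x else 0#) ≈ (if b then 1# - α else 0#) * x
        move true  x = K.refl
        move false x = trans (zeroʳ _) (sym (zeroˡ x))

-- The trace as a sum over configurations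

module Expansion {c ℓ₁ ℓ₂ : Level} (F : OrderedField c ℓ₁ ℓ₂) where
  open OrderedField F hiding (refl)
  open Tensors F
  open FieldLemmas F
  open PolySemantics F
  open RowOperators F
  open Lists
  open Walks
  open Trees using () renaming (∑ to ∑ℕ)
  open import Data.Nat.Base using (ℕ; zero; suc)
  open import Relation.Binary.Reasoning.Setoid K.setoid

  module Configurations {r n : ℕ} (G : Hypergraph (suc (suc r)) n) (α : Carrier) where
    open Rows G α

    m k : ℕ
    m = suc r
    k = suc m

    -- For each vertex i, the choices made in the dᵢ factors of its row operator.
    Configuration : Set
    Configuration = Vec (List (Choice n)) n

    words : ℕ → List (List (Choice n))
    words zero    = [] ∷ []
    words (suc d) = cartesianProductWith _∷_ choices (words d)

    configs : ∀ {p} → Vec ℕ p → List (Vec (List (Choice n)) p)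
    configs []       = [] ∷ []
    configs (d ∷ ds) = cartesianProductWith _∷_ (words d) (configs ds)

    configurations : ℕ → List Configuration
    configurations d = concatMap configs (compositions n d)

    choiceArcs : Fin n → Choice n → List (Arc n)
    choiceArcs i x = map (i ,_) (targets i x)

    wordArcs : Fin n → List (Choice n) → List (Arc n)
    wordArcs i w = concatMap (choiceArcs i) w

    wordWeight : Fin n → List (Choice n) → Carrier
    wordWeight i w = (1/! (length w ℕ.* m)) * ∏F w (weight i)

    arcs : Configuration → List (Arc n)
    arcs Γ = concatMap (λ i → wordArcs i (lookup Γ i)) (allFin n)

    configWeight : Configuration → Carrier
    configWeight Γ = ∏F (allFin n) (λ i → wordWeight i (lookup Γ i))

    term : ℕ → Configuration → Carrier
    term d Γ = configWeight Γ * fromℕ (closedWalks (d ℕ.* m) (arcs Γ))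

    words-length : ∀ d {w} → w ∈ words d → length w ≡ d
    words-length zero    (here refl) = refl
    words-length (suc d) w∈ with _ , w , _ , w∈′ , refl ← ∈-cartesianProductWith⁻ _∷_ choices (words d) w∈ =
      ≡.cong suc (words-length d w∈′)

    private
      row : Fin n → Poly n → Poly n
      row = rowOperator k (A[ G ] α)

      -- As terms, derivatives in different orders are different polynomials; only their values
      -- agree. Independence of the order is therefore carried along as a property, which the trace
      -- has because walks do not depend on the order of the arc list, and which the row operators
      -- preserve.
      Symmetric : Poly n → Set _
      Symmetric f = ∀ {D E} → D ↭ E → coeff f D ≈ coeff f E

      coeff-∂* : ∀ {p f} → Symmetric f → ∀ i (γ : Vec (Fin n) p) D →
                 coeff (∂* i γ f) D ≈ coeff f (map (i ,_) (toList γ) ++ D)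
      coeff-∂* sf i []      D = K.refl
      coeff-∂* sf i (j ∷ γ) D = trans (coeff-∂* sf i γ ((i , j) ∷ D)) (sf (shift (i , j) (map (i ,_) (toList γ)) D))

      coeff-row : ∀ {f} → Symmetric f → ∀ i D →
                  coeff (row i f) D ≈ ∑ choices (λ x → weight i x * coeff f (choiceArcs i x ++ D))
      coeff-row {f} sf i D = begin
        coeff (row i f) D
          ≈⟨ coeff-∑ (tuples (allFin n) m) _ D ⟩
        ∑ (tuples (allFin n) m) (λ γ → coeff (con (A[ G ] α i γ) ⊗ ∂* i γ f) D)
          ≈⟨ SumF.⨁-cong (tuples (allFin n) m) (λ γ →
               trans (coeff-con⊗ (A[ G ] α i γ) (∂* i γ f) D) (*-congˡ (coeff-∂* sf i γ D))) ⟩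
        ∑ (tuples (allFin n) m) (λ γ → A[ G ] α i γ * coeff f (map (i ,_) (toList γ) ++ D))
          ≈⟨ row-sum i (λ ys → coeff f (map (i ,_) ys ++ D)) (λ p → sf (++⁺ʳ D (↭-map⁺ (i ,_) p))) ⟩
        ∑ choices (λ x → weight i x * coeff f (choiceArcs i x ++ D)) ∎

      row-symmetric : ∀ {f} → Symmetric f → ∀ i → Symmetric (row i f)
      row-symmetric sf i {D} {E} p = trans (coeff-row sf i D) (trans
        (SumF.⨁-cong choices (λ x → *-congˡ (sf (++⁺ˡ (choiceArcs i x) p)))) (sym (coeff-row sf i E)))

      fold-symmetric : ∀ {f} → Symmetric f → ∀ i d → Symmetric (fold f (row i) d)
      fold-symmetric sf i zero    = sf
      fold-symmetric sf i (suc d) = row-symmetric (fold-symmetric sf i d) i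

      coeff-fold : ∀ {f} → Symmetric f → ∀ i d D →
                   coeff (fold f (row i) d) D ≈ ∑ (words d) (λ w → ∏F w (weight i) * coeff f (wordArcs i w ++ D))
      coeff-fold {f} sf i zero    D = sym (trans (+-identityʳ _) (*-identityˡ _))
      coeff-fold {f} sf i (suc d) D = begin
        coeff (row i (fold f (row i) d)) D
          ≈⟨ coeff-row (fold-symmetric sf i d) i D ⟩
        ∑ choices (λ x → weight i x * coeff (fold f (row i) d) (choiceArcs i x ++ D))
          ≈⟨ SumF.⨁-cong choices (λ x → trans (*-congˡ (coeff-fold sf i d (choiceArcs i x ++ D)))
               (trans (∑F-*ˡ (weight i x) (words d) (λ w → ∏F w (weight i) * coeff f (wordArcs i w ++ choiceArcs i x ++ D)))
               (SumF.⨁-cong (words d) (λ w → trans (sym (*-assoc _ _ _)) (*-congˡ (sf (reorder x w))))))) ⟩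
        ∑ choices (λ x → ∑ (words d) (λ w → weight i x * ∏F w (weight i) * coeff f (wordArcs i (x ∷ w) ++ D)))
          ≈⟨ SumF.⨁-cartesian _∷_ choices (words d) _ ⟨
        _ ∎
        where
        reorder : ∀ x w → wordArcs i w ++ choiceArcs i x ++ D ↭ wordArcs i (x ∷ w) ++ D
        reorder x w = Perm.trans (shifts (wordArcs i w) (choiceArcs i x))
          (Perm.↭-reflexive (≡.sym (Listₚ.++-assoc (choiceArcs i x) (wordArcs i w) D)))

      -- The induction over the vertices meets the last p of them only; `σ` says which vertex each
      -- position stands for. The same holds for `weight′` and `op`.
      arcs′ : ∀ {p} (σ : Fin p → Fin n) → Vec (List (Choice n)) p → List (Arc n)
      arcs′ σ []      = []
      arcs′ σ (w ∷ Γ) = wordArcs (σ Fin.zero) w ++ arcs′ (λ j → σ (Fin.suc j)) Γ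

      weight′ : ∀ {p} (σ : Fin p → Fin n) → Vec (List (Choice n)) p → Carrier
      weight′ σ []      = 1#
      weight′ σ (w ∷ Γ) = wordWeight (σ Fin.zero) w * weight′ (λ j → σ (Fin.suc j)) Γ

      arcs≡arcs′ : ∀ {p} (σ : Fin p → Fin n) Γ →
                   concatMap (λ j → wordArcs (σ j) (lookup Γ j)) (allFin p) ≡ arcs′ σ Γ
      arcs≡arcs′ σ []      = refl
      arcs≡arcs′ σ (w ∷ Γ) = ≡.cong (wordArcs (σ Fin.zero) w ++_) (≡.trans
        (≡.cong List.concat (≡.trans (Listₚ.map-tabulate Fin.suc (λ j → wordArcs (σ j) (lookup (w ∷ Γ) j))) (≡.sym (Listₚ.map-tabulate id (λ j → wordArcs (σ (Fin.suc j)) (lookup Γ j))))))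
        (arcs≡arcs′ (λ j → σ (Fin.suc j)) Γ))

      weight≈weight′ : ∀ {p} (σ : Fin p → Fin n) Γ →
                       ∏F (allFin p) (λ j → wordWeight (σ j) (lookup Γ j)) ≈ weight′ σ Γ
      weight≈weight′ σ []      = K.refl
      weight≈weight′ σ (w ∷ Γ) = *-congˡ (trans (ProdF.⨁-tabulate Fin.suc (λ j → wordWeight (σ j) (lookup (w ∷ Γ) j)))
        (weight≈weight′ (λ j → σ (Fin.suc j)) Γ))

      op : ∀ {p} → (Fin p → Fin n) → (Fin n → ℕ) → Poly n → Poly n
      op σ dd f = List.foldr (λ i g → con (1/! (dd i ℕ.* m)) ⊗ fold g (row i) (dd i)) f (List.tabulate σ)

      -- Mutual with `op-symmetric`: expanding the row of the first vertex requires the operator of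
      -- the later vertices to be symmetric, and that is read off from its own expansion.
      coeff-op : ∀ {f p} → Symmetric f → (σ : Fin p → Fin n) (dd : Fin n → ℕ) → ∀ D →
                 coeff (op σ dd f) D ≈
                 ∑ (configs (Vec.tabulate (λ j → dd (σ j)))) (λ Γ → weight′ σ Γ * coeff f (arcs′ σ Γ ++ D))
      op-symmetric : ∀ {f p} → Symmetric f → (σ : Fin p → Fin n) (dd : Fin n → ℕ) → Symmetric (op σ dd f)

      op-symmetric sf σ dd {D} {E} q = trans (coeff-op sf σ dd D) (trans
        (SumF.⨁-cong (configs (Vec.tabulate (λ j → dd (σ j)))) (λ Γ → *-congˡ (sf (++⁺ˡ (arcs′ σ Γ) q))))
        (sym (coeff-op sf σ dd E)))

      coeff-op {p = zero}  sf σ dd D = sym (trans (+-identityʳ _) (*-identityˡ _))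
      coeff-op {f} {suc p} sf σ dd D = begin
        coeff (con (1/! (d ℕ.* m)) ⊗ fold (op σ′ dd f) (row i) d) D
          ≈⟨ coeff-con⊗ (1/! (d ℕ.* m)) (fold (op σ′ dd f) (row i) d) D ⟩
        (1/! (d ℕ.* m)) * coeff (fold (op σ′ dd f) (row i) d) D
          ≈⟨ *-congˡ (coeff-fold (op-symmetric sf σ′ dd) i d D) ⟩
        (1/! (d ℕ.* m)) * ∑ (words d) (λ w → ∏F w (weight i) * coeff (op σ′ dd f) (wordArcs i w ++ D))
          ≈⟨ ∑F-*ˡ (1/! (d ℕ.* m)) (words d) (λ w → ∏F w (weight i) * coeff (op σ′ dd f) (wordArcs i w ++ D)) ⟩
        ∑ (words d) (λ w → (1/! (d ℕ.* m)) * (∏F w (weight i) * coeff (op σ′ dd f) (wordArcs i w ++ D)))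
          ≈⟨ SumF.⨁-cong-∈ (words d) (λ {w} w∈ → begin
               (1/! (d ℕ.* m)) * (∏F w (weight i) * coeff (op σ′ dd f) (wordArcs i w ++ D))
                 ≈⟨ *-assoc _ _ _ ⟨
               (1/! (d ℕ.* m)) * ∏F w (weight i) * coeff (op σ′ dd f) (wordArcs i w ++ D)
                 ≈⟨ *-cong (K.reflexive (≡.cong (λ l → (1/! (l ℕ.* m)) * ∏F w (weight i)) (≡.sym (words-length d w∈))))
                           (coeff-op sf σ′ dd (wordArcs i w ++ D)) ⟩
               wordWeight i w * ∑ (configs ds′) (λ Γ → weight′ σ′ Γ * coeff f (arcs′ σ′ Γ ++ wordArcs i w ++ D))
                 ≈⟨ ∑F-*ˡ (wordWeight i w) (configs ds′) (λ Γ → weight′ σ′ Γ * coeff f (arcs′ σ′ Γ ++ wordArcs i w ++ D)) ⟩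
               ∑ (configs ds′) (λ Γ → wordWeight i w * (weight′ σ′ Γ * coeff f (arcs′ σ′ Γ ++ wordArcs i w ++ D)))
                 ≈⟨ SumF.⨁-cong (configs ds′) (λ Γ → trans (sym (*-assoc _ _ _)) (*-congˡ (sf (reorder w Γ)))) ⟩
               ∑ (configs ds′) (λ Γ → weight′ σ (w ∷ Γ) * coeff f (arcs′ σ (w ∷ Γ) ++ D)) ∎) ⟩
        ∑ (words d) (λ w → ∑ (configs ds′) (λ Γ → weight′ σ (w ∷ Γ) * coeff f (arcs′ σ (w ∷ Γ) ++ D)))
          ≈⟨ SumF.⨁-cartesian _∷_ (words d) (configs ds′) (λ Γ → weight′ σ Γ * coeff f (arcs′ σ Γ ++ D)) ⟨
        _ ∎
        where
        i : Fin n
        i = σ Fin.zero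
        d : ℕ
        d = dd i
        σ′ : Fin p → Fin n
        σ′ j = σ (Fin.suc j)
        ds′ : Vec ℕ p
        ds′ = Vec.tabulate (λ j → dd (σ′ j))
        reorder : ∀ w Γ → arcs′ σ′ Γ ++ wordArcs i w ++ D ↭ (wordArcs i w ++ arcs′ σ′ Γ) ++ D
        reorder w Γ = Perm.trans (shifts (arcs′ σ′ Γ) (wordArcs i w))
          (Perm.↭-reflexive (≡.sym (Listₚ.++-assoc (wordArcs i w) (arcs′ σ′ Γ) D)))

    Tr-expansion : ∀ d → Tr k d (A[ G ] α) ≈ [ k -1]^ (n ⊖ 1) * ∑ (configurations d) (term d)
    Tr-expansion d = *-congˡ (trans (SumF.⨁-cong (compositions n d) each)
      (sym (SumF.⨁-concatMap configs (compositions n d) (term d))))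
      where
      f : Poly n
      f = tr (var ^ᵐ (d ℕ.* m))
      f-symmetric : Symmetric f
      f-symmetric {D} {E} p = trans (coeff-tr (d ℕ.* m) D) (trans
        (K.reflexive (≡.cong fromℕ (Trees.Sum.⨁-cong (allFin n) (λ i → walks-↭ (d ℕ.* m) p i i))))
        (sym (coeff-tr (d ℕ.* m) E)))
      each : ∀ ds → constantTerm (operator k (A[ G ] α) ds f) ≈ ∑ (configs ds) (term d)
      each ds = begin
        coeff (op id (lookup ds) f) []
          ≈⟨ coeff-op f-symmetric id (lookup ds) [] ⟩
        ∑ (configs (Vec.tabulate (lookup ds))) (λ Γ → weight′ id Γ * coeff f (arcs′ id Γ ++ []))
          ≈⟨ K.reflexive (≡.cong (λ ds → ∑ (configs ds) (λ Γ → weight′ id Γ * coeff f (arcs′ id Γ ++ []))) (Vecₚ.tabulate∘lookup ds)) ⟩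
        ∑ (configs ds) (λ Γ → weight′ id Γ * coeff f (arcs′ id Γ ++ []))
          ≈⟨ SumF.⨁-cong (configs ds) (λ Γ → *-cong (sym (weight≈weight′ id Γ)) (begin
               coeff f (arcs′ id Γ ++ [])
                 ≈⟨ K.reflexive (≡.cong (coeff f) (≡.trans (Listₚ.++-identityʳ (arcs′ id Γ)) (≡.sym (arcs≡arcs′ id Γ)))) ⟩
               coeff f (arcs Γ)
                 ≈⟨ coeff-tr (d ℕ.* m) (arcs Γ) ⟩
               fromℕ (closedWalks (d ℕ.* m) (arcs Γ)) ∎)) ⟩
        ∑ (configs ds) (term d) ∎

    total : Configuration → ℕ
    total Γ = ∑ℕ (allFin n) (λ i → length (lookup Γ i))

    private
      choices-unique : Unique choices
      choices-unique = All.tabulate (λ x∈ e → nothing∉ (≡.subst (_∈ map just (subsets n)) (≡.sym e) x∈))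
        ∷ map⁺ (λ { refl → refl }) (subsets-unique n)
        where
        nothing∉ : nothing ∉ map just (subsets n)
        nothing∉ x∈ with _ , _ , () ← ∈-map⁻ just x∈

      ∈-choices : ∀ x → x ∈ choices
      ∈-choices nothing  = here refl
      ∈-choices (just e) = there (∈-map⁺ just (∈-subsets e))

      words-unique : ∀ d → Unique (words d)
      words-unique zero    = [] ∷ []
      words-unique (suc d) = cartesianProductWith⁺ _∷_ Listₚ.∷-injective choices-unique (words-unique d)

      ∈-words : ∀ w → w ∈ words (length w)
      ∈-words []      = here refl
      ∈-words (x ∷ w) = ∈-cartesianProductWith⁺ _∷_ (∈-choices x) (∈-words w)

      configs-unique : ∀ {p} (ds : Vec ℕ p) → Unique (configs ds)
      configs-unique []       = [] ∷ []
      configs-unique (d ∷ ds) = cartesianProductWith⁺ _∷_ Vecₚ.∷-injective (words-unique d) (configs-unique ds)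

      ∈-configs : ∀ {p} (Γ : Vec (List (Choice n)) p) → Γ ∈ configs (Vec.map length Γ)
      ∈-configs []      = here refl
      ∈-configs (w ∷ Γ) = ∈-cartesianProductWith⁺ _∷_ (∈-words w) (∈-configs Γ)

      configs-lengths : ∀ {p} (ds : Vec ℕ p) {Γ} → Γ ∈ configs ds → Vec.map length Γ ≡ ds
      configs-lengths []       (here refl) = refl
      configs-lengths (d ∷ ds) Γ∈ with w , Γ , w∈ , Γ∈′ , refl ← ∈-cartesianProductWith⁻ _∷_ (words d) (configs ds) Γ∈ =
        ≡.cong₂ _∷_ (words-length d w∈) (configs-lengths ds Γ∈′)

      sum-lengths : ∀ {p} (Γ : Vec (List (Choice n)) p) →
                    Vec.sum (Vec.map length Γ) ≡ ∑ℕ (allFin p) (λ i → length (lookup Γ i))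
      sum-lengths []      = refl
      sum-lengths (w ∷ Γ) = ≡.cong (length w ℕ.+_) (≡.trans (sum-lengths Γ)
        (≡.sym (Trees.Sum.⨁-tabulate Fin.suc (λ i → length (lookup (w ∷ Γ) i)))))

      lookup≤sum : ∀ {p} (ds : Vec ℕ p) i → lookup ds i ℕ.≤ Vec.sum ds
      lookup≤sum (d ∷ ds) Fin.zero    = ℕₚ.m≤m+n d (Vec.sum ds)
      lookup≤sum (d ∷ ds) (Fin.suc i) = ℕₚ.≤-trans (lookup≤sum ds i) (ℕₚ.m≤n+m (Vec.sum ds) d)

    configurations-unique : ∀ d → Unique (configurations d)
    configurations-unique d = concatMap-unique (Vec.map length)
      (filter⁺ (λ ds → Vec.sum ds ℕₚ.≟ d) (tuples-unique n (Uniqueₚ.upTo⁺ (suc d))))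
      (λ {ds} _ → configs-unique ds) (λ {_} {ds} _ → configs-lengths ds)

    ∈-configurations⁺ : ∀ {d Γ} → total Γ ≡ d → Γ ∈ configurations d
    ∈-configurations⁺ {d} {Γ} eq = ∈-concatMap⁺ configs (lose
      (∈-filter⁺ (λ ds → Vec.sum ds ℕₚ.≟ d)
        (∈-tuples (Vec.map length Γ) (λ i → ∈-upTo⁺ (ℕ.s≤s (ℕₚ.≤-trans (lookup≤sum (Vec.map length Γ) i) (ℕₚ.≤-reflexive sum≡d)))))
        sum≡d)
      (∈-configs Γ))
      where
      sum≡d : Vec.sum (Vec.map length Γ) ≡ d
      sum≡d = ≡.trans (sum-lengths Γ) eq

    ∈-configurations⁻ : ∀ {d Γ} → Γ ∈ configurations d → total Γ ≡ d
    ∈-configurations⁻ {d} {Γ} Γ∈ with ds , ds∈ , Γ∈′ ← find (∈-concatMap⁻ configs {xs = compositions n d} Γ∈) =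
      ≡.trans (≡.sym (sum-lengths Γ)) (≡.trans (≡.cong Vec.sum (configs-lengths ds Γ∈′))
        (proj₂ (∈-filter⁻ (λ ds → Vec.sum ds ℕₚ.≟ d) {xs = tuples (upTo (suc d)) n} ds∈)))

-- Equality cases of sums, subsets of nearly full size, connectedness

module Bounds where
  open Trees
  open Walks
  open Euler
  open Lists
  open import Data.Nat.Base using (ℕ; zero; suc; _+_; _≤_; z≤n)
  open ≡ using (cong; cong₂; sym; trans)

  module _ {a} {A : Set a} where
    ∑-mono : ∀ {xs : List A} {f g : A → ℕ} → (∀ {x} → x ∈ xs → f x ≤ g x) → ∑ xs f ≤ ∑ xs g
    ∑-mono {[]}     f≤g = z≤n
    ∑-mono {x ∷ xs} f≤g = ℕₚ.+-mono-≤ (f≤g (here refl)) (∑-mono (λ x∈ → f≤g (there x∈)))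

    ∑-mono-≡ : ∀ {xs : List A} {f g : A → ℕ} → (∀ {x} → x ∈ xs → f x ≤ g x) → ∑ xs f ≡ ∑ xs g →
               ∀ {x} → x ∈ xs → f x ≡ g x
    ∑-mono-≡ {y ∷ xs} {f} {g} f≤g eq x∈ with f≤g (here refl) | ∑-mono {xs} (λ x∈ → f≤g (there x∈))
    ... | fy≤gy | fs≤gs with ℕₚ.m≤n⇒m<n∨m≡n fy≤gy
    ... | inj₁ fy<gy = contradiction eq (ℕₚ.<⇒≢ (ℕₚ.+-mono-<-≤ fy<gy fs≤gs))
    ... | inj₂ fy≡gy with x∈
    ...   | here refl = fy≡gy
    ...   | there x∈′ = ∑-mono-≡ {xs} (λ x∈ → f≤g (there x∈))
                          (ℕₚ.+-cancelˡ-≡ (f y) _ _ (trans eq (cong (_+ ∑ xs g) (sym fy≡gy)))) x∈′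

    ∑≢0 : ∀ {xs : List A} {f : A → ℕ} → ∑ xs f ≢ 0 → ∃[ x ] x ∈ xs × f x ≢ 0
    ∑≢0 {[]}     ≢0 = contradiction refl ≢0
    ∑≢0 {x ∷ xs} {f} ≢0 with f x ℕₚ.≟ 0
    ... | no fx≢0 = x , here refl , fx≢0
    ... | yes fx≡0 with z , z∈ , fz≢0 ← ∑≢0 {xs} (λ e → ≢0 (cong₂ _+_ fx≡0 e)) = z , there z∈ , fz≢0

  x∉p-x : ∀ {n} (p : Subset n) x → x Subset.∉ p Subset.- x
  x∉p-x (inside  ∷ p) Fin.zero    ()
  x∉p-x (outside ∷ p) Fin.zero    ()
  x∉p-x (_ ∷ p)       (Fin.suc x) (Vec.there x∈) = x∉p-x p x x∈

  module _ {n : ℕ} where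
    ∑-δ-∈ : ∀ {xs : List (Fin n)} {j} → Unique xs → j ∈ xs → ∑ xs (δ j) ≡ 1
    ∑-δ-∈ {xs} {j} u j∈ = trans (Sum.⨁-cong xs (λ i → trans (δ-sym j i) (sym (ℕₚ.*-identityʳ (δ i j))))) (∑-δ u j∈ (λ _ → 1))

    ∑-δ≡0 : ∀ {xs : List (Fin n)} {j} → j ∉ xs → ∑ xs (δ j) ≡ 0
    ∑-δ≡0 {xs} {j} j∉ = Sum.⨁-ε xs (λ {i} i∈ → δ-≢ {i = j} {i} (λ { refl → j∉ i∈ }))

    δ-≤ : ∀ {i v : Fin n} {x} → (i ≡ v → 1 ≤ x) → δ i v ≤ x
    δ-≤ {i} {v} f with i ≟ v
    ... | yes i≡v = f i≡v
    ... | no _    = z≤n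

    pointwise-≡ : ∀ {f g : Fin n → ℕ} → (∀ i → f i ≤ g i) → ∑ (allFin n) f ≡ ∑ (allFin n) g → ∀ i → f i ≡ g i
    pointwise-≡ f≤g eq i = ∑-mono-≡ (λ {i} _ → f≤g i) eq (∈-allFin i)

    -- The difference of `g` and `f` is a function into ℕ with sum 1, hence the indicator of one
    -- vertex. It locates the spare factor when d = k + 1.
    pointwise-suc : ∀ {f g : Fin n → ℕ} → (∀ i → f i ≤ g i) → suc (∑ (allFin n) f) ≡ ∑ (allFin n) g →
                    ∃[ v ] (∀ i → g i ≡ f i + δ i v)
    pointwise-suc {f} {g} f≤g eq = v , λ i → trans (sym (g≡f+h i)) (cong (f i +_) (sym (pointwise-≡ δ≤h ∑δ≡∑h i)))
      where
      h : Fin n → ℕ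
      h i = g i ℕ.∸ f i
      g≡f+h : ∀ i → f i + h i ≡ g i
      g≡f+h i = ℕₚ.m+[n∸m]≡n (f≤g i)
      ∑h≡1 : ∑ (allFin n) h ≡ 1
      ∑h≡1 = ℕₚ.+-cancelˡ-≡ (∑ (allFin n) f) _ _ (trans (sym (Sum.⨁-∙ (allFin n) f h))
        (trans (Sum.⨁-cong (allFin n) g≡f+h) (trans (sym eq) (ℕₚ.+-comm 1 _))))
      pick : ∃[ v ] v ∈ allFin n × h v ≢ 0
      pick = ∑≢0 {xs = allFin n} (λ e → ℕₚ.1+n≢0 (trans (sym ∑h≡1) e))
      v : Fin n
      v = proj₁ pick
      δ≤h : ∀ i → δ i v ≤ h i
      δ≤h i = δ-≤ {i} {v} (λ { refl → ℕₚ.n≢0⇒n>0 (proj₂ (proj₂ pick)) })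
      ∑δ≡∑h : ∑ (allFin n) (λ i → δ i v) ≡ ∑ (allFin n) h
      ∑δ≡∑h = trans (trans (Sum.⨁-cong (allFin n) (λ i → δ-sym i v)) (∑-δ-∈ (allFin⁺ n) (∈-allFin v))) (sym ∑h≡1)

    indicator : Subset n → Fin n → ℕ
    indicator p i = if does (i ∈? p) then 1 else 0

    indicator-∈ : ∀ {p i} → i Subset.∈ p → indicator p i ≡ 1
    indicator-∈ {p} {i} i∈ = cong (λ b → if b then 1 else 0) (dec-true (i ∈? p) i∈)

    indicator-∉ : ∀ {p i} → i Subset.∉ p → indicator p i ≡ 0
    indicator-∉ {p} {i} i∉ = cong (λ b → if b then 1 else 0) (dec-false (i ∈? p) i∉)

    ∑-indicator : ∀ p → ∑ (allFin n) (indicator p) ≡ ∣ p ∣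
    ∑-indicator p = trans (sym (Sum.⨁-filter (_∈? p) (allFin n) (λ _ → 1))) (trans (∑-1 (elements p)) (length-elements p))

    ⊆-∣∣-≡ : ∀ {p q : Subset n} → p Subset.⊆ q → ∣ p ∣ ≡ ∣ q ∣ → p ≡ q
    ⊆-∣∣-≡ {p} {q} p⊆q eq = Subsetₚ.⊆-antisym p⊆q λ x∈ → ∈-elements⁻ (∈-resp-↭
      (cover-↭ (elements-unique p) (λ x∈ → ∈-elements⁺ (p⊆q (∈-elements⁻ x∈)))
        (ℕₚ.≤-reflexive (trans (length-elements q) (trans (sym eq) (sym (length-elements p))))))
      (∈-elements⁺ x∈))

    ∈-minus⁻ : ∀ {p : Subset n} {x y} → y Subset.∈ p Subset.- x → y Subset.∈ p × y ≢ x
    ∈-minus⁻ {p} {x} y∈ = Subsetₚ.p─q⊆p p ⁅ x ⁆ y∈ , λ { refl → x∉p-x p x y∈ }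

    ⊆-∣∣-suc : ∀ {p q : Subset n} → p Subset.⊆ q → suc ∣ p ∣ ≡ ∣ q ∣ → ∃[ y ] y Subset.∈ q × p ≡ q Subset.- y
    ⊆-∣∣-suc {p} {q} p⊆q eq
      with zs , perm ← ⊆⇒↭++ (elements-unique p) (λ x∈ → ∈-elements⁺ (p⊆q (∈-elements⁻ x∈)))
      = go zs perm (ℕₚ.+-cancelˡ-≡ ∣ p ∣ _ _ (trans (sym (trans (trans (sym (length-elements q)) (↭-length perm))
                     (trans (Listₚ.length-++ (elements p)) (cong (_+ length zs) (length-elements p)))))
                     (trans (sym eq) (ℕₚ.+-comm 1 ∣ p ∣))))
      where
      go : ∀ zs → elements q ↭ elements p ++ zs → length zs ≡ 1 → ∃[ y ] y Subset.∈ q × p ≡ q Subset.- y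
      go (y ∷ []) perm refl = y , ∈-elements⁻ (∈-resp-↭ (Perm.↭-sym perm) (∈-++⁺ʳ (elements p) (here refl))) ,
        Subsetₚ.⊆-antisym
          (λ x∈ → Subsetₚ.x∈p∧x≢y⇒x∈p-y (p⊆q x∈) (λ { refl → Unique[x∷xs]⇒x∉xs y-unique (∈-++⁺ˡ (∈-elements⁺ x∈)) }))
          (λ x∈ → let x∈q , x≢y = ∈-minus⁻ x∈ in back x≢y (∈-++⁻ (elements p) (∈-resp-↭ perm (∈-elements⁺ x∈q))))
        where
        y-unique : Unique (y ∷ elements p ++ [])
        y-unique = Unique-resp-↭ (shift y (elements p) []) (Unique-resp-↭ perm (elements-unique q))
        back : ∀ {x} → x ≢ y → x ∈ elements p ⊎ x ∈ y ∷ [] → x Subset.∈ p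
        back x≢y (inj₁ x∈) = ∈-elements⁻ x∈
        back x≢y (inj₂ (here x≡y)) = contradiction x≡y x≢y

  module _ {n : ℕ} where
    closedWalks-balanced : ∀ {N} {D : List (Arc n)} → closedWalks N D ≢ 0 → ∀ i → outdegree D i ≡ indegree D i
    closedWalks-balanced {N} {D} ≢0 i with u , _ , w≢0 ← ∑≢0 {xs = allFin n} ≢0 with walks≡0⊎balanced N D u u
    ... | inj₁ e   = contradiction e w≢0
    ... | inj₂ bal = ℕₚ.+-cancelʳ-≡ (δ i u) _ _ (bal i)

    -- Both `P` and its complement are closed under arcs, and each contains the tail of an arc;
    -- wherever the walk starts, it misses one of the two.
    closedWalks-connected : ∀ {N p} {D : List (Arc n)} {P : Fin n → Set p} → (∀ i → Dec (P i)) →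
      (∀ {a} → a ∈ D → P (proj₁ a) → P (proj₂ a)) → (∀ {a} → a ∈ D → ¬ P (proj₁ a) → ¬ P (proj₂ a)) →
      ∀ {a b} → a ∈ D → P (proj₁ a) → b ∈ D → ¬ P (proj₁ b) → closedWalks N D ≡ 0
    closedWalks-connected {N} {D = D} {P} P? closed closed′ a∈ Pa b∈ ¬Pb = Sum.⨁-ε (allFin n) (λ {u} _ → from u (P? u))
      where
      from : ∀ u → Dec (P u) → walks N D u u ≡ 0
      from u (yes Pu) = walks-unreachable {P = P} N D u u closed Pu b∈ ¬Pb
      from u (no ¬Pu) = walks-unreachable {P = λ i → ¬ P i} N D u u closed′ ¬Pu a∈ (λ ¬P → ¬P Pa)

-- Classification of the contributing configurations

module Analysis {c ℓ₁ ℓ₂ : Level} (F : OrderedField c ℓ₁ ℓ₂) {r n : ℕ} (G : Hypergraph (suc (suc r)) n) (α : OrderedField.Carrier F) where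
  open Trees
  open Walks
  open Euler
  open Lists
  open Bounds
  open RowOperators F using (Choice; module Rows)
  open Rows G α
  open Expansion F
  open Configurations G α
  open Hypergraph G
  open import Data.Nat.Base using (zero; _+_; _*_; _≤_; z≤n; s≤s)
  open import Data.Nat.Tactic.RingSolver using (solve-∀)
  open ≡ using (cong; cong₂; sym; trans; subst; subst₂)
  open ≡.≡-Reasoning

  isLoop isEdge : Choice n → ℕ
  isLoop nothing  = 1
  isLoop (just _) = 0
  isEdge nothing  = 0
  isEdge (just _) = 1

  hits : Fin n → Fin n → Choice n → ℕ
  hits j i nothing  = 0
  hits j i (just e) = ∑ (others e i) (δ j)

  ValidChoice : Fin n → Choice n → Set
  ValidChoice i x = ∀ {e} → x ≡ just e → Edge e × i Subset.∈ e

  Valid : Configuration → Set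
  Valid Γ = ∀ i {e} → just e ∈ lookup Γ i → Edge e × i Subset.∈ e

  hits≤1 : ∀ j i x → hits j i x ≤ 1
  hits≤1 j i nothing  = z≤n
  hits≤1 j i (just e) with Data.List.Membership.DecPropositional._∈?_ _≟_ j (others e i)
  ... | yes j∈ = ℕₚ.≤-reflexive (∑-δ-∈ (others-unique e i) j∈)
  ... | no j∉  = subst (_≤ 1) (sym (∑-δ≡0 j∉)) z≤n

  hits-∈ : ∀ {e j i} → j Subset.∈ e → j ≢ i → hits j i (just e) ≡ 1
  hits-∈ {e} {j} {i} j∈ j≢i = ∑-δ-∈ (others-unique e i) (∈-others⁺ j∈ j≢i)

  hits-∉ : ∀ {e j i} → j Subset.∉ e → hits j i (just e) ≡ 0
  hits-∉ j∉ = ∑-δ≡0 (λ j∈ → j∉ (proj₁ (∈-others⁻ j∈)))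

  hits-self : ∀ i x → hits i i x ≡ 0
  hits-self i nothing  = refl
  hits-self i (just e) = ∑-δ≡0 (λ i∈ → proj₂ (∈-others⁻ {p = e} i∈) refl)

  targets-length : ∀ {i} x → ValidChoice i x → length (targets i x) ≡ m
  targets-length {i} nothing  v = Listₚ.length-replicate m
  targets-length {i} (just e) v = length-others (proj₂ (v refl)) (uniform (proj₁ (v refl)))

  targets-in : ∀ i j x → ∑ (targets i x) (δ j) ≡ δ i j * (isLoop x * m) + hits j i x
  targets-in i j nothing  = trans (go m) (trans (cong (m *_) (δ-sym j i)) (lem m (δ i j)))
    where
    go : ∀ m → ∑ (replicate m i) (δ j) ≡ m * δ j i
    go zero    = refl
    go (suc m) = cong (δ j i +_) (go m)
    lem : ∀ m d → m * d ≡ d * (1 * m) + 0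
    lem = solve-∀
  targets-in i j (just e) = sym (cong (_+ hits j i (just e)) (ℕₚ.*-zeroʳ (δ i j)))

  module _ (Γ : Configuration) where
    word : Fin n → List (Choice n)
    word = lookup Γ

    len loops edges incidence : Fin n → ℕ
    len i       = length (word i)
    loops i     = ∑ (word i) isLoop
    edges i     = ∑ (word i) isEdge
    incidence j = ∑ (allFin n) (λ i → ∑ (word i) (hits j i))

    len≡loops+edges : ∀ i → len i ≡ loops i + edges i
    len≡loops+edges i = trans (sym (∑-1 (word i))) (trans (Sum.⨁-cong (word i) (λ { nothing → refl ; (just _) → refl }))
      (Sum.⨁-∙ (word i) isLoop isEdge))

    ∑-arcs : ∀ (f : Arc n → ℕ) → ∑ (arcs Γ) f ≡
             ∑ (allFin n) (λ i → ∑ (word i) (λ x → ∑ (targets i x) (λ t → f (i , t))))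
    ∑-arcs f = trans (Sum.⨁-concatMap (λ i → wordArcs i (word i)) (allFin n) f)
      (Sum.⨁-cong (allFin n) (λ i → trans (Sum.⨁-concatMap (choiceArcs i) (word i) f)
        (Sum.⨁-cong (word i) (λ x → Sum.⨁-map (i ,_) (targets i x) f))))

    arcs-∈⁻ : ∀ {a} → a ∈ arcs Γ → ∃[ x ] x ∈ word (proj₁ a) × proj₂ a ∈ targets (proj₁ a) x
    arcs-∈⁻ {a} a∈
      with i , _ , a∈′ ← find (∈-concatMap⁻ (λ i → wordArcs i (word i)) {xs = allFin n} a∈)
      with x , x∈ , a∈″ ← find (∈-concatMap⁻ (choiceArcs i) {xs = word i} a∈′)
      with t , t∈ , refl ← ∈-map⁻ (i ,_) a∈″ = x , x∈ , t∈

    arcs-∈⁺ : ∀ {i x t} → x ∈ word i → t ∈ targets i x → (i , t) ∈ arcs Γ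
    arcs-∈⁺ {i} x∈ t∈ = ∈-concatMap⁺ (λ i → wordArcs i (word i)) (lose (∈-allFin i)
      (∈-concatMap⁺ (choiceArcs i) (lose x∈ (∈-map⁺ (i ,_) t∈))))

    module _ (valid : Valid Γ) where
      private
        valid-choice : ∀ {i x} → x ∈ word i → ValidChoice i x
        valid-choice x∈ refl = valid _ x∈

      outdegree-arcs : ∀ j → outdegree (arcs Γ) j ≡ len j * m
      outdegree-arcs j = begin
        ∑ (arcs Γ) (λ a → δ j (proj₁ a))
          ≡⟨ ∑-arcs (λ a → δ j (proj₁ a)) ⟩
        ∑ (allFin n) (λ i → ∑ (word i) (λ x → ∑ (targets i x) (λ _ → δ j i)))
          ≡⟨ Sum.⨁-cong (allFin n) (λ i → trans
               (Sum.⨁-cong-∈ (word i) (λ {x} x∈ → trans (const (targets i x) (δ j i))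
                 (cong (_* δ j i) (targets-length x (valid-choice x∈)))))
               (trans (const (word i) (m * δ j i)) (trans (cong (λ d → len i * (m * d)) (δ-sym j i)) (lem (len i) m (δ i j))))) ⟩
        ∑ (allFin n) (λ i → δ i j * (len i * m))
          ≡⟨ ∑-δ (allFin⁺ n) (∈-allFin j) (λ i → len i * m) ⟩
        len j * m ∎
        where
        const : ∀ {a} {A : Set a} (xs : List A) d → ∑ xs (λ _ → d) ≡ length xs * d
        const []       d = refl
        const (_ ∷ xs) d = cong (d +_) (const xs d)
        lem : ∀ a b c → a * (b * c) ≡ c * (a * b)
        lem = solve-∀

      arcs-length : length (arcs Γ) ≡ total Γ * m
      arcs-length = trans (sym (∑-outdegree (arcs Γ))) (trans (Sum.⨁-cong (allFin n) outdegree-arcs)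
        (sym (∑-*ʳ m (allFin n) len)))

      indegree-arcs : ∀ j → indegree (arcs Γ) j ≡ loops j * m + incidence j
      indegree-arcs j = begin
        ∑ (arcs Γ) (λ a → δ j (proj₂ a))
          ≡⟨ ∑-arcs (λ a → δ j (proj₂ a)) ⟩
        ∑ (allFin n) (λ i → ∑ (word i) (λ x → ∑ (targets i x) (δ j)))
          ≡⟨ Sum.⨁-cong (allFin n) (λ i → trans (Sum.⨁-cong (word i) (targets-in i j))
               (trans (Sum.⨁-∙ (word i) (λ x → δ i j * (isLoop x * m)) (hits j i))
                 (cong (_+ ∑ (word i) (hits j i)) (trans (sym (∑-*ˡ (δ i j) (word i) (λ x → isLoop x * m)))
                   (cong (δ i j *_) (sym (∑-*ʳ m (word i) isLoop))))))) ⟩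
        ∑ (allFin n) (λ i → δ i j * (loops i * m) + ∑ (word i) (hits j i))
          ≡⟨ Sum.⨁-∙ (allFin n) (λ i → δ i j * (loops i * m)) _ ⟩
        ∑ (allFin n) (λ i → δ i j * (loops i * m)) + incidence j
          ≡⟨ cong (_+ incidence j) (∑-δ (allFin⁺ n) (∈-allFin j) (λ i → loops i * m)) ⟩
        loops j * m + incidence j ∎

      -- A loop counts once in both degrees, so that only the edges matter for the balance.
      edges-incidence : ∀ {N} → closedWalks N (arcs Γ) ≢ 0 → ∀ j → edges j * m ≡ incidence j
      edges-incidence {N} ≢0 j = ℕₚ.+-cancelˡ-≡ (loops j * m) _ _ (begin
        loops j * m + edges j * m    ≡⟨ ℕₚ.*-distribʳ-+ m (loops j) (edges j) ⟨
        (loops j + edges j) * m      ≡⟨ cong (_* m) (len≡loops+edges j) ⟨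
        len j * m                    ≡⟨ outdegree-arcs j ⟨
        outdegree (arcs Γ) j         ≡⟨ closedWalks-balanced {N = N} ≢0 j ⟩
        indegree (arcs Γ) j          ≡⟨ indegree-arcs j ⟩
        loops j * m + incidence j    ∎)

  loopConfig : ℕ → Fin n → Configuration
  loopConfig d i = Vec.tabulate λ j → if does (j ≟ i) then replicate d nothing else []

  -- At vertex `j` there are `p j` diagonal entries before the edge and `q j` after it. Words are
  -- ordered, so the two places of a spare diagonal entry give different configurations.
  edgeConfig : (p q : Fin n → ℕ) → Subset n → Configuration
  edgeConfig p q e = Vec.tabulate λ j →
    if does (j ∈? e) then replicate (p j) nothing ++ just e ∷ replicate (q j) nothing else []

  cliqueWord : Subset n → (σ : Fin (suc k) → Fin n) → Vec (Fin (suc k)) (suc k) → ∀ {j} → Dec (∃[ a ] σ a ≡ j) → List (Choice n)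
  cliqueWord S σ h (yes (a , _)) = just (S Subset.- σ (lookup h a)) ∷ []
  cliqueWord S σ h (no _)        = []

  -- At each vertex σ a of S, the edge of S missing the vertex σ (h a).
  cliqueConfig : Subset n → (Fin (suc k) → Fin n) → Vec (Fin (suc k)) (suc k) → Configuration
  cliqueConfig S σ h = Vec.tabulate λ j → cliqueWord S σ h (Finₚ.any? (λ a → σ a ≟ j))

  -- Labelling the vertices of `S` by `Fin (suc k)` lets `h` range over a list that is the same for
  -- all `S`.
  enumerate : (S : Subset n) → length (elements S) ≡ suc k → Fin (suc k) → Fin n
  enumerate S p a = List.lookup (elements S) (Fin.cast (sym p) a)

  lookup-injective : ∀ {a} {A : Set a} {xs : List A} → Unique xs → ∀ {i j} → List.lookup xs i ≡ List.lookup xs j → i ≡ j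
  lookup-injective {xs = x ∷ xs} u         {Fin.zero}  {Fin.zero}  eq = refl
  lookup-injective {xs = x ∷ xs} u         {Fin.zero}  {Fin.suc j} eq =
    contradiction (subst (_∈ xs) (sym eq) (∈-lookup j)) (Unique[x∷xs]⇒x∉xs u)
  lookup-injective {xs = x ∷ xs} u         {Fin.suc i} {Fin.zero}  eq =
    contradiction (subst (_∈ xs) eq (∈-lookup i)) (Unique[x∷xs]⇒x∉xs u)
  lookup-injective {xs = x ∷ xs} (_ ∷ uxs) {Fin.suc i} {Fin.suc j} eq = cong Fin.suc (lookup-injective uxs eq)

  module _ (S : Subset n) (p : length (elements S) ≡ suc k) where
    enumerate-injective : ∀ {a b} → enumerate S p a ≡ enumerate S p b → a ≡ b
    enumerate-injective {a} {b} eq = trans (sym (Finₚ.cast-involutive p (sym p) a)) (trans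
      (cong (Fin.cast p) (lookup-injective (elements-unique S) eq)) (Finₚ.cast-involutive p (sym p) b))

    enumerate-∈ : ∀ a → enumerate S p a Subset.∈ S
    enumerate-∈ a = ∈-elements⁻ (∈-lookup (Fin.cast (sym p) a))

    enumerate-surjective : ∀ {i} → i Subset.∈ S → ∃[ a ] enumerate S p a ≡ i
    enumerate-surjective {i} i∈ = Fin.cast p (Any.index (∈-elements⁺ i∈)) ,
      trans (cong (List.lookup (elements S)) (Finₚ.cast-involutive (sym p) p _))
            (sym (Anyₚ.lookup-index (∈-elements⁺ i∈)))

  -- `first` and `last` say on which side of the edge the spare diagonal entry at `v` stands. A
  -- shape is only necessary for a nonzero term: `clique` admits every `h` without fixed points.
  data Shape (d : ℕ) (Γ : Configuration) : Set where
    loop   : ∀ i → Γ ≡ loopConfig d i → Shape d Γ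
    edge   : ∀ e → Edge e → d ≡ k → Γ ≡ edgeConfig (λ _ → 0) (λ _ → 0) e → Shape d Γ
    first  : ∀ e v → Edge e → v Subset.∈ e → d ≡ suc k → Γ ≡ edgeConfig (λ j → δ j v) (λ _ → 0) e → Shape d Γ
    last   : ∀ e v → Edge e → v Subset.∈ e → d ≡ suc k → Γ ≡ edgeConfig (λ _ → 0) (λ j → δ j v) e → Shape d Γ
    clique : ∀ S (p : length (elements S) ≡ suc k) h → Complete S → (∀ a → lookup h a ≢ a) → d ≡ suc k →
             Γ ≡ cliqueConfig S (enumerate S p) h → Shape d Γ

  ∈-replicate : ∀ {a} {A : Set a} m {x y : A} → x ∈ replicate m y → x ≡ y
  ∈-replicate (suc m) (here eq)  = eq
  ∈-replicate (suc m) (there x∈) = ∈-replicate m x∈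

  ≡-tabulate : ∀ {a l} {A : Set a} {v : Vec A l} {f} → (∀ i → lookup v i ≡ f i) → v ≡ Vec.tabulate f
  ≡-tabulate {v = v} eq = trans (sym (Vecₚ.tabulate∘lookup v)) (Vecₚ.tabulate-cong eq)

  single-edge : ∀ (w : List (Choice n)) → length w ≡ 1 → ∑ w isEdge ≢ 0 → ∃[ e ] w ≡ just e ∷ []
  single-edge (nothing ∷ []) refl ≢0 = contradiction refl ≢0
  single-edge (just e ∷ [])  refl ≢0 = e , refl

  no-edge : ∀ (w : List (Choice n)) → (∀ e → just e ∉ w) → w ≡ replicate (length w) nothing
  no-edge []            ∉ = refl
  no-edge (nothing ∷ w) ∉ = cong (nothing ∷_) (no-edge w (λ e e∈ → ∉ e (there e∈)))
  no-edge (just e ∷ w)  ∉ = contradiction (here refl) (∉ e)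

  length≡0 : ∀ {a} {A : Set a} {xs : List A} → length xs ≡ 0 → xs ≡ []
  length≡0 {xs = []} eq = refl

  module _ {d : ℕ} (Γ : Configuration) (valid : Valid Γ) (total≡d : total Γ ≡ d)
           (1≤d : 1 ≤ d) (d≤1+k : d ≤ suc k) (≢0 : closedWalks (d * m) (arcs Γ) ≢ 0) where
    private
      W : Fin n → List (Choice n)
      W = word Γ

      balance : ∀ j → edges Γ j * m ≡ incidence Γ j
      balance = edges-incidence Γ valid {d * m} ≢0

      edges≢0⁺ : ∀ {i e} → just e ∈ W i → edges Γ i ≢ 0
      edges≢0⁺ e∈ eq with () ← ∑≡0⇒≡0 eq e∈

      edges≢0⇒len≢0 : ∀ {i} → edges Γ i ≢ 0 → len Γ i ≢ 0
      edges≢0⇒len≢0 {i} ≢0 eq = ≢0 (ℕₚ.m+n≡0⇒n≡0 (loops Γ i) (trans (sym (len≡loops+edges Γ i)) eq))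

      -- If `j` chose no edge, the balance would give it incidence 0, but the choice of `e` at `i`
      -- sends an arc to `j`.
      neighbour : ∀ {i e j} → just e ∈ W i → j Subset.∈ e → edges Γ j ≢ 0
      neighbour {i} {e} {j} e∈ j∈ eq with j ≟ i
      ... | yes refl = edges≢0⁺ e∈ eq
      ... | no j≢i with () ← trans (sym (hits-∈ j∈ j≢i)) (∑≡0⇒≡0
              (∑≡0⇒≡0 {xs = allFin n} (trans (sym (balance j)) (cong (_* m) eq)) (∈-allFin i)) e∈)

      -- Every arc is a loop, so a second vertex with a nonempty word would form a component of its
      -- own.
      loops-only : (∀ i e → just e ∉ W i) → Shape d Γ
      loops-only none = loop i (≡-tabulate word≡)
        where
        some : ∃[ i ] i ∈ allFin n × len Γ i ≢ 0
        some = ∑≢0 {xs = allFin n} (λ e → ℕₚ.<⇒≢ 1≤d (sym (trans (sym total≡d) e)))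
        i : Fin n
        i = proj₁ some
        loop-arc : ∀ {j} → len Γ j ≢ 0 → (j , j) ∈ arcs Γ
        loop-arc {j} len≢0 = arcs-∈⁺ Γ {x = nothing} (nothing∈ (W j) (no-edge (W j) (none j)) len≢0) (here refl)
          where
          nothing∈ : ∀ w → w ≡ replicate (length w) nothing → length w ≢ 0 → nothing ∈ w
          nothing∈ []      _  ≢0 = contradiction refl ≢0
          nothing∈ (x ∷ w) eq ≢0 = here (sym (Listₚ.∷-injectiveˡ eq))
        loop-target : ∀ {a} → a ∈ arcs Γ → proj₂ a ≡ proj₁ a
        loop-target a∈ with arcs-∈⁻ Γ a∈
        ... | nothing , _  , t∈ = ∈-replicate m t∈
        ... | just e  , e∈ , _  = contradiction e∈ (none _ e)
        other : ∀ j → j ≢ i → len Γ j ≡ 0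
        other j j≢i with len Γ j ℕₚ.≟ 0
        ... | yes eq = eq
        ... | no ≢0′ = contradiction (closedWalks-connected {N = d * m} {P = _≡ i} (_≟ i)
                (λ a∈ Pa → trans (loop-target a∈) Pa) (λ a∈ ¬Pa Pb → ¬Pa (trans (sym (loop-target a∈)) Pb))
                (loop-arc (proj₂ (proj₂ some))) refl (loop-arc ≢0′) j≢i) ≢0
        len-i : len Γ i ≡ d
        len-i = trans (sym (Sum.⨁-single (allFin⁺ n) (∈-allFin i) (λ {j} _ → single j))) total≡d
          where
          single : ∀ j → j ≡ i ⊎ len Γ j ≡ 0
          single j with j ≟ i
          ... | yes j≡i = inj₁ j≡i
          ... | no j≢i  = inj₂ (other j j≢i)
        word≡ : ∀ j → W j ≡ (if does (j ≟ i) then replicate d nothing else [])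
        word≡ j with j ≟ i
        ... | yes refl = trans (no-edge (W i) (none i)) (cong (λ l → replicate l nothing) len-i)
        ... | no j≢i   = length≡0 (other j j≢i)

      module _ {i₀ e} (e∈ : just e ∈ W i₀) where
        E : Edge e
        E = proj₁ (valid i₀ e∈)

        -- All vertices of `e′` choose edges by `neighbour`, so they lie in `e`; as both are edges
        -- of size k, they coincide.
        only : (∀ t → edges Γ t ≢ 0 → t Subset.∈ e) → ∀ {j e′} → just e′ ∈ W j → e′ ≡ e
        only sub {j} e′∈ = ⊆-∣∣-≡ (λ {t} t∈ → sub t (neighbour e′∈ t∈))
          (trans (uniform (proj₁ (valid j e′∈))) (sym (uniform E)))

        indicator≤len : ∀ j → indicator e j ≤ len Γ j
        indicator≤len j with j ∈? e
        ... | yes j∈ = ℕₚ.n≢0⇒n>0 (edges≢0⇒len≢0 (neighbour e∈ j∈))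
        ... | no _   = z≤n

        ∑indicator : ∑ (allFin n) (indicator e) ≡ k
        ∑indicator = trans (∑-indicator e) (uniform E)

        edge-word : (∀ t → edges Γ t ≢ 0 → t Subset.∈ e) → ∀ {j} → j Subset.∈ e → len Γ j ≡ 1 → W j ≡ just e ∷ []
        edge-word sub {j} j∈ len≡1 with e′ , eq ← single-edge (W j) len≡1 (neighbour e∈ j∈) =
          trans eq (cong (λ e → just e ∷ []) (only sub (subst (just e′ ∈_) (sym eq) (here refl))))

        -- The k vertices of `e` already use up all factors, so the lengths of the words equal the
        -- indicator of `e`.
        one-edge : k ≡ d → Shape d Γ
        one-edge k≡d = edge e E (sym k≡d) (≡-tabulate word≡)
          where
          len≡ : ∀ j → indicator e j ≡ len Γ j
          len≡ = pointwise-≡ indicator≤len (trans ∑indicator (trans k≡d (sym total≡d)))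
          sub : ∀ t → edges Γ t ≢ 0 → t Subset.∈ e
          sub t ≢0 with t ∈? e
          ... | yes t∈ = t∈
          ... | no t∉  = contradiction (trans (sym (len≡ t)) (indicator-∉ t∉)) (edges≢0⇒len≢0 ≢0)
          word≡ : ∀ j → W j ≡ (if does (j ∈? e) then just e ∷ [] else [])
          word≡ j with j ∈? e
          ... | yes j∈ = edge-word sub j∈ (trans (sym (len≡ j)) (indicator-∈ j∈))
          ... | no j∉  = length≡0 (trans (sym (len≡ j)) (indicator-∉ j∉))

        module _ (d≡1+k : d ≡ suc k) {v} (len≡ : ∀ j → len Γ j ≡ indicator e j + δ j v) where
          len-other : ∀ {j} → j ≢ v → len Γ j ≡ indicator e j
          len-other {j} j≢v = trans (len≡ j) (trans (cong (indicator e j +_) (δ-≢ j≢v)) (ℕₚ.+-identityʳ _))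

          loop-inside : v Subset.∈ e → Shape d Γ
          loop-inside v∈ = split (W v) refl (trans (len≡ v) (cong₂ _+_ (indicator-∈ v∈) (δ-refl v))) (neighbour e∈ v∈)
            where
            sub : ∀ t → edges Γ t ≢ 0 → t Subset.∈ e
            sub t ≢0 with t ∈? e
            ... | yes t∈ = t∈
            ... | no t∉  = contradiction (trans (len-other {t} (λ { refl → t∉ v∈ })) (indicator-∉ t∉)) (edges≢0⇒len≢0 ≢0)
            word-other : ∀ {j} → j Subset.∈ e → j ≢ v → W j ≡ just e ∷ []
            word-other {j} j∈ j≢v = edge-word sub j∈ (trans (len-other j≢v) (indicator-∈ j∈))
            word-outside : ∀ {j} → j Subset.∉ e → W j ≡ []
            word-outside {j} j∉ = length≡0 (trans (len-other {j} (λ { refl → j∉ v∈ })) (indicator-∉ j∉))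
            -- The choices at `v` itself never hit `v`, and every other choice hits it at most once;
            -- altogether there are `suc k` choices.
            incidence≤m : incidence Γ v + len Γ v ≤ suc k
            incidence≤m = ℕₚ.≤-trans (ℕₚ.≤-trans
              (ℕₚ.+-mono-≤ (∑-mono {xs = allFin n} {g = λ i → len Γ i ℕ.∸ δ i v * len Γ i} (λ {i} _ → bound i))
                (ℕₚ.≤-reflexive (sym (∑-δ (allFin⁺ n) (∈-allFin v) (len Γ)))))
              (ℕₚ.≤-reflexive (trans (sym (Sum.⨁-∙ (allFin n) (λ i → len Γ i ℕ.∸ δ i v * len Γ i) (λ i → δ i v * len Γ i)))
                (Sum.⨁-cong (allFin n) (λ i → ℕₚ.m∸n+n≡m (δ≤1 i))))))
              (ℕₚ.≤-reflexive (trans total≡d d≡1+k))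
              where
              δ≤1 : ∀ i → δ i v * len Γ i ≤ len Γ i
              δ≤1 i with i ≟ v
              ... | yes _ = ℕₚ.≤-reflexive (ℕₚ.*-identityˡ (len Γ i))
              ... | no _  = z≤n
              bound : ∀ i → ∑ (W i) (hits v i) ≤ len Γ i ℕ.∸ δ i v * len Γ i
              bound i with i ≟ v
              ... | yes refl = subst (_≤ len Γ v ℕ.∸ 1 * len Γ v) (sym (Sum.⨁-ε (W v) (λ {x} _ → hits-self v x))) z≤n
              ... | no _     = ℕₚ.≤-trans (∑-mono {xs = W i} (λ {x} _ → hits≤1 v i x)) (ℕₚ.≤-reflexive (∑-1 (W i)))
            split : ∀ w → W v ≡ w → length w ≡ 2 → ∑ w isEdge ≢ 0 → Shape d Γ
            split (nothing ∷ nothing ∷ []) eq refl ≢0 = contradiction refl ≢0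
            split (just e₁ ∷ nothing ∷ []) eq refl ≢0 = last e v E v∈ d≡1+k (≡-tabulate word≡)
              where
              word≡ : ∀ j → W j ≡ (if does (j ∈? e) then just e ∷ replicate (δ j v) nothing else [])
              word≡ j with j ∈? e | j ≟ v
              ... | no j∉  | _        = word-outside j∉
              ... | yes j∈ | no j≢v   = word-other j∈ j≢v
              ... | yes j∈ | yes refl = trans eq (cong (λ e → just e ∷ nothing ∷ [])
                (only sub (subst (just e₁ ∈_) (sym eq) (here refl))))
            split (nothing ∷ just e₁ ∷ []) eq refl ≢0 = first e v E v∈ d≡1+k (≡-tabulate word≡)
              where
              word≡ : ∀ j → W j ≡ (if does (j ∈? e) then replicate (δ j v) nothing ++ just e ∷ [] else [])
              word≡ j with j ∈? e | j ≟ v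
              ... | no j∉  | _        = word-outside j∉
              ... | yes j∈ | no j≢v   = word-other j∈ j≢v
              ... | yes j∈ | yes refl = trans eq (cong (λ e → nothing ∷ just e ∷ [])
                (only sub (subst (just e₁ ∈_) (sym eq) (there (here refl)))))
            -- Two edges at `v` would call for 2(k-1) arcs into `v`, but only k - 1 choices are made
            -- at other vertices.
            split (just e₁ ∷ just e₂ ∷ []) eq refl ≢0 = contradiction
              (subst₂ (λ a b → a + b ≤ suc k) (trans (sym (balance v)) (cong (λ w → ∑ w isEdge * m) eq)) (cong length eq) incidence≤m)
              (ℕₚ.<⇒≱ (s≤s (ℕₚ.≤-trans (ℕₚ.m≤m+n (suc k) r) (ℕₚ.≤-reflexive (lem r)))))
              where
              lem : ∀ r → suc (suc (suc r)) + r ≡ r + suc (r + 0) + 2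
              lem = solve-∀

          module _ (v∉ : v Subset.∉ e) where
            len-v : len Γ v ≡ 1
            len-v = trans (len≡ v) (cong₂ _+_ (indicator-∉ v∉) (δ-refl v))

            -- A vertex outside `e` with nothing but a loop is a component of its own: all chosen
            -- edges equal `e` and do not reach it.
            loop-outside : W v ≢ nothing ∷ []
            loop-outside eq = ≢0 (closedWalks-connected {N = d * m} {P = _≡ v} (_≟ v) closed closed′
              (arcs-∈⁺ Γ {x = nothing} (subst (nothing ∈_) (sym eq) (here refl)) (here refl)) refl
              (proj₂ other) (λ { refl → v∉ (proj₂ (valid i₀ e∈)) }))
              where
              sub : ∀ t → edges Γ t ≢ 0 → t Subset.∈ e
              sub t ≢0 with t ∈? e
              ... | yes t∈ = t∈
              ... | no t∉ with t ≟ v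
              ...   | yes refl = contradiction (cong (λ w → ∑ w isEdge) eq) ≢0
              ...   | no t≢v   = contradiction (trans (len-other {t} t≢v) (indicator-∉ t∉)) (edges≢0⇒len≢0 ≢0)
              closed : ∀ {a} → a ∈ arcs Γ → proj₁ a ≡ v → proj₂ a ≡ v
              closed a∈ refl with x , x∈ , t∈ ← arcs-∈⁻ Γ a∈ with subst (x ∈_) eq x∈
              ... | here refl = ∈-replicate m t∈
              closed′ : ∀ {a} → a ∈ arcs Γ → proj₁ a ≢ v → proj₂ a ≢ v
              closed′ a∈ ≢v refl with arcs-∈⁻ Γ a∈
              ... | nothing , x∈  , t∈ = ≢v (sym (∈-replicate m t∈))
              ... | just e′ , e′∈ , t∈ = v∉ (subst (v Subset.∈_) (only sub e′∈) (proj₁ (∈-others⁻ {p = e′} t∈)))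
              other : ∃[ t ] (i₀ , t) ∈ arcs Γ
              other = let t , t∈ = inhabited (others e i₀) (length-others (proj₂ (valid i₀ e∈)) (uniform E)) in
                t , arcs-∈⁺ Γ {x = just e} e∈ t∈
                where
                inhabited : ∀ xs → length xs ≡ m → ∃[ t ] t ∈ xs
                inhabited (t ∷ _) _ = t , here refl

            -- Each vertex of `S`, that is `e` with `v` added, has a single factor, and it is an
            -- edge. By `neighbour` the vertices of this edge carry edges too, so it lies in `S` and
            -- misses exactly one vertex, which `h` records.
            many-edges : W v ≢ nothing ∷ [] → Shape d Γ
            many-edges ≢loop = clique S size h complete h≢ d≡1+k (≡-tabulate word≡)
              where
              S : Subset n
              S = e Subset.∪ ⁅ v ⁆
              e⊆S : ∀ {j} → j Subset.∈ e → j Subset.∈ S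
              e⊆S j∈ = Subsetₚ.x∈p∪q⁺ (inj₁ j∈)
              v∈S : v Subset.∈ S
              v∈S = Subsetₚ.x∈p∪q⁺ (inj₂ (Subsetₚ.x∈⁅x⁆ v))
              len-S : ∀ j → len Γ j ≡ indicator S j
              len-S j with j ≟ v
              ... | yes refl = trans len-v (sym (indicator-∈ v∈S))
              ... | no j≢v with j ∈? e
              ...   | yes j∈ = trans (len-other j≢v) (trans (indicator-∈ j∈) (sym (indicator-∈ (e⊆S j∈))))
              ...   | no j∉  = trans (len-other j≢v) (trans (indicator-∉ j∉) (sym (indicator-∉ j∉S)))
                where
                j∉S : j Subset.∉ S
                j∉S j∈ with Subsetₚ.x∈p∪q⁻ e ⁅ v ⁆ j∈
                ... | inj₁ j∈e = j∉ j∈e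
                ... | inj₂ j∈v = j≢v (Subsetₚ.x∈⁅y⁆⇒x≡y v j∈v)
              ∣S∣ : ∣ S ∣ ≡ suc k
              ∣S∣ = trans (sym (∑-indicator S)) (trans (Sum.⨁-cong (allFin n) (λ j → sym (len-S j))) (trans total≡d d≡1+k))
              size : length (elements S) ≡ suc k
              size = trans (length-elements S) ∣S∣
              σ : Fin (suc k) → Fin n
              σ = enumerate S size
              ∈S : ∀ {t} → edges Γ t ≢ 0 → t Subset.∈ S
              ∈S {t} ≢0 with t ∈? S
              ... | yes t∈ = t∈
              ... | no t∉  = contradiction (trans (len-S t) (indicator-∉ t∉)) (edges≢0⇒len≢0 ≢0)
              edges≢0 : ∀ {j} → j Subset.∈ S → edges Γ j ≢ 0
              edges≢0 {j} j∈ with Subsetₚ.x∈p∪q⁻ e ⁅ v ⁆ j∈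
              ... | inj₁ j∈e = neighbour e∈ j∈e
              ... | inj₂ j∈v with refl ← Subsetₚ.x∈⁅y⁆⇒x≡y v j∈v = at-v (W v) len-v ≢loop
                where
                at-v : ∀ w → length w ≡ 1 → w ≢ nothing ∷ [] → ∑ w isEdge ≢ 0
                at-v (nothing ∷ []) refl ≢loop = contradiction refl ≢loop
                at-v (just _ ∷ [])  refl _     ()
              missing : ∀ {j} → j Subset.∈ S → ∃[ y ] y Subset.∈ S × y ≢ j × W j ≡ just (S Subset.- y) ∷ [] × Edge (S Subset.- y)
              missing {j} j∈ with g , eq ← single-edge (W j) (trans (len-S j) (indicator-∈ j∈)) (edges≢0 j∈) =
                let g∈ = subst (just g ∈_) (sym eq) (here refl)
                    Eg , j∈g = valid j g∈
                    y , y∈ , g≡ = ⊆-∣∣-suc {p = g} {S} (λ t∈ → ∈S (neighbour g∈ t∈)) (trans (cong suc (uniform Eg)) (sym ∣S∣))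
                in y , y∈ , (λ y≡j → proj₂ (∈-minus⁻ (subst (j Subset.∈_) g≡ j∈g)) (sym y≡j))
                 , trans eq (cong (λ g → just g ∷ []) g≡) , subst Edge g≡ Eg
              missing-a : ∀ a → ∃[ y ] y Subset.∈ S × y ≢ σ a × W (σ a) ≡ just (S Subset.- y) ∷ [] × Edge (S Subset.- y)
              missing-a a = missing (enumerate-∈ S size a)
              index : ∀ a → ∃[ b ] σ b ≡ proj₁ (missing-a a)
              index a = enumerate-surjective S size (proj₁ (proj₂ (missing-a a)))
              h : Vec (Fin (suc k)) (suc k)
              h = Vec.tabulate (λ a → proj₁ (index a))
              h-index : ∀ a → σ (lookup h a) ≡ proj₁ (missing-a a)
              h-index a = trans (cong σ (Vecₚ.lookup∘tabulate (λ a → proj₁ (index a)) a)) (proj₂ (index a))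
              h≢ : ∀ a → lookup h a ≢ a
              h≢ a eq = proj₁ (proj₂ (proj₂ (missing-a a))) (trans (sym (h-index a)) (cong σ eq))
              word≡ : ∀ j → W j ≡ cliqueWord S σ h (Finₚ.any? (λ a → σ a ≟ j))
              word≡ j = by (Finₚ.any? (λ a → σ a ≟ j))
                where
                by : ∀ {j} (x : Dec (∃[ a ] σ a ≡ j)) → W j ≡ cliqueWord S σ h x
                by (yes (a , refl)) = trans (proj₁ (proj₂ (proj₂ (proj₂ (missing-a a)))))
                  (cong (λ y → just (S Subset.- y) ∷ []) (sym (h-index a)))
                by {j} (no ∄) = length≡0 (trans (len-S j) (indicator-∉ (λ j∈ → ∄ (enumerate-surjective S size j∈))))
              minus-edge : ∀ {t} → t Subset.∈ S → Edge (S Subset.- t)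
              minus-edge {t} t∈ = from violated
                where
                edges-t : edges Γ t ≡ 1
                edges-t = cong (λ w → ∑ w isEdge) (proj₁ (proj₂ (proj₂ (proj₂ (missing t∈)))))
                hit : Fin n → ℕ
                hit i = ∑ (W i) (hits t i) + δ i t
                -- The summand `δ i t` excuses `t` itself. If each further vertex of `S` hit `t`,
                -- there would be k hits, while one edge at `t` balances only k - 1. So some vertex
                -- other than `t` has an edge avoiding `t`, which can only be `S` without `t`.
                violated : ∃[ i ] ¬ (indicator S i ≤ hit i)
                violated = Finₚ.¬∀⟶∃¬ n _ (λ i → indicator S i ℕₚ.≤? hit i) (λ all →
                  ℕₚ.1+n≰n (subst₂ _≤_ (trans (∑-indicator S) ∣S∣)
                    (trans (Sum.⨁-∙ (allFin n) (λ i → ∑ (W i) (hits t i)) (λ i → δ i t))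
                      (trans (cong₂ _+_ (sym (balance t)) (trans (Sum.⨁-cong (allFin n) (λ i → δ-sym i t)) (∑-δ-∈ (allFin⁺ n) (∈-allFin t))))
                        (trans (cong (λ x → x * m + 1) edges-t) (trans (ℕₚ.+-comm (1 * m) 1) (cong suc (ℕₚ.*-identityˡ m))))))
                    (∑-mono {xs = allFin n} (λ {i} _ → all i))))
                from : ∃[ i ] ¬ (indicator S i ≤ hit i) → Edge (S Subset.- t)
                from (i , ≰) with i ∈? S
                ... | no i∉ = contradiction z≤n ≰
                ... | yes i∈ with y , y∈ , y≢i , eq , Ey ← missing i∈ with t ≟ y
                ...   | yes refl = Ey
                ...   | no t≢y with i ≟ t
                ...     | yes refl = contradiction (ℕₚ.m≤n+m 1 (∑ (W i) (hits i i))) ≰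
                ...     | no i≢t = contradiction (ℕₚ.≤-reflexive (sym (cong (_+ 0) (trans (cong (λ w → ∑ w (hits t i)) eq)
                  (cong (_+ 0) (hits-∈ {j = t} {i} (Subsetₚ.x∈p∧x≢y⇒x∈p-y t∈ t≢y) (λ e → i≢t (sym e)))))))) ≰
              complete : Complete S
              complete = All.tabulate λ {e′} _ (e′⊆S , ∣e′∣) →
                let y , y∈ , eq = ⊆-∣∣-suc {p = e′} {S} e′⊆S (trans (cong suc ∣e′∣) (sym ∣S∣)) in subst Edge (sym eq) (minus-edge y∈)

          two-cases : Shape d Γ
          two-cases with v ∈? e
          ... | yes v∈ = loop-inside v∈
          ... | no v∉  = many-edges v∉ (loop-outside v∉)

        some-edge : Shape d Γ
        -- Each of the k vertices of `e` has a nonempty word, so k ≤ d, and at most one factor is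
        -- spare.
        some-edge with ℕₚ.m≤n⇒m<n∨m≡n {k} {d} (subst₂ _≤_ ∑indicator total≡d (∑-mono {xs = allFin n} (λ {j} _ → indicator≤len j)))
        ... | inj₂ k≡d = one-edge k≡d
        ... | inj₁ k<d =
          let d≡1+k = ℕₚ.≤-antisym d≤1+k k<d
              v , len≡ = pointwise-suc indicator≤len (trans (cong suc ∑indicator) (trans (sym d≡1+k) (sym total≡d)))
          in two-cases d≡1+k len≡

    classify : Shape d Γ
    classify with Finₚ.any? (λ i → Any.any? is-just? (W i))
      where
      is-just? : (x : Choice n) → Dec (∃[ e ] x ≡ just e)
      is-just? nothing  = no λ ()
      is-just? (just e) = yes (e , refl)
    ... | yes (i , x∈) with x , x∈′ , e , refl ← find x∈ = some-edge x∈′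
    ... | no ∄ = loops-only (λ i e e∈ → ∄ (i , lose e∈ (e , refl)))

-- Terms of the loop and edge configurations

module Evaluation {c ℓ₁ ℓ₂ : Level} (F : OrderedField c ℓ₁ ℓ₂) {r n : ℕ} (G : Hypergraph (suc (suc r)) n) (α : OrderedField.Carrier F) where
  open OrderedField F hiding (refl; _<_; _≤_)
  open FieldLemmas F
  open Trees using (δ; δ-≢; δ-sym; module Sum) renaming (∑ to ∑ℕ)
  open Walks
  open Euler
  open Lists
  open Bounds
  open RowOperators F using (Choice; module Rows)
  open Rows G α
  open Expansion F
  open Configurations G α
  open Analysis F G α
  open Hypergraph G
  open import Data.Nat.Base using (zero; _!)
  open import Relation.Binary.Reasoning.Setoid K.setoid
  open ≡ using (cong; cong₂; subst)

  walks-no-start : ∀ {N D} {u v : Fin n} → outdegree D u ≡ 0 → walks (suc N) D u v ≡ 0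
  walks-no-start {D = D} {u} out≡0 = Sum.⨁-ε (picks D) (λ {x} x∈ → δ-case-0 u (proj₁ (proj₁ x))
    (λ { refl → contradiction refl (outdegree≡0 {i = u} out≡0 (∈-resp-↭ (picks-↭ x∈) (here refl))) }))

  ≡-∈ : ∀ {a} {A : Set a} {x : A} {xs ys} → xs ≡ ys → x ∈ xs → x ∈ ys
  ≡-∈ refl x∈ = x∈

  -- At a vertex with L + 1 outgoing arcs the operator contributes 1/(L+1)! and the walk count L!;
  -- this is what remains of the two.
  1/!-suc : ∀ L → (1/! suc L) * fromℕ (L !) ≈ 1/ suc L
  1/!-suc L = begin
    (1/! suc L) * fromℕ (L !)                                      ≈⟨ *-identityʳ _ ⟨
    (1/! suc L) * fromℕ (L !) * 1#                                 ≈⟨ *-congˡ (1/-inverse (suc L)) ⟨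
    (1/! suc L) * fromℕ (L !) * ((1/ suc L) * fromℕ (suc L))       ≈⟨ lem (1/! suc L) (fromℕ (L !)) (1/ suc L) (fromℕ (suc L)) ⟩
    (1/ suc L) * ((1/! suc L) * (fromℕ (suc L) * fromℕ (L !)))     ≈⟨ *-congˡ (*-congˡ (fromℕ-* (suc L) (L !))) ⟨
    (1/ suc L) * ((1/! suc L) * fromℕ (suc L !))                   ≈⟨ *-congˡ (1/!-inverse (suc L)) ⟩
    (1/ suc L) * 1#                                                ≈⟨ *-identityʳ _ ⟩
    (1/ suc L)                                                     ∎
    where
    lem : ∀ a b c d → a * b * (c * d) ≈ c * (a * (d * b))
    lem = solve 4 (λ a b c d → a :* b :* (c :* d) := c :* (a :* (d :* b))) K.refl

  wordWeight-[] : ∀ i → wordWeight i [] ≈ 1#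
  wordWeight-[] i = trans (*-identityʳ _) 1/!0

  ∏F-replicate : ∀ {a} {A : Set a} d (x : A) f → ∏F (replicate d x) f ≈ f x ^ d
  ∏F-replicate zero    x f = K.refl
  ∏F-replicate (suc d) x f = *-congˡ (∏F-replicate d x f)

  module _ (d : ℕ) (i : Fin n) where
    private
      Γ : Configuration
      Γ = loopConfig (suc d) i
      D : List (Arc n)
      D = arcs Γ
      -- Chosen so that `suc N` computes to `suc d * m`, the number of arcs.
      N : ℕ
      N = r ℕ.+ d ℕ.* suc r

      word≡ : ∀ j → word Γ j ≡ (if does (j ≟ i) then replicate (suc d) nothing else [])
      word≡ = Vecₚ.lookup∘tabulate _

    loopConfig-self : word Γ i ≡ replicate (suc d) nothing
    loopConfig-self = ≡.trans (word≡ i) (cong (λ b → if b then replicate (suc d) nothing else []) (dec-true (i ≟ i) refl))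

    loopConfig-other : ∀ {j} → j ≢ i → word Γ j ≡ []
    loopConfig-other {j} j≢i = ≡.trans (word≡ j) (cong (λ b → if b then replicate (suc d) nothing else []) (dec-false (j ≟ i) j≢i))

    loopConfig-nothing : ∀ {j x} → x ∈ word Γ j → j ≡ i × x ≡ nothing
    loopConfig-nothing {j} x∈ with j ≟ i
    ... | yes refl = refl , ∈-replicate (suc d) (≡-∈ loopConfig-self x∈)
    ... | no j≢i with () ← ≡-∈ (loopConfig-other j≢i) x∈

    private
      valid : Valid Γ
      valid j e∈ with () ← proj₂ (loopConfig-nothing e∈)

      len-self : len Γ i ≡ suc d
      len-self = ≡.trans (cong length loopConfig-self) (Listₚ.length-replicate (suc d))

    loopConfig-total : total Γ ≡ suc d
    loopConfig-total = ≡.trans (Sum.⨁-single (allFin⁺ n) (∈-allFin i) (λ {j} _ → single j)) len-self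
      where
      single : ∀ j → j ≡ i ⊎ len Γ j ≡ 0
      single j with j ≟ i
      ... | yes j≡i = inj₁ j≡i
      ... | no j≢i  = inj₂ (cong length (loopConfig-other j≢i))

    private
      loop-arc : ∀ {a} → a ∈ D → proj₁ a ≡ i × proj₂ a ≡ i
      loop-arc a∈ with x , x∈ , t∈ ← arcs-∈⁻ Γ a∈ with refl , refl ← loopConfig-nothing x∈ = refl , ∈-replicate m t∈

      -- All arcs are loops at `i`, so every order of them is a closed walk. Formally this is
      -- `euler` with no vertex besides the root.
      loop-walks : closedWalks (suc N) D ≡ suc N !
      loop-walks = ≡.trans (Sum.⨁-single (allFin⁺ n) (∈-allFin i) (λ {j} _ → single j)) (≡.trans
        (euler (suc N) D [] i i (≡.trans (arcs-length Γ valid) (cong (ℕ._* m) loopConfig-total)) ([] ∷ []) (here refl)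
          (λ a∈ → here (proj₁ (loop-arc a∈)) , here (proj₂ (loop-arc a∈))) (λ ())
          (λ j → cong (ℕ._+ δ j i) (Sum.⨁-cong-∈ D (λ a∈ → cong (δ j) (≡.trans (proj₁ (loop-arc a∈)) (≡.sym (proj₂ (loop-arc a∈))))))))
        (≡.trans (ℕₚ.*-identityʳ _) (≡.trans (ℕₚ.*-identityʳ _) (cong _! (≡.trans (outdegree-arcs Γ valid i) (cong (ℕ._* m) len-self))))))
        where
        single : ∀ j → j ≡ i ⊎ walks (suc N) D j j ≡ 0
        single j with j ≟ i
        ... | yes j≡i = inj₁ j≡i
        ... | no j≢i  = inj₂ (walks-no-start {N} {D} {j} {j} (≡.trans (outdegree-arcs Γ valid j) (cong (λ w → length w ℕ.* m) (loopConfig-other j≢i))))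

    loop-term : term (suc d) Γ ≈ (α * fromℕ (degree i)) ^ suc d
    loop-term = begin
      configWeight Γ * fromℕ (closedWalks (suc N) D)
        ≈⟨ *-cong (ProdF.⨁-single (allFin⁺ n) (∈-allFin i) (λ {j} _ → single j)) (K.reflexive (cong fromℕ loop-walks)) ⟩
      wordWeight i (word Γ i) * fromℕ (suc N !)
        ≈⟨ *-congʳ (K.reflexive (cong (wordWeight i) loopConfig-self)) ⟩
      (1/! (length (replicate (suc d) (nothing {A = Subset n})) ℕ.* m)) * ∏F (replicate (suc d) nothing) (weight i) * fromℕ (suc N !)
        ≈⟨ *-congʳ (*-cong (K.reflexive (cong (λ l → 1/! (l ℕ.* m)) (Listₚ.length-replicate (suc d)))) (∏F-replicate (suc d) nothing (weight i))) ⟩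
      (1/! suc N) * x * fromℕ (suc N !)
        ≈⟨ lem (1/! suc N) x (fromℕ (suc N !)) ⟩
      (1/! suc N) * fromℕ (suc N !) * x
        ≈⟨ *-congʳ (1/!-inverse (suc N)) ⟩
      1# * x
        ≈⟨ *-identityˡ x ⟩
      x ∎
      where
      x : Carrier
      x = (α * fromℕ (degree i)) ^ suc d
      lem : ∀ a b c → a * b * c ≈ a * c * b
      lem = solve 3 (λ a b c → a :* b :* c := a :* c :* b) K.refl
      single : ∀ j → j ≡ i ⊎ wordWeight j (word Γ j) ≈ 1#
      single j with j ≟ i
      ... | yes j≡i = inj₁ j≡i
      ... | no j≢i  = inj₂ (trans (K.reflexive (cong (wordWeight j) (loopConfig-other j≢i))) (wordWeight-[] j))

  module _ (p q : Fin n → ℕ) (e : Subset n) (E : Edge e) where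
    private
      Γ : Configuration
      Γ = edgeConfig p q e
      D : List (Arc n)
      D = arcs Γ

      block : Fin n → List (Choice n)
      block j = replicate (p j) nothing ++ just e ∷ replicate (q j) nothing

      word≡ : ∀ j → word Γ j ≡ (if does (j ∈? e) then block j else [])
      word≡ = Vecₚ.lookup∘tabulate _

      extra : Fin n → ℕ
      extra j = p j ℕ.+ q j

    edgeConfig-∈ : ∀ {j} → j Subset.∈ e → word Γ j ≡ block j
    edgeConfig-∈ {j} j∈ = ≡.trans (word≡ j) (cong (λ b → if b then block j else []) (dec-true (j ∈? e) j∈))

    edgeConfig-∉ : ∀ {j} → j Subset.∉ e → word Γ j ≡ []
    edgeConfig-∉ {j} j∉ = ≡.trans (word≡ j) (cong (λ b → if b then block j else []) (dec-false (j ∈? e) j∉))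

    edgeConfig-inside : ∀ {j x} → x ∈ word Γ j → j Subset.∈ e × x ∈ block j
    edgeConfig-inside {j} x∈ with j ∈? e
    ... | yes j∈ = j∈ , ≡-∈ (edgeConfig-∈ j∈) x∈
    ... | no j∉ with () ← ≡-∈ (edgeConfig-∉ j∉) x∈

    private
      in-block : ∀ {j x} → x ∈ block j → x ≡ nothing ⊎ x ≡ just e
      in-block {j} x∈ with ∈-++⁻ (replicate (p j) nothing) x∈
      ... | inj₁ x∈′         = inj₁ (∈-replicate (p j) x∈′)
      ... | inj₂ (here eq)   = inj₂ eq
      ... | inj₂ (there x∈′) = inj₁ (∈-replicate (q j) x∈′)

      valid : Valid Γ
      valid j e∈ with j∈ , e∈′ ← edgeConfig-inside e∈ with in-block {j} e∈′
      ... | inj₂ refl = E , j∈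

      ∑-replicate-0 : ∀ l (f : Choice n → ℕ) → f nothing ≡ 0 → ∑ℕ (replicate l nothing) f ≡ 0
      ∑-replicate-0 zero    f eq = refl
      ∑-replicate-0 (suc l) f eq = cong₂ ℕ._+_ eq (∑-replicate-0 l f eq)

      ∑-block : ∀ j f → f nothing ≡ 0 → ∑ℕ (block j) f ≡ f (just e)
      ∑-block j f eq = ≡.trans (Sum.⨁-++ (replicate (p j) nothing) _ f) (≡.trans
        (cong₂ ℕ._+_ (∑-replicate-0 (p j) f eq) (cong (f (just e) ℕ.+_) (∑-replicate-0 (q j) f eq))) (ℕₚ.+-identityʳ _))

      length-block : ∀ j → length (block j) ≡ suc (extra j)
      length-block j = ≡.trans (Listₚ.length-++ (replicate (p j) nothing)) (≡.trans
        (cong₂ (λ a b → a ℕ.+ suc b) (Listₚ.length-replicate (p j)) (Listₚ.length-replicate (q j))) (ℕₚ.+-suc (p j) (q j)))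

      len-∈ : ∀ {j} → j Subset.∈ e → len Γ j ≡ suc (extra j)
      len-∈ {j} j∈ = ≡.trans (cong length (edgeConfig-∈ j∈)) (length-block j)

      ∑-word : ∀ j f → f nothing ≡ 0 → ∑ℕ (word Γ j) f ≡ (if does (j ∈? e) then f (just e) else 0)
      ∑-word j f eq = ≡.trans (cong (λ w → ∑ℕ w f) (word≡ j)) (by (does (j ∈? e)))
        where
        by : ∀ b → ∑ℕ (if b then block j else []) f ≡ (if b then f (just e) else 0)
        by true  = ∑-block j f eq
        by false = refl

      others-hits : ∀ {j} → j Subset.∈ e → ∑ℕ (elements e) (λ i → hits j i (just e)) ≡ m
      others-hits {j} j∈ = ≡.trans (Sum.⨁-↭ (elements-↭-others j∈) (λ i → hits j i (just e))) (≡.trans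
        (cong₂ ℕ._+_ (hits-self j (just e)) (≡.trans
          (Sum.⨁-cong-∈ (others e j) (λ i∈ → hits-∈ j∈ (λ j≡i → proj₂ (∈-others⁻ {p = e} i∈) (≡.sym j≡i))))
          (∑-1 (others e j)))) (length-others j∈ (uniform E)))

      incidence≡ : ∀ j → incidence Γ j ≡ ∑ℕ (elements e) (λ i → hits j i (just e))
      incidence≡ j = ≡.trans (Sum.⨁-cong (allFin n) (λ i → ∑-word i (hits j i) refl))
        (≡.sym (Sum.⨁-filter (_∈? e) (allFin n) (λ i → hits j i (just e))))

      balanced : ∀ j → outdegree D j ≡ indegree D j
      balanced j = ≡.trans (outdegree-arcs Γ valid j) (≡.trans by (≡.sym (indegree-arcs Γ valid j)))
        where
        by : len Γ j ℕ.* m ≡ loops Γ j ℕ.* m ℕ.+ incidence Γ j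
        by = ≡.trans (cong (ℕ._* m) (len≡loops+edges Γ j)) (≡.trans (ℕₚ.*-distribʳ-+ m (loops Γ j) (edges Γ j))
          (cong (loops Γ j ℕ.* m ℕ.+_) (≡.trans (cong (ℕ._* m) (∑-word j isEdge refl)) (≡.trans edges≡ (≡.sym (incidence≡ j))))))
          where
          edges≡ : (if does (j ∈? e) then 1 else 0) ℕ.* m ≡ ∑ℕ (elements e) (λ i → hits j i (just e))
          edges≡ with j ∈? e
          ... | yes j∈ = ≡.trans (ℕₚ.*-identityˡ m) (≡.sym (others-hits j∈))
          ... | no j∉  = ≡.sym (Sum.⨁-ε (elements e) (λ {i} _ → hits-∉ {e} {j} {i} j∉))

      -- Only the word at `i` has arcs leaving `i`; its diagonal entries stay at `i`, and its single
      -- `e` reaches `j` once. Apart from loops the arcs thus form the complete digraph on `e`.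
      mult≡1 : ∀ {i j} → i ∈ elements e → j ∈ elements e → i ≢ j → mult D i j ≡ 1
      mult≡1 {i} {j} i∈ j∈ i≢j = ≡.trans (∑-arcs Γ (λ a → δ i (proj₁ a) ℕ.* δ j (proj₂ a))) (≡.trans
        (Sum.⨁-cong (allFin n) (λ i′ → ≡.trans (Sum.⨁-cong (word Γ i′) (λ x → ≡.sym (Trees.∑-*ˡ (δ i i′) (targets i′ x) (δ j))))
          (≡.trans (≡.sym (Trees.∑-*ˡ (δ i i′) (word Γ i′) (λ x → ∑ℕ (targets i′ x) (δ j)))) (cong (ℕ._* T i′) (δ-sym i i′)))))
        (≡.trans (Trees.∑-δ (allFin⁺ n) (∈-allFin i) T) T≡1))
        where
        T : Fin n → ℕ
        T i′ = ∑ℕ (word Γ i′) (λ x → ∑ℕ (targets i′ x) (δ j))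
        T≡1 : T i ≡ 1
        T≡1 = ≡.trans (Sum.⨁-cong (word Γ i) (λ x → ≡.trans (targets-in i j x) (cong (λ d → d ℕ.* (isLoop x ℕ.* m) ℕ.+ hits j i x) (δ-≢ i≢j))))
          (≡.trans (∑-word i (hits j i) refl) (≡.trans (cong (λ b → if b then hits j i (just e) else 0) (dec-true (i ∈? e) (∈-elements⁻ i∈)))
            (hits-∈ (∈-elements⁻ j∈) (λ j≡i → i≢j (≡.sym j≡i)))))

    edgeConfig-total : total Γ ≡ k ℕ.+ ∑ℕ (elements e) extra
    edgeConfig-total = ≡.trans (Sum.⨁-cong (allFin n) by) (≡.trans (≡.sym (Sum.⨁-filter (_∈? e) (allFin n) (λ j → suc (extra j))))
      (≡.trans (Sum.⨁-∙ (elements e) (λ _ → 1) extra) (cong (ℕ._+ ∑ℕ (elements e) extra)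
        (≡.trans (∑-1 (elements e)) (≡.trans (length-elements e) (uniform E))))))
      where
      by : ∀ j → len Γ j ≡ (if does (j ∈? e) then suc (extra j) else 0)
      by j with j ∈? e
      ... | yes j∈ = len-∈ j∈
      ... | no j∉  = cong length (edgeConfig-∉ j∉)

    module _ {d} (total≡ : total Γ ≡ suc d) where
      private
        N : ℕ
        N = r ℕ.+ d ℕ.* suc r

        walks≡ : closedWalks (suc N) D ≡ suc N ℕ.* k ℕ.^ r ℕ.* ∏ (elements e) (λ i → (outdegree D i ℕ.∸ 1) !)
        walks≡ = closedWalks-complete (≡.trans (arcs-length Γ valid) (cong (ℕ._* m) total≡)) (elements-unique e)
          (≡.trans (length-elements e) (uniform E)) inside-e nonzero balanced mult≡1
          where
          inside-e : ∀ {a} → a ∈ D → proj₁ a ∈ elements e × proj₂ a ∈ elements e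
          inside-e {i , t} a∈ with x , x∈ , t∈ ← arcs-∈⁻ Γ a∈ with i∈ , x∈′ ← edgeConfig-inside x∈ with in-block {i} x∈′
          ... | inj₁ refl = ∈-elements⁺ i∈ , subst (_∈ elements e) (≡.sym (∈-replicate m t∈)) (∈-elements⁺ i∈)
          ... | inj₂ refl = ∈-elements⁺ i∈ , ∈-elements⁺ (proj₁ (∈-others⁻ {p = e} t∈))
          nonzero : ∀ {i} → i ∈ elements e → outdegree D i ≢ 0
          nonzero {i} i∈ eq with () ← ≡.trans (≡.sym eq) (≡.trans (outdegree-arcs Γ valid i) (cong (ℕ._* m) (len-∈ (∈-elements⁻ i∈))))

        -- The contribution of a vertex after the reciprocal factorial of its word has met the
        -- factorial from `closedWalks-complete`: the last reciprocal is that of its outdegree.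
        factor : Fin n → Carrier
        factor i = (1# - α) * (α * fromℕ (degree i)) ^ extra i * (1/ (suc (extra i) ℕ.* m))

        local : ∀ {i} → i ∈ elements e → wordWeight i (word Γ i) * fromℕ ((outdegree D i ℕ.∸ 1) !) ≈ factor i
        local {i} i∈ = begin
          wordWeight i (word Γ i) * fromℕ ((outdegree D i ℕ.∸ 1) !)
            ≈⟨ *-cong (K.reflexive (≡.trans (cong (wordWeight i) (edgeConfig-∈ (∈-elements⁻ i∈)))
                 (cong (λ l → (1/! (l ℕ.* m)) * ∏F (block i) (weight i)) (length-block i))))
                 (K.reflexive (cong (λ o → fromℕ ((o ℕ.∸ 1) !)) (≡.trans (outdegree-arcs Γ valid i) (cong (ℕ._* m) (len-∈ (∈-elements⁻ i∈)))))) ⟩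
          (1/! suc L) * ∏F (block i) (weight i) * fromℕ (L !)
            ≈⟨ lem (1/! suc L) (∏F (block i) (weight i)) (fromℕ (L !)) ⟩
          ∏F (block i) (weight i) * ((1/! suc L) * fromℕ (L !))
            ≈⟨ *-cong blocks (1/!-suc L) ⟩
          factor i ∎
          where
          L : ℕ
          L = r ℕ.+ extra i ℕ.* suc r
          lem : ∀ a b c → a * b * c ≈ b * (a * c)
          lem = solve 3 (λ a b c → a :* b :* c := b :* (a :* c)) K.refl
          lem₂ : ∀ a b c → a * (b * c) ≈ b * (a * c)
          lem₂ = solve 3 (λ a b c → a :* (b :* c) := b :* (a :* c)) K.refl
          blocks : ∏F (block i) (weight i) ≈ (1# - α) * (α * fromℕ (degree i)) ^ extra i
          blocks = begin
            ∏F (block i) (weight i)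
              ≈⟨ ProdF.⨁-++ (replicate (p i) nothing) _ (weight i) ⟩
            ∏F (replicate (p i) nothing) (weight i) * (weight i (just e) * ∏F (replicate (q i) nothing) (weight i))
              ≈⟨ *-cong (∏F-replicate (p i) nothing (weight i)) (*-cong
                   (K.reflexive (cong (λ b → if b then 1# - α else 0#) (dec-true (edge? e ×-dec (i ∈? e)) (E , ∈-elements⁻ i∈))))
                   (∏F-replicate (q i) nothing (weight i))) ⟩
            weight i nothing ^ p i * ((1# - α) * weight i nothing ^ q i)
              ≈⟨ lem₂ _ _ _ ⟩
            (1# - α) * (weight i nothing ^ p i * weight i nothing ^ q i)
              ≈⟨ *-congˡ (^-homo-* (weight i nothing) (p i) (q i)) ⟨
            (1# - α) * weight i nothing ^ extra i ∎

      -- The leading factors are the number of arcs, (d+1)(k-1), and Cayley's number k^(k-2).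
      edge-term : term (suc d) Γ ≈ fromℕ (suc d) * fromℕ m * fromℕ k ^ r * ∏F (elements e) factor
      edge-term = begin
        configWeight Γ * fromℕ (closedWalks (suc N) D)
          ≈⟨ *-cong (ProdF.⨁-support (allFin⁺ n) (elements-unique e) (λ {j} _ → ∈-allFin j) (λ {j} _ → support j))
               (K.reflexive (cong fromℕ walks≡)) ⟩
        ∏F (elements e) (λ i → wordWeight i (word Γ i)) * fromℕ (suc N ℕ.* k ℕ.^ r ℕ.* ∏ (elements e) (λ i → (outdegree D i ℕ.∸ 1) !))
          ≈⟨ *-congˡ (trans (fromℕ-* (suc N ℕ.* k ℕ.^ r) _) (*-cong (trans (fromℕ-* (suc N) (k ℕ.^ r)) (*-cong (fromℕ-* (suc d) m) (fromℕ-^ k r)))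
               (fromℕ-∏ (elements e) (λ i → (outdegree D i ℕ.∸ 1) !)))) ⟩
        ∏F (elements e) (λ i → wordWeight i (word Γ i)) *
          (fromℕ (suc d) * fromℕ m * fromℕ k ^ r * ∏F (elements e) (λ i → fromℕ ((outdegree D i ℕ.∸ 1) !)))
          ≈⟨ lem _ _ _ ⟩
        fromℕ (suc d) * fromℕ m * fromℕ k ^ r *
          (∏F (elements e) (λ i → wordWeight i (word Γ i)) * ∏F (elements e) (λ i → fromℕ ((outdegree D i ℕ.∸ 1) !)))
          ≈⟨ *-congˡ (ProdF.⨁-∙ (elements e) (λ i → wordWeight i (word Γ i)) _) ⟨
        fromℕ (suc d) * fromℕ m * fromℕ k ^ r *
          ∏F (elements e) (λ i → wordWeight i (word Γ i) * fromℕ ((outdegree D i ℕ.∸ 1) !))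
          ≈⟨ *-congˡ (ProdF.⨁-cong-∈ (elements e) local) ⟩
        _ ∎
        where
        lem : ∀ a b c → a * (b * c) ≈ b * (a * c)
        lem = solve 3 (λ a b c → a :* (b :* c) := b :* (a :* c)) K.refl
        support : ∀ j → j ∈ elements e ⊎ wordWeight j (word Γ j) ≈ 1#
        support j with j ∈? e
        ... | yes j∈ = inj₁ (∈-elements⁺ j∈)
        ... | no j∉  = inj₂ (trans (K.reflexive (cong (wordWeight j) (edgeConfig-∉ j∉))) (wordWeight-[] j))

-- The model digraphs of the cliques

module CliqueWalks where
  open Walks
  open Lists

  avoiding : ∀ {l} → Vec (Fin l) l → Fin l → List (Fin l)
  avoiding {l} h a = filter (λ b → ¬? (b ≟ a) ×-dec ¬? (b ≟ lookup h a)) (allFin l)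

  -- The arcs of a clique configuration in terms of labels. No hypergraph enters, so its walks are
  -- determined by `h`.
  avoidingArcs : ∀ {l} → Vec (Fin l) l → List (Arc l)
  avoidingArcs {l} h = concatMap (λ a → map (a ,_) (avoiding h a)) (allFin l)

  avoidingArcs-unique : ∀ {l} (h : Vec (Fin l) l) → Unique (avoidingArcs h)
  avoidingArcs-unique {l} h = concatMap-unique proj₁ (allFin⁺ l)
    (λ {a} _ → map⁺ (λ { refl → refl }) (filter⁺ (λ b → ¬? (b ≟ a) ×-dec ¬? (b ≟ lookup h a)) (allFin⁺ l)))
    (λ {_} {a} _ x∈ → key a x∈)
    where
    key : ∀ a {x} → x ∈ map (a ,_) (avoiding h a) → proj₁ x ≡ a
    key a x∈ with _ , _ , refl ← ∈-map⁻ (a ,_) x∈ = refl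

  ∈-avoidingArcs⁺ : ∀ {l} (h : Vec (Fin l) l) {a b} → b ≢ a → b ≢ lookup h a → (a , b) ∈ avoidingArcs h
  ∈-avoidingArcs⁺ h {a} {b} b≢a b≢ha = ∈-concatMap⁺ (λ a → map (a ,_) (avoiding h a)) (lose (∈-allFin a)
    (∈-map⁺ (a ,_) (∈-filter⁺ (λ b → ¬? (b ≟ a) ×-dec ¬? (b ≟ lookup h a)) (∈-allFin b) (b≢a , b≢ha))))

  ∈-avoidingArcs⁻ : ∀ {l} (h : Vec (Fin l) l) {a b} → (a , b) ∈ avoidingArcs h → b ≢ a × b ≢ lookup h a
  ∈-avoidingArcs⁻ {l} h ab∈
    with a , _ , x∈ ← find (∈-concatMap⁻ (λ a → map (a ,_) (avoiding h a)) {xs = allFin l} ab∈)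
    with b , b∈ , refl ← ∈-map⁻ (a ,_) x∈ =
    proj₂ (∈-filter⁻ (λ b → ¬? (b ≟ a) ×-dec ¬? (b ≟ lookup h a)) {xs = allFin l} b∈)

  -- With 3 + r = k + 1, the length is the number of arcs if `h` has no fixed point: each vertex
  -- then sends arcs to all but itself and one more.
  cliqueWalks : ∀ r → Vec (Fin (3 ℕ.+ r)) (3 ℕ.+ r) → ℕ
  cliqueWalks r h = closedWalks ((3 ℕ.+ r) ℕ.* suc r) (avoidingArcs h)

  fixedPointFree : ∀ l → List (Vec (Fin l) l)
  fixedPointFree l = filter (λ h → Finₚ.all? (λ a → ¬? (lookup h a ≟ a))) (tuples (allFin l) l)

  -- Only the permutations h contribute: otherwise the digraph is not balanced.
  totalCliqueWalks : ℕ → ℕ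
  totalCliqueWalks r = Trees.∑ (fixedPointFree (3 ℕ.+ r)) (cliqueWalks r)

-- Terms of the clique configurations

module Cliques {c ℓ₁ ℓ₂ : Level} (F : OrderedField c ℓ₁ ℓ₂) {r n : ℕ} (G : Hypergraph (suc (suc r)) n) (α : OrderedField.Carrier F) where
  open OrderedField F hiding (refl; _<_; _≤_)
  open FieldLemmas F
  open Trees using (δ-≢; module Sum)
  open Walks
  open CliqueWalks
  open Euler
  open Lists
  open Bounds
  open RowOperators F using (module Rows)
  open Rows G α
  open Expansion F
  open Configurations G α
  open Analysis F G α
  open Evaluation F G α
  open Hypergraph G
  open import Relation.Binary.Reasoning.Setoid K.setoid
  open ≡ using (cong; cong₂; subst)

  minus-size : ∀ {S : Subset n} {y l} → y Subset.∈ S → ∣ S ∣ ≡ suc l → ∣ S Subset.- y ∣ ≡ l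
  minus-size {S} {y} y∈ eq = ≡.trans (≡.sym (length-elements (S Subset.- y))) (≡.trans
    (↭-length (unique-↭ (others-unique S y) (elements-unique (S Subset.- y))
      (λ x∈ → let x∈S , x≢y = ∈-others⁻ {p = S} x∈ in ∈-elements⁺ (Subsetₚ.x∈p∧x≢y⇒x∈p-y x∈S x≢y))
      (λ x∈ → let x∈S , x≢y = ∈-minus⁻ {p = S} (∈-elements⁻ x∈) in ∈-others⁺ x∈S x≢y)))
    (length-others y∈ eq))

  minus-injective : ∀ {S : Subset n} {x y} → x Subset.∈ S → y Subset.∈ S → S Subset.- x ≡ S Subset.- y → x ≡ y
  minus-injective {S} {x} {y} x∈ y∈ eq with x ≟ y
  ... | yes x≡y = x≡y
  ... | no x≢y  = contradiction (subst (x Subset.∈_) (≡.sym eq) (Subsetₚ.x∈p∧x≢y⇒x∈p-y x∈ x≢y)) (x∉p-x S x)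

  nonempty : ∀ {a} {A : Set a} → List A → Bool
  nonempty []      = false
  nonempty (_ ∷ _) = true

  -- Gives back `S` from a clique configuration, and so keeps the configurations of different sets
  -- apart.
  support : Configuration → Subset n
  support Γ = Vec.map nonempty Γ

  module _ (S : Subset n) (p : length (elements S) ≡ suc k) (h : Vec (Fin (suc k)) (suc k)) where
    private
      σ : Fin (suc k) → Fin n
      σ = enumerate S p
      σ-injective : ∀ {a b} → σ a ≡ σ b → a ≡ b
      σ-injective = enumerate-injective S p
      Γ : Configuration
      Γ = cliqueConfig S σ h
      D : List (Arc n)
      D = arcs Γ
      ∣S∣ : ∣ S ∣ ≡ suc k
      ∣S∣ = ≡.trans (≡.sym (length-elements S)) p

      word≡ : ∀ j → word Γ j ≡ cliqueWord S σ h (Finₚ.any? (λ a → σ a ≟ j))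
      word≡ = Vecₚ.lookup∘tabulate _

    clique-word : ∀ a → word Γ (σ a) ≡ just (S Subset.- σ (lookup h a)) ∷ []
    clique-word a = ≡.trans (word≡ (σ a)) (by (Finₚ.any? (λ b → σ b ≟ σ a)))
      where
      by : (x : Dec (∃[ b ] σ b ≡ σ a)) → cliqueWord S σ h x ≡ just (S Subset.- σ (lookup h a)) ∷ []
      by (yes (b , eq)) = cong (λ b → just (S Subset.- σ (lookup h b)) ∷ []) (σ-injective eq)
      by (no ∄)         = contradiction (a , refl) ∄

    clique-word-∉ : ∀ {j} → j Subset.∉ S → word Γ j ≡ []
    clique-word-∉ {j} j∉ = ≡.trans (word≡ j) (by (Finₚ.any? (λ b → σ b ≟ j)))
      where
      by : (x : Dec (∃[ b ] σ b ≡ j)) → cliqueWord S σ h x ≡ []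
      by (yes (b , refl)) = contradiction (enumerate-∈ S p b) j∉
      by (no ∄)           = refl

    clique-inside : ∀ {j x} → x ∈ word Γ j → ∃[ a ] σ a ≡ j × x ≡ just (S Subset.- σ (lookup h a))
    clique-inside {j} x∈ with j ∈? S
    ... | no j∉ with () ← ≡-∈ (clique-word-∉ j∉) x∈
    ... | yes j∈ with a , refl ← enumerate-surjective S p j∈ with here eq ← ≡-∈ (clique-word a) x∈ = a , refl , eq

    clique-support : support Γ ≡ S
    clique-support = ≡.trans (≡-tabulate (λ j → ≡.trans (Vecₚ.lookup-map j nonempty Γ) (by j))) (Vecₚ.tabulate∘lookup S)
      where
      by : ∀ j → nonempty (word Γ j) ≡ lookup S j
      by j with j ∈? S
      ... | yes j∈ with a , refl ← enumerate-surjective S p j∈ =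
        ≡.trans (cong nonempty (clique-word a)) (≡.sym (Vecₚ.[]=⇒lookup j∈))
      ... | no j∉ = ≡.trans (cong nonempty (clique-word-∉ j∉)) (≡.sym (∉⇒lookup (lookup S j) refl))
        where
        ∉⇒lookup : ∀ b → lookup S j ≡ b → b ≡ false
        ∉⇒lookup true  eq = contradiction (Vecₚ.lookup⇒[]= j S eq) j∉
        ∉⇒lookup false eq = refl

    clique-total : total Γ ≡ suc k
    clique-total = ≡.trans (Sum.⨁-cong (allFin n) by) (≡.trans (∑-indicator S) ∣S∣)
      where
      by : ∀ j → len Γ j ≡ indicator S j
      by j with j ∈? S
      ... | no j∉  = cong length (clique-word-∉ j∉)
      ... | yes j∈ with a , refl ← enumerate-surjective S p j∈ = cong length (clique-word a)

    module _ (complete : Complete S) (h≢ : ∀ a → lookup h a ≢ a) where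
      private
        weight≈ : ∀ a → wordWeight (σ a) (word Γ (σ a)) ≈ (1/! m) * (1# - α)
        weight≈ a = begin
          wordWeight (σ a) (word Γ (σ a))
            ≈⟨ K.reflexive (cong (wordWeight (σ a)) (clique-word a)) ⟩
          (1/! (1 ℕ.* m)) * (weight (σ a) (just (S Subset.- σ (lookup h a))) * 1#)
            ≈⟨ *-cong (K.reflexive (cong (λ l → 1/! l) (ℕₚ.*-identityˡ m))) (trans (*-identityʳ _) (K.reflexive
                 (cong (λ b → if b then 1# - α else 0#) (dec-true (edge? (S Subset.- σ (lookup h a)) ×-dec (σ a ∈? S Subset.- σ (lookup h a)))
                   ( All.lookup complete (∈-subsets (S Subset.- σ (lookup h a)))
                       (Subsetₚ.p─q⊆p S ⁅ σ (lookup h a) ⁆ , minus-size (enumerate-∈ S p (lookup h a)) ∣S∣)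
                   , Subsetₚ.x∈p∧x≢y⇒x∈p-y (enumerate-∈ S p a) (λ eq → h≢ a (≡.sym (σ-injective eq)))))))) ⟩
          (1/! m) * (1# - α) ∎

        configWeight≈ : configWeight Γ ≈ ((1/! m) * (1# - α)) ^ suc k
        configWeight≈ = begin
          configWeight Γ
            ≈⟨ ProdF.⨁-support (allFin⁺ n) (map⁺ σ-injective (allFin⁺ (suc k))) (λ {j} _ → ∈-allFin j) (λ {j} _ → outer j) ⟩
          ∏F (map σ (allFin (suc k))) (λ j → wordWeight j (word Γ j))
            ≈⟨ ProdF.⨁-map σ (allFin (suc k)) (λ j → wordWeight j (word Γ j)) ⟩
          ∏F (allFin (suc k)) (λ a → wordWeight (σ a) (word Γ (σ a)))
            ≈⟨ ProdF.⨁-cong (allFin (suc k)) weight≈ ⟩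
          ∏F (allFin (suc k)) (λ _ → (1/! m) * (1# - α))
            ≈⟨ ∏F-const (allFin (suc k)) _ ⟩
          ((1/! m) * (1# - α)) ^ length (allFin (suc k))
            ≈⟨ K.reflexive (cong (((1/! m) * (1# - α)) ^_) (Listₚ.length-tabulate {n = suc k} id)) ⟩
          ((1/! m) * (1# - α)) ^ suc k ∎
          where
          outer : ∀ j → j ∈ map σ (allFin (suc k)) ⊎ wordWeight j (word Γ j) ≈ 1#
          outer j with j ∈? S
          ... | yes j∈ with a , refl ← enumerate-surjective S p j∈ = inj₁ (∈-map⁺ σ (∈-allFin a))
          ... | no j∉ = inj₂ (trans (K.reflexive (cong (wordWeight j) (clique-word-∉ j∉))) (wordWeight-[] j))

        σ² : Arc (suc k) → Arc n
        σ² a = σ (proj₁ a) , σ (proj₂ a)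

        arcs-unique : Unique D
        arcs-unique = concatMap-unique proj₁ (allFin⁺ n) (λ {i} _ → u i) (λ {_} {i} _ x∈ → key i (word Γ i) x∈)
          where
          key : ∀ i w {x} → x ∈ wordArcs i w → proj₁ x ≡ i
          key i w x∈ with y , _ , x∈′ ← find (∈-concatMap⁻ (choiceArcs i) {xs = w} x∈) with _ , _ , refl ← ∈-map⁻ (i ,_) x∈′ = refl
          single : ∀ i e → Unique (wordArcs i (just e ∷ []))
          single i e = subst Unique (≡.sym (Listₚ.++-identityʳ (map (i ,_) (others e i)))) (map⁺ (λ { refl → refl }) (others-unique e i))
          u : ∀ i → Unique (wordArcs i (word Γ i))
          u i with i ∈? S
          ... | no i∉ = subst (λ w → Unique (wordArcs i w)) (≡.sym (clique-word-∉ i∉)) []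
          ... | yes i∈ with a , refl ← enumerate-surjective S p i∈ =
            subst (λ w → Unique (wordArcs (σ a) w)) (≡.sym (clique-word a)) (single (σ a) _)

        -- Each word holds at most one edge, so no arc is repeated on either side and it suffices to
        -- compare members.
        arcs-↭ : D ↭ map σ² (avoidingArcs h)
        arcs-↭ = unique-↭ (map⁺ (λ eq → cong₂ _,_ (σ-injective (cong proj₁ eq)) (σ-injective (cong proj₂ eq))) (avoidingArcs-unique h))
          arcs-unique from to
          where
          from : ∀ {x} → x ∈ map σ² (avoidingArcs h) → x ∈ D
          from x∈ with (a , b) , ab∈ , refl ← ∈-map⁻ σ² x∈ with b≢a , b≢ha ← ∈-avoidingArcs⁻ h ab∈ =
            arcs-∈⁺ Γ {x = just (S Subset.- σ (lookup h a))} (≡-∈ (≡.sym (clique-word a)) (here refl))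
              (∈-others⁺ (Subsetₚ.x∈p∧x≢y⇒x∈p-y (enumerate-∈ S p b) (λ eq → b≢ha (σ-injective eq))) (λ eq → b≢a (σ-injective eq)))
          to : ∀ {x} → x ∈ D → x ∈ map σ² (avoidingArcs h)
          to {i , t} x∈ with y , y∈ , t∈ ← arcs-∈⁻ Γ x∈ with a , refl , refl ← clique-inside y∈
            with t∈′ , t≢ ← ∈-others⁻ {p = S Subset.- σ (lookup h a)} t∈
            with t∈S , t≢h ← ∈-minus⁻ {p = S} t∈′ with b , refl ← enumerate-surjective S p t∈S =
            ∈-map⁺ σ² (∈-avoidingArcs⁺ h (λ { refl → t≢ refl }) (λ { refl → t≢h refl }))

        -- A start outside `S` has no arc to leave by; the remaining starts are the labelled ones,
        -- and the labelling is injective.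
        walks≡ : closedWalks (suc k ℕ.* m) D ≡ cliqueWalks r h
        walks≡ = ≡.trans (Sum.⨁-cong (allFin n) (λ u → walks-↭ (suc k ℕ.* m) arcs-↭ u u)) (≡.trans
          (Sum.⨁-support (allFin⁺ n) (map⁺ σ-injective (allFin⁺ (suc k))) (λ {j} _ → ∈-allFin j) (λ {j} _ → outer j))
          (≡.trans (Sum.⨁-map σ (allFin (suc k)) (λ u → walks (suc k ℕ.* m) (map σ² (avoidingArcs h)) u u))
            (Sum.⨁-cong (allFin (suc k)) (λ a → walks-relabel σ σ-injective (suc k ℕ.* m) (avoidingArcs h) a a))))
          where
          outer : ∀ j → j ∈ map σ (allFin (suc k)) ⊎ walks (suc k ℕ.* m) (map σ² (avoidingArcs h)) j j ≡ 0
          outer j with j ∈? S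
          ... | yes j∈ with a , refl ← enumerate-surjective S p j∈ = inj₁ (∈-map⁺ σ (∈-allFin a))
          ... | no j∉ = inj₂ (walks-no-start {r ℕ.+ k ℕ.* suc r} {map σ² (avoidingArcs h)} {j} {j} (Sum.⨁-ε (map σ² (avoidingArcs h)) λ {x} x∈ → δ-≢ {i = j} {proj₁ x} λ { refl →
              let (a , b) , _ , eq = ∈-map⁻ σ² x∈ in j∉ (subst (Subset._∈ S) (≡.sym (cong proj₁ eq)) (enumerate-∈ S p a)) }))

      clique-term : term (suc k) Γ ≈ ((1/! m) * (1# - α)) ^ suc k * fromℕ (cliqueWalks r h)
      clique-term = *-cong configWeight≈ (K.reflexive (cong fromℕ walks≡))

    -- The word at `σ a` names the set `S` without `σ (lookup h a)`, and the omitted vertex can be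
    -- read back from this set.
    clique-injective : ∀ {h′} → Γ ≡ cliqueConfig S σ h′ → h ≡ h′
    clique-injective {h′} eq = ≡.trans (≡-tabulate {v = h} by) (Vecₚ.tabulate∘lookup h′)
      where
      word′ : ∀ a → lookup (cliqueConfig S σ h′) (σ a) ≡ just (S Subset.- σ (lookup h′ a)) ∷ []
      word′ a = ≡.trans (Vecₚ.lookup∘tabulate _ (σ a)) (go (Finₚ.any? (λ b → σ b ≟ σ a)))
        where
        go : (x : Dec (∃[ b ] σ b ≡ σ a)) → cliqueWord S σ h′ x ≡ just (S Subset.- σ (lookup h′ a)) ∷ []
        go (yes (b , eq)) = cong (λ b → just (S Subset.- σ (lookup h′ b)) ∷ []) (σ-injective eq)
        go (no ∄)         = contradiction (a , refl) ∄
      by : ∀ a → lookup h a ≡ lookup h′ a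
      by a = σ-injective (minus-injective (enumerate-∈ S p _) (enumerate-∈ S p _) (just-injective (Listₚ.∷-injectiveˡ
        (≡.trans (≡.sym (clique-word a)) (≡.trans (cong (λ Γ → lookup Γ (σ a)) eq) (word′ a))))))
        where
        just-injective : ∀ {x y : Subset n} → just x ≡ just y → x ≡ y
        just-injective refl = refl

-- Summing the terms over all shapes

module Summation {c ℓ₁ ℓ₂ : Level} (F : OrderedField c ℓ₁ ℓ₂) {r n : ℕ} (G : Hypergraph (suc (suc r)) n) (α : OrderedField.Carrier F) where
  open OrderedField F hiding (refl; _<_; _≤_)
  open FieldLemmas F
  open Trees using (δ; δ-refl; δ-sym; module Sum)
  open Walks
  open CliqueWalks
  open Euler
  open Lists
  open Bounds
  open RowOperators F using (Choice; module Rows)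
  open Rows G α
  open Expansion F
  open Configurations G α
  open Analysis F G α
  open Evaluation F G α
  open Cliques F G α
  open Hypergraph G
  open import Data.Nat.Base using (zero; _≤_; z≤n; s≤s)
  open import Relation.Binary.Reasoning.Setoid K.setoid
  open ≡ using (cong; cong₂; subst)

  ∏F-zero : ∀ {a} {A : Set a} {xs : List A} {f : A → Carrier} {x} → x ∈ xs → f x ≈ 0# → ∏F xs f ≈ 0#
  ∏F-zero (here refl) eq = trans (*-congʳ eq) (zeroˡ _)
  ∏F-zero (there x∈)  eq = trans (*-congˡ (∏F-zero x∈ eq)) (zeroʳ _)

  valid⊎weight≈0 : ∀ Γ → Valid Γ ⊎ configWeight Γ ≈ 0#
  valid⊎weight≈0 Γ with Finₚ.any? (λ i → Any.any? (bad? i) (word Γ i))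
    where
    Bad : Fin n → Choice n → Set
    Bad i x = ∃[ e ] x ≡ just e × ¬ (Edge e × i Subset.∈ e)
    bad? : ∀ i x → Dec (Bad i x)
    bad? i nothing = no λ ()
    bad? i (just e) with edge? e ×-dec (i ∈? e)
    ... | yes ok = no λ { (_ , refl , ¬ok) → ¬ok ok }
    ... | no ¬ok = yes (e , refl , ¬ok)
  ... | yes (i , any) with _ , e∈ , e , refl , ¬ok ← find any = inj₂ (∏F-zero (∈-allFin i)
          (trans (*-congˡ (∏F-zero e∈ (K.reflexive (cong (λ b → if b then 1# - α else 0#) (dec-false (edge? e ×-dec (i ∈? e)) ¬ok))))) (zeroʳ _)))
  ... | no ∄ = inj₁ λ i {e} e∈ → ok i e e∈ (edge? e ×-dec (i ∈? e))
    where
    ok : ∀ i e → just e ∈ word Γ i → Dec (Edge e × i Subset.∈ e) → Edge e × i Subset.∈ e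
    ok i e e∈ (yes p) = p
    ok i e e∈ (no ¬p) = contradiction (i , lose e∈ (e , refl , ¬p)) ∄

  module _ {d : ℕ} (1≤d : 1 ≤ d) (d≤1+k : d ≤ suc k) where
    shape⊎term≈0 : ∀ {Γ} → total Γ ≡ d → Shape d Γ ⊎ term d Γ ≈ 0#
    shape⊎term≈0 {Γ} total≡d with closedWalks (d ℕ.* m) (arcs Γ) ℕₚ.≟ 0
    ... | yes eq = inj₂ (trans (*-congˡ (K.reflexive (cong fromℕ eq))) (zeroʳ _))
    ... | no ≢0 with valid⊎weight≈0 Γ
    ...   | inj₁ valid = inj₁ (classify Γ valid total≡d 1≤d d≤1+k ≢0)
    ...   | inj₂ eq    = inj₂ (trans (*-congʳ eq) (zeroˡ _))

    -- The list has to contain every shape, but may contain configurations whose term vanishes. This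
    -- permits all `h` without fixed points to be listed for a clique.
    sum-shapes : ∀ {Γs} → Unique Γs → (∀ {Γ} → Γ ∈ Γs → total Γ ≡ d) → (∀ {Γ} → Shape d Γ → Γ ∈ Γs) →
                 ∑ (configurations d) (term d) ≈ ∑ Γs (term d)
    sum-shapes u tot sh = SumF.⨁-support (configurations-unique d) u (λ Γ∈ → ∈-configurations⁺ (tot Γ∈))
      (λ {Γ} Γ∈ → [ (λ s → inj₁ (sh s)) , inj₂ ]′ (shape⊎term≈0 (∈-configurations⁻ {d} {Γ} Γ∈)))

  loopConfigs : ℕ → List Configuration
  loopConfigs d = map (loopConfig d) (allFin n)

  loopConfigs-unique : ∀ d → Unique (loopConfigs (suc d))
  loopConfigs-unique d = map-unique (allFin⁺ n) λ {i} {j} _ _ eq →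
    proj₁ (loopConfig-nothing d j (≡-∈ (≡.trans (≡.sym (loopConfig-self d i)) (cong (λ Γ → word Γ i) eq)) (here refl)))

  loopConfigs-total : ∀ d {Γ} → Γ ∈ loopConfigs (suc d) → total Γ ≡ suc d
  loopConfigs-total d Γ∈ with i , _ , refl ← ∈-map⁻ (loopConfig (suc d)) Γ∈ = loopConfig-total d i

  loop-edge-disjoint : ∀ d {Γ j e} → Γ ∈ loopConfigs (suc d) → just e ∉ word Γ j
  loop-edge-disjoint d {j = j} Γ∈ e∈ with i , _ , refl ← ∈-map⁻ (loopConfig (suc d)) Γ∈
    with () ← proj₂ (loopConfig-nothing d i {j} e∈)

  ∑-loopConfigs : ∀ d → ∑ (loopConfigs (suc d)) (term (suc d)) ≈ ∑ (allFin n) (λ i → (α * fromℕ (degree i)) ^ suc d)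
  ∑-loopConfigs d = trans (SumF.⨁-map (loopConfig (suc d)) (allFin n) (term (suc d))) (SumF.⨁-cong (allFin n) (loop-term d))

  sum-below : ∀ d → suc d ≤ suc r → ∑ (configurations (suc d)) (term (suc d)) ≈ ∑ (allFin n) (λ i → (α * fromℕ (degree i)) ^ suc d)
  sum-below d d<k = trans (sum-shapes (s≤s z≤n) (ℕₚ.≤-trans d<k (ℕₚ.≤-trans (ℕₚ.n≤1+n m) (ℕₚ.n≤1+n k))) (loopConfigs-unique d) (loopConfigs-total d) shapes)
    (∑-loopConfigs d)
    where
    shapes : ∀ {Γ} → Shape (suc d) Γ → Γ ∈ loopConfigs (suc d)
    shapes (loop i refl)       = ∈-map⁺ (loopConfig (suc d)) (∈-allFin i)
    shapes (edge _ _ eq _)     = contradiction (subst (_≤ m) eq d<k) (ℕₚ.<⇒≱ ℕₚ.≤-refl)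
    shapes (first _ _ _ _ eq _) = contradiction (subst (_≤ m) eq d<k) (ℕₚ.<⇒≱ (ℕₚ.n≤1+n k))
    shapes (last _ _ _ _ eq _) = contradiction (subst (_≤ m) eq d<k) (ℕₚ.<⇒≱ (ℕₚ.n≤1+n k))
    shapes (clique _ _ _ _ _ eq _) = contradiction (subst (_≤ m) eq d<k) (ℕₚ.<⇒≱ (ℕₚ.n≤1+n k))

  Edges : List (Subset n)
  Edges = filter edge? (subsets n)

  Edges-unique : Unique Edges
  Edges-unique = filter⁺ edge? (subsets-unique n)

  ∈-Edges⁻ : ∀ {e} → e ∈ Edges → Edge e
  ∈-Edges⁻ e∈ = proj₂ (∈-filter⁻ edge? {xs = subsets n} e∈)

  vertex : ∀ {e} → Edge e → ∃[ v ] v Subset.∈ e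
  vertex {e} E = go (elements e) ∈-elements⁻ (≡.trans (length-elements e) (uniform E))
    where
    go : ∀ xs → (∀ {v} → v ∈ xs → v Subset.∈ e) → length xs ≡ k → ∃[ v ] v Subset.∈ e
    go (v ∷ _) ∈e _ = v , ∈e (here refl)

  plain : Subset n → Configuration
  plain = edgeConfig (λ _ → 0) (λ _ → 0)

  firstAt lastAt : Subset n × Fin n → Configuration
  firstAt (e , v) = edgeConfig (λ j → δ j v) (λ _ → 0) e
  lastAt  (e , v) = edgeConfig (λ _ → 0) (λ j → δ j v) e

  β ι : Carrier
  β = 1# - α
  ι = 1/ m

  inverse-unique : ∀ {x y z} → x * y ≈ 1# → z * y ≈ 1# → x ≈ z
  inverse-unique {x} {y} {z} xy zy = begin
    x              ≈⟨ *-identityʳ x ⟨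
    x * 1#         ≈⟨ *-congˡ zy ⟨
    x * (z * y)    ≈⟨ solve 3 (λ x y z → x :* (z :* y) := z :* (x :* y)) K.refl x y z ⟩
    z * (x * y)    ≈⟨ *-congˡ xy ⟩
    z * 1#         ≈⟨ *-identityʳ z ⟩
    z              ∎

  1/-* : ∀ a b → 1/ (suc a ℕ.* suc b) ≈ (1/ suc a) * (1/ suc b)
  1/-* a b = inverse-unique (1/-inverse (suc a ℕ.* suc b)) (begin
    (1/ suc a) * (1/ suc b) * fromℕ (suc a ℕ.* suc b)             ≈⟨ *-congˡ (fromℕ-* (suc a) (suc b)) ⟩
    (1/ suc a) * (1/ suc b) * (fromℕ (suc a) * fromℕ (suc b))     ≈⟨ solve 4 (λ x y z w → x :* y :* (z :* w) := x :* z :* (y :* w)) K.refl _ _ _ _ ⟩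
    (1/ suc a) * fromℕ (suc a) * ((1/ suc b) * fromℕ (suc b))     ≈⟨ *-cong (1/-inverse (suc a)) (1/-inverse (suc b)) ⟩
    1# * 1#                                                       ≈⟨ *-identityˡ 1# ⟩
    1#                                                            ∎)

  1/1 : 1/ 1 ≈ 1#
  1/1 = inverse-unique (1/-inverse 1) (trans (*-identityˡ _) fromℕ-1)

  edge-size : ∀ {e} → Edge e → length (elements e) ≡ k
  edge-size {e} E = ≡.trans (length-elements e) (uniform E)

  plain-total : ∀ {e} → Edge e → total (plain e) ≡ k
  plain-total {e} E = ≡.trans (edgeConfig-total (λ _ → 0) (λ _ → 0) e E)
    (≡.trans (cong (k ℕ.+_) (Sum.⨁-ε (elements e) (λ _ → refl))) (ℕₚ.+-identityʳ k))

  plain-term : ∀ {e} → Edge e → term k (plain e) ≈ fromℕ k * fromℕ m * fromℕ k ^ r * (β * ι) ^ k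
  plain-term {e} E = trans (edge-term (λ _ → 0) (λ _ → 0) e E (plain-total E)) (*-congˡ (begin
    ∏F (elements e) (λ i → β * 1# * (1/ (1 ℕ.* m)))
      ≈⟨ ProdF.⨁-cong (elements e) (λ _ → *-cong (*-identityʳ β) (trans (1/-* 0 r) (trans (*-congʳ 1/1) (*-identityˡ ι)))) ⟩
    ∏F (elements e) (λ i → β * ι)
      ≈⟨ ∏F-const (elements e) (β * ι) ⟩
    (β * ι) ^ length (elements e)
      ≈⟨ K.reflexive (cong ((β * ι) ^_) (edge-size E)) ⟩
    (β * ι) ^ k ∎))

  module _ (p q : Fin n → ℕ) {e v} (E : Edge e) (v∈ : v Subset.∈ e) (p+q≡δ : ∀ j → p j ℕ.+ q j ≡ δ j v) where
    marked-total : total (edgeConfig p q e) ≡ suc k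
    marked-total = ≡.trans (edgeConfig-total p q e E) (≡.trans
      (cong (k ℕ.+_) (≡.trans (Sum.⨁-cong (elements e) (λ j → ≡.trans (p+q≡δ j) (δ-sym j v))) (∑-δ-∈ (elements-unique e) (∈-elements⁺ v∈))))
      (ℕₚ.+-comm k 1))

    -- The diagonal entry at `v` brings α times the degree of `v`. It doubles the outdegree there,
    -- whence the 1/2.
    marked-term : term (suc k) (edgeConfig p q e) ≈
                  fromℕ (suc k) * fromℕ m * fromℕ k ^ r * ((β * ι) ^ k * (α * fromℕ (degree v) * (1/ 2)))
    marked-term = trans (edge-term p q e E marked-total) (*-congˡ (begin
      ∏F (elements e) (λ i → β * (α * fromℕ (degree i)) ^ (p i ℕ.+ q i) * (1/ (suc (p i ℕ.+ q i) ℕ.* m)))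
        ≈⟨ ProdF.⨁-cong (elements e) split ⟩
      ∏F (elements e) (λ i → β * ι * g i)
        ≈⟨ ProdF.⨁-∙ (elements e) (λ _ → β * ι) g ⟩
      ∏F (elements e) (λ _ → β * ι) * ∏F (elements e) g
        ≈⟨ *-cong (trans (∏F-const (elements e) (β * ι)) (K.reflexive (cong ((β * ι) ^_) (edge-size E))))
             (trans (ProdF.⨁-single (elements-unique e) (∈-elements⁺ v∈) (λ {j} _ → other j)) self) ⟩
      (β * ι) ^ k * (α * fromℕ (degree v) * (1/ 2)) ∎))
      where
      g : Fin n → Carrier
      g i = if does (i ≟ v) then α * fromℕ (degree i) * (1/ 2) else 1#
      self : g v ≈ α * fromℕ (degree v) * (1/ 2)
      self = K.reflexive (cong (λ b → if b then α * fromℕ (degree v) * (1/ 2) else 1#) (dec-true (v ≟ v) refl))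
      other : ∀ j → j ≡ v ⊎ g j ≈ 1#
      other j with j ≟ v
      ... | yes j≡v = inj₁ j≡v
      ... | no _    = inj₂ K.refl
      split : ∀ i → β * (α * fromℕ (degree i)) ^ (p i ℕ.+ q i) * (1/ (suc (p i ℕ.+ q i) ℕ.* m)) ≈ β * ι * g i
      split i = trans (K.reflexive (cong (λ l → β * (α * fromℕ (degree i)) ^ l * (1/ (suc l ℕ.* m))) (p+q≡δ i))) (by i)
        where
        by : ∀ i → β * (α * fromℕ (degree i)) ^ δ i v * (1/ (suc (δ i v) ℕ.* m)) ≈ β * ι * g i
        by i with i ≟ v
        ... | yes _ = trans (*-cong (*-congˡ (*-identityʳ _)) (1/-* 1 r))
          (solve 4 (λ b a t i → b :* a :* (t :* i) := b :* i :* (a :* t)) K.refl β (α * fromℕ (degree i)) (1/ 2) ι)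
        ... | no _  = trans (*-cong (*-identityʳ β) (trans (1/-* 0 r) (trans (*-congʳ 1/1) (*-identityˡ ι)))) (sym (*-identityʳ _))

  edgeConfig-edge : ∀ p q {e v} → Edge e → v Subset.∈ e → just e ∈ word (edgeConfig p q e) v
  edgeConfig-edge p q {e} {v} E v∈ = ≡-∈ (≡.sym (edgeConfig-∈ p q e E v∈)) (∈-++⁺ʳ (replicate (p v) nothing) (here refl))

  plains : List Configuration
  plains = map plain Edges

  plains-unique : Unique plains
  plains-unique = map-unique Edges-unique λ {e} {e′} e∈ e′∈ eq →
    let v , v∈ = vertex (∈-Edges⁻ e∈) in
    same (proj₂ (edgeConfig-inside (λ _ → 0) (λ _ → 0) e′ (∈-Edges⁻ e′∈)
      (≡-∈ (cong (λ Γ → word Γ v) eq) (edgeConfig-edge (λ _ → 0) (λ _ → 0) (∈-Edges⁻ e∈) v∈))))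
    where
    same : ∀ {e e′ : Subset n} → just e ∈ just e′ ∷ [] → e ≡ e′
    same (here refl) = refl

  sum-at : ∑ (configurations k) (term k) ≈
           ∑ (allFin n) (λ i → (α * fromℕ (degree i)) ^ k) +
           fromℕ numEdges * (fromℕ k * fromℕ m * fromℕ k ^ r * (β * ι) ^ k)
  sum-at = begin
    ∑ (configurations k) (term k)
      ≈⟨ sum-shapes (s≤s z≤n) (ℕₚ.n≤1+n k) unique totals shapes ⟩
    ∑ (loopConfigs k ++ plains) (term k)
      ≈⟨ SumF.⨁-++ (loopConfigs k) plains (term k) ⟩
    ∑ (loopConfigs k) (term k) + ∑ plains (term k)
      ≈⟨ +-cong (∑-loopConfigs m) (trans (SumF.⨁-map plain Edges (term k))
           (trans (SumF.⨁-cong-∈ Edges (λ e∈ → plain-term (∈-Edges⁻ e∈))) (∑F-const Edges _))) ⟩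
    _ ∎
    where
    unique : Unique (loopConfigs k ++ plains)
    unique = Uniqueₚ.++⁺ (loopConfigs-unique m) plains-unique λ { (Γ∈ , Γ∈′) → disjoint Γ∈ Γ∈′ }
      where
      disjoint : ∀ {Γ} → Γ ∈ loopConfigs k → Γ ∉ plains
      disjoint Γ∈ Γ∈′ with e , e∈ , refl ← ∈-map⁻ plain Γ∈′ =
        let v , v∈ = vertex (∈-Edges⁻ e∈) in
        loop-edge-disjoint m {j = v} Γ∈ (edgeConfig-edge (λ _ → 0) (λ _ → 0) (∈-Edges⁻ e∈) v∈)
    totals : ∀ {Γ} → Γ ∈ loopConfigs k ++ plains → total Γ ≡ k
    totals Γ∈ with ∈-++⁻ (loopConfigs k) Γ∈
    ... | inj₁ l = loopConfigs-total m l
    ... | inj₂ l with e , e∈ , refl ← ∈-map⁻ plain l = plain-total (∈-Edges⁻ e∈)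
    shapes : ∀ {Γ} → Shape k Γ → Γ ∈ loopConfigs k ++ plains
    shapes (loop i refl)           = ∈-++⁺ˡ (∈-map⁺ (loopConfig k) (∈-allFin i))
    shapes (edge e E _ refl)       = ∈-++⁺ʳ (loopConfigs k) (∈-map⁺ plain (∈-filter⁺ edge? (∈-subsets e) E))
    shapes (first _ _ _ _ eq _)    = contradiction eq (ℕₚ.<⇒≢ ℕₚ.≤-refl)
    shapes (last _ _ _ _ eq _)     = contradiction eq (ℕₚ.<⇒≢ ℕₚ.≤-refl)
    shapes (clique _ _ _ _ _ eq _) = contradiction eq (ℕₚ.<⇒≢ ℕₚ.≤-refl)

  pairs : List (Subset n × Fin n)
  pairs = concatMap (λ e → map (e ,_) (elements e)) Edges

  pairs-unique : Unique pairs
  pairs-unique = concatMap-unique proj₁ Edges-unique (λ {e} _ → map⁺ (λ { refl → refl }) (elements-unique e))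
    (λ {_} {e} _ x∈ → key e x∈)
    where
    key : ∀ e {x} → x ∈ map (e ,_) (elements e) → proj₁ x ≡ e
    key e x∈ with _ , _ , refl ← ∈-map⁻ (e ,_) x∈ = refl

  ∈-pairs⁻ : ∀ {e v} → (e , v) ∈ pairs → Edge e × v Subset.∈ e
  ∈-pairs⁻ ev∈ with e , e∈ , x∈ ← find (∈-concatMap⁻ (λ e → map (e ,_) (elements e)) {xs = Edges} ev∈)
    with v , v∈ , refl ← ∈-map⁻ (e ,_) x∈ = ∈-Edges⁻ e∈ , ∈-elements⁻ v∈

  ∈-pairs⁺ : ∀ {e v} → Edge e → v Subset.∈ e → (e , v) ∈ pairs
  ∈-pairs⁺ {e} {v} E v∈ = ∈-concatMap⁺ (λ e → map (e ,_) (elements e))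
    (lose (∈-filter⁺ edge? (∈-subsets e) E) (∈-map⁺ (e ,_) (∈-elements⁺ v∈)))

  first-word : ∀ {e v} → Edge e → v Subset.∈ e → word (firstAt (e , v)) v ≡ nothing ∷ just e ∷ []
  first-word {e} {v} E v∈ = ≡.trans (edgeConfig-∈ (λ j → δ j v) (λ _ → 0) e E v∈)
    (cong (λ l → replicate l nothing ++ just e ∷ []) (δ-refl v))

  last-word : ∀ {e v} → Edge e → v Subset.∈ e → word (lastAt (e , v)) v ≡ just e ∷ nothing ∷ []
  last-word {e} {v} E v∈ = ≡.trans (edgeConfig-∈ (λ _ → 0) (λ j → δ j v) e E v∈)
    (cong (λ l → just e ∷ replicate l nothing) (δ-refl v))

  -- Only the word at `v` begins with a diagonal entry, and the edge follows it; both parts of the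
  -- pair can thus be recovered.
  first-head : ∀ {e v j w} → Edge e → word (firstAt (e , v)) j ≡ nothing ∷ w → j ≡ v × w ≡ just e ∷ []
  first-head {e} {v} {j} {w} E eq with edgeConfig-inside (λ j → δ j v) (λ _ → 0) e E (≡-∈ (≡.sym eq) (here refl))
  ... | j∈ , _ = by (j ≟ v) (≡.trans (≡.sym (edgeConfig-∈ (λ j → δ j v) (λ _ → 0) e E j∈)) eq)
    where
    by : (x : Dec (j ≡ v)) → replicate (if does x then 1 else 0) nothing ++ just e ∷ [] ≡ nothing ∷ w → j ≡ v × w ≡ just e ∷ []
    by (yes j≡v) refl = j≡v , refl

  -- Every nonempty word begins with the edge, and only the word at `v` has a second entry.
  last-head : ∀ {e v j x w} → Edge e → word (lastAt (e , v)) j ≡ x ∷ w → x ≡ just e × (∀ {y w′} → w ≡ y ∷ w′ → j ≡ v)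
  last-head {e} {v} {j} {x} {w} E eq with edgeConfig-inside (λ _ → 0) (λ j → δ j v) e E (≡-∈ (≡.sym eq) (here refl))
  ... | j∈ , _ = by (j ≟ v) (≡.trans (≡.sym (edgeConfig-∈ (λ _ → 0) (λ j → δ j v) e E j∈)) eq)
    where
    by : (d : Dec (j ≡ v)) → just e ∷ replicate (if does d then 1 else 0) nothing ≡ x ∷ w →
         x ≡ just e × (∀ {y w′} → w ≡ y ∷ w′ → j ≡ v)
    by (yes j≡v) refl = refl , λ _ → j≡v
    by (no _)    refl = refl , λ ()

  firsts lasts : List Configuration
  firsts = map firstAt pairs
  lasts  = map lastAt pairs

  firsts-unique : Unique firsts
  firsts-unique = map-unique pairs-unique λ {x} {y} x∈ y∈ eq →
    let E , v∈ = ∈-pairs⁻ x∈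
        v≡ , w≡ = first-head (proj₁ (∈-pairs⁻ y∈)) (≡.trans (cong (λ Γ → word Γ (proj₂ x)) (≡.sym eq)) (first-word E v∈))
    in cong₂ _,_ (same w≡) v≡
    where
    same : ∀ {e e′ : Subset n} → just e ∷ [] ≡ just e′ ∷ [] → e ≡ e′
    same refl = refl

  lasts-unique : Unique lasts
  lasts-unique = map-unique pairs-unique λ {x} {y} x∈ y∈ eq →
    let E , v∈ = ∈-pairs⁻ x∈
        e≡ , v≡ = last-head (proj₁ (∈-pairs⁻ y∈)) (≡.trans (cong (λ Γ → word Γ (proj₂ x)) (≡.sym eq)) (last-word E v∈))
    in cong₂ _,_ (same e≡) (v≡ refl)
    where
    same : ∀ {e e′ : Subset n} → just e ≡ just e′ → e ≡ e′
    same refl = refl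

  CompleteSets : List (Subset n)
  CompleteSets = filter (λ S → (∣ S ∣ ℕₚ.≟ suc k) ×-dec complete? S) (subsets n)

  ∈-CompleteSets⁻ : ∀ {S} → S ∈ CompleteSets → ∣ S ∣ ≡ suc k × Complete S
  ∈-CompleteSets⁻ S∈ = proj₂ (∈-filter⁻ (λ S → (∣ S ∣ ℕₚ.≟ suc k) ×-dec complete? S) {xs = subsets n} S∈)

  -- `enumerate` needs a proof of the size of `S`, so the size is decided here; the empty branch
  -- does not occur for members of `CompleteSets`.
  cliquesOf : Subset n → List Configuration
  cliquesOf S with length (elements S) ℕₚ.≟ suc k
  ... | yes p = map (cliqueConfig S (enumerate S p)) (fixedPointFree (suc k))
  ... | no _  = []

  cliques : List Configuration
  cliques = concatMap cliquesOf CompleteSets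

  ∈-cliquesOf⁻ : ∀ S {Γ} → Γ ∈ cliquesOf S → ∃[ p ] ∃[ h ] h ∈ fixedPointFree (suc k) × Γ ≡ cliqueConfig S (enumerate S p) h
  ∈-cliquesOf⁻ S Γ∈ with length (elements S) ℕₚ.≟ suc k
  ... | yes p with h , h∈ , eq ← ∈-map⁻ (cliqueConfig S (enumerate S p)) Γ∈ = p , h , h∈ , eq

  ∈-cliquesOf⁺ : ∀ S p h → (∀ a → lookup h a ≢ a) → cliqueConfig S (enumerate S p) h ∈ cliquesOf S
  ∈-cliquesOf⁺ S p h h≢ with length (elements S) ℕₚ.≟ suc k
  ... | no ¬p  = contradiction p ¬p
  -- The decision may return a proof other than `p`, on which `enumerate` depends; proofs of an
  -- equation in ℕ are all equal.
  ... | yes p′ rewrite ℕₚ.≡-irrelevant p p′ = ∈-map⁺ (cliqueConfig S (enumerate S p′))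
    (∈-filter⁺ (λ h → Finₚ.all? (λ a → ¬? (lookup h a ≟ a))) (∈-tuples h (λ a → ∈-allFin (lookup h a))) h≢)

  fixedPointFree-unique : ∀ l → Unique (fixedPointFree l)
  fixedPointFree-unique l = filter⁺ (λ h → Finₚ.all? (λ a → ¬? (lookup h a ≟ a))) (tuples-unique l (allFin⁺ l))

  cliquesOf-unique : ∀ S → Unique (cliquesOf S)
  cliquesOf-unique S with length (elements S) ℕₚ.≟ suc k
  ... | yes p = map⁺ (λ {h} {h′} eq → clique-injective S p h {h′} eq) (fixedPointFree-unique (suc k))
  ... | no _  = []

  cliques-unique : Unique cliques
  cliques-unique = concatMap-unique support (filter⁺ (λ S → (∣ S ∣ ℕₚ.≟ suc k) ×-dec complete? S) (subsets-unique n))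
    (λ {S} _ → cliquesOf-unique S) (λ {Γ} {S} _ Γ∈ → key S Γ∈)
    where
    key : ∀ S {Γ} → Γ ∈ cliquesOf S → support Γ ≡ S
    key S Γ∈ with p , h , _ , refl ← ∈-cliquesOf⁻ S Γ∈ = clique-support S p h

  ∈-cliques⁻ : ∀ {Γ} → Γ ∈ cliques → ∃[ S ] ∃[ p ] ∃[ h ] Γ ≡ cliqueConfig S (enumerate S p) h
  ∈-cliques⁻ Γ∈ with S , _ , Γ∈′ ← find (∈-concatMap⁻ cliquesOf {xs = CompleteSets} Γ∈)
    with p , h , _ , eq ← ∈-cliquesOf⁻ S Γ∈′ = S , p , h , eq

  clique-no-loop : ∀ {Γ j} → Γ ∈ cliques → nothing ∉ word Γ j
  clique-no-loop {j = j} Γ∈ x∈ with S , p , h , refl ← ∈-cliques⁻ Γ∈ with _ , _ , () ← clique-inside S p h {j} x∈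

  ∑-cliques : ∑ cliques (term (suc k)) ≈ fromℕ numComplete * (((1/! m) * β) ^ suc k * fromℕ (totalCliqueWalks r))
  ∑-cliques = trans (SumF.⨁-concatMap cliquesOf CompleteSets (term (suc k)))
    (trans (SumF.⨁-cong-∈ CompleteSets (λ S∈ → let size , complete = ∈-CompleteSets⁻ S∈ in each _ size complete)) (∑F-const CompleteSets _))
    where
    each : ∀ S → ∣ S ∣ ≡ suc k → Complete S → ∑ (cliquesOf S) (term (suc k)) ≈ ((1/! m) * β) ^ suc k * fromℕ (totalCliqueWalks r)
    each S size complete with length (elements S) ℕₚ.≟ suc k
    ... | no ¬p = contradiction (≡.trans (length-elements S) size) ¬p
    ... | yes p = begin
      ∑ (map (cliqueConfig S (enumerate S p)) (fixedPointFree (suc k))) (term (suc k))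
        ≈⟨ SumF.⨁-map (cliqueConfig S (enumerate S p)) (fixedPointFree (suc k)) (term (suc k)) ⟩
      ∑ (fixedPointFree (suc k)) (λ h → term (suc k) (cliqueConfig S (enumerate S p) h))
        ≈⟨ SumF.⨁-cong-∈ (fixedPointFree (suc k)) (λ {h} h∈ → clique-term S p h complete
             (proj₂ (∈-filter⁻ (λ h → Finₚ.all? (λ a → ¬? (lookup h a ≟ a))) {xs = tuples (allFin (suc k)) (suc k)} h∈))) ⟩
      ∑ (fixedPointFree (suc k)) (λ h → ((1/! m) * β) ^ suc k * fromℕ (cliqueWalks r h))
        ≈⟨ ∑F-*ˡ _ (fixedPointFree (suc k)) (λ h → fromℕ (cliqueWalks r h)) ⟨
      ((1/! m) * β) ^ suc k * ∑ (fixedPointFree (suc k)) (λ h → fromℕ (cliqueWalks r h))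
        ≈⟨ *-congˡ (fromℕ-∑ (fixedPointFree (suc k)) (cliqueWalks r)) ⟨
      ((1/! m) * β) ^ suc k * fromℕ (totalCliqueWalks r) ∎

  -- Double counting of incidences. A second factor `degree v` sits in the `Q` used later, and this
  -- is how the squares of the degrees arise.
  ∑-pairs : ∀ (Q : Fin n → Carrier) → ∑ pairs (λ x → Q (proj₂ x)) ≈ ∑ (allFin n) (λ v → fromℕ (degree v) * Q v)
  ∑-pairs Q = begin
    ∑ pairs (λ x → Q (proj₂ x))
      ≈⟨ SumF.⨁-concatMap (λ e → map (e ,_) (elements e)) Edges _ ⟩
    ∑ Edges (λ e → ∑ (map (e ,_) (elements e)) (λ x → Q (proj₂ x)))
      ≈⟨ SumF.⨁-cong Edges (λ e → trans (SumF.⨁-map (e ,_) (elements e) (λ x → Q (proj₂ x))) (SumF.⨁-filter (_∈? e) (allFin n) Q)) ⟩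
    ∑ Edges (λ e → ∑ (allFin n) (λ v → if does (v ∈? e) then Q v else 0#))
      ≈⟨ SumF.⨁-swap Edges (allFin n) (λ e v → if does (v ∈? e) then Q v else 0#) ⟩
    ∑ (allFin n) (λ v → ∑ Edges (λ e → if does (v ∈? e) then Q v else 0#))
      ≈⟨ SumF.⨁-cong (allFin n) (λ v → trans (SumF.⨁-filter edge? (subsets n) _) (trans
           (SumF.⨁-cong (subsets n) (λ e → K.reflexive (nest (edge? e) (v ∈? e) (Q v))))
           (trans (sym (SumF.⨁-filter (λ e → edge? e ×-dec (v ∈? e)) (subsets n) (λ _ → Q v)))
             (∑F-const (filter (λ e → edge? e ×-dec (v ∈? e)) (subsets n)) (Q v))))) ⟩
    ∑ (allFin n) (λ v → fromℕ (degree v) * Q v) ∎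
    where
    nest : ∀ {a b} {A : Set a} {B : Set b} (x : Dec A) (y : Dec B) q →
           (if does x then (if does y then q else 0#) else 0#) ≡ (if does (x ×-dec y) then q else 0#)
    nest (yes _) y q = refl
    nest (no _)  y q = refl

  sum-above : ∑ (configurations (suc k)) (term (suc k)) ≈
              ∑ (allFin n) (λ i → (α * fromℕ (degree i)) ^ suc k) +
              (∑ (allFin n) (λ v → fromℕ (degree v) * (fromℕ (suc k) * fromℕ m * fromℕ k ^ r * ((β * ι) ^ k * (α * fromℕ (degree v))))) +
               fromℕ numComplete * (((1/! m) * β) ^ suc k * fromℕ (totalCliqueWalks r)))
  sum-above = begin
    ∑ (configurations (suc k)) (term (suc k))
      ≈⟨ sum-shapes (s≤s z≤n) ℕₚ.≤-refl unique totals shapes ⟩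
    ∑ (loopConfigs (suc k) ++ firsts ++ lasts ++ cliques) T
      ≈⟨ SumF.⨁-++ (loopConfigs (suc k)) _ T ⟩
    ∑ (loopConfigs (suc k)) T + ∑ (firsts ++ lasts ++ cliques) T
      ≈⟨ +-cong (∑-loopConfigs k) (trans (SumF.⨁-++ firsts _ T) (+-congˡ (SumF.⨁-++ lasts cliques T))) ⟩
    _ + (∑ firsts T + (∑ lasts T + ∑ cliques T))
      ≈⟨ +-congˡ (trans (sym (+-assoc _ _ _)) (+-cong marked ∑-cliques)) ⟩
    _ ∎
    where
    T : Configuration → Carrier
    T = term (suc k)
    -- The term of one pair with the diagonal entry on a given side of the edge; the two sides
    -- together restore a full term.
    half : Fin n → Carrier
    half v = fromℕ (suc k) * fromℕ m * fromℕ k ^ r * ((β * ι) ^ k * (α * fromℕ (degree v) * (1/ 2)))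
    two-halves : (1/ 2) + (1/ 2) ≈ 1#
    two-halves = trans (trans (+-cong (sym (*-identityʳ (1/ 2))) (sym (*-identityʳ (1/ 2)))) (sym (distribˡ (1/ 2) 1# 1#)))
      (trans (*-congˡ (sym (+-congˡ fromℕ-1))) (1/-inverse 2))
    marked : ∑ firsts T + ∑ lasts T ≈
             ∑ (allFin n) (λ v → fromℕ (degree v) * (fromℕ (suc k) * fromℕ m * fromℕ k ^ r * ((β * ι) ^ k * (α * fromℕ (degree v)))))
    marked = begin
      ∑ firsts T + ∑ lasts T
        ≈⟨ +-cong (SumF.⨁-map firstAt pairs T) (SumF.⨁-map lastAt pairs T) ⟩
      ∑ pairs (λ x → T (firstAt x)) + ∑ pairs (λ x → T (lastAt x))
        ≈⟨ +-cong (SumF.⨁-cong-∈ pairs (λ {x} x∈ → let E , v∈ = ∈-pairs⁻ x∈ in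
                     marked-term (λ j → δ j (proj₂ x)) (λ _ → 0) E v∈ (λ j → ℕₚ.+-identityʳ _)))
                  (SumF.⨁-cong-∈ pairs (λ {x} x∈ → let E , v∈ = ∈-pairs⁻ x∈ in
                     marked-term (λ _ → 0) (λ j → δ j (proj₂ x)) E v∈ (λ j → refl))) ⟩
      ∑ pairs (λ x → half (proj₂ x)) + ∑ pairs (λ x → half (proj₂ x))
        ≈⟨ SumF.⨁-∙ pairs (λ x → half (proj₂ x)) (λ x → half (proj₂ x)) ⟨
      ∑ pairs (λ x → half (proj₂ x) + half (proj₂ x))
        ≈⟨ ∑-pairs (λ v → half v + half v) ⟩
      ∑ (allFin n) (λ v → fromℕ (degree v) * (half v + half v))
        ≈⟨ SumF.⨁-cong (allFin n) (λ v → *-congˡ (trans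
             (solve 4 (λ x y z t → x :* (y :* (z :* t)) :+ x :* (y :* (z :* t)) := x :* (y :* (z :* (t :+ t)))) K.refl
                (fromℕ (suc k) * fromℕ m * fromℕ k ^ r) ((β * ι) ^ k) (α * fromℕ (degree v)) (1/ 2))
             (*-congˡ (*-congˡ (trans (*-congˡ two-halves) (*-identityʳ _)))))) ⟩
      _ ∎
    unique : Unique (loopConfigs (suc k) ++ firsts ++ lasts ++ cliques)
    -- The four families differ in their words: loop configurations contain no edge and cliques no
    -- diagonal entry, while a word of `firsts` begins with a diagonal entry and no word of `lasts`
    -- does.
    unique = Uniqueₚ.++⁺ (loopConfigs-unique k)
      (Uniqueₚ.++⁺ firsts-unique (Uniqueₚ.++⁺ lasts-unique cliques-unique λ { (Γ∈ , Γ∈′) → last-clique Γ∈ Γ∈′ })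
        λ { (Γ∈ , Γ∈′) → [ first-last Γ∈ , first-clique Γ∈ ]′ (∈-++⁻ lasts Γ∈′) })
      λ { (Γ∈ , Γ∈′) → [ loop-first Γ∈ , (λ q → [ loop-last Γ∈ , loop-clique Γ∈ ]′ (∈-++⁻ lasts q)) ]′ (∈-++⁻ firsts Γ∈′) }
      where
      last-clique : ∀ {Γ} → Γ ∈ lasts → Γ ∉ cliques
      last-clique Γ∈ Γ∈′ with (e , v) , x∈ , refl ← ∈-map⁻ lastAt Γ∈ with E , v∈ ← ∈-pairs⁻ x∈ =
        clique-no-loop {j = v} Γ∈′ (≡-∈ (≡.sym (last-word E v∈)) (there (here refl)))
      first-clique : ∀ {Γ} → Γ ∈ firsts → Γ ∉ cliques
      first-clique Γ∈ Γ∈′ with (e , v) , x∈ , refl ← ∈-map⁻ firstAt Γ∈ with E , v∈ ← ∈-pairs⁻ x∈ =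
        clique-no-loop {j = v} Γ∈′ (≡-∈ (≡.sym (first-word E v∈)) (here refl))
      first-last : ∀ {Γ} → Γ ∈ firsts → Γ ∉ lasts
      first-last Γ∈ Γ∈′ with x , x∈ , refl ← ∈-map⁻ firstAt Γ∈ with y , y∈ , eq ← ∈-map⁻ lastAt Γ∈′
        with E , v∈ ← ∈-pairs⁻ x∈
        with () ← proj₁ (last-head (proj₁ (∈-pairs⁻ y∈)) (≡.trans (cong (λ Γ → word Γ (proj₂ x)) (≡.sym eq)) (first-word E v∈)))
      loop-first : ∀ {Γ} → Γ ∈ loopConfigs (suc k) → Γ ∉ firsts
      loop-first Γ∈ Γ∈′ with (e , v) , x∈ , refl ← ∈-map⁻ firstAt Γ∈′ with E , v∈ ← ∈-pairs⁻ x∈ =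
        loop-edge-disjoint k {j = v} Γ∈ (edgeConfig-edge (λ j → δ j v) (λ _ → 0) E v∈)
      loop-last : ∀ {Γ} → Γ ∈ loopConfigs (suc k) → Γ ∉ lasts
      loop-last Γ∈ Γ∈′ with (e , v) , x∈ , refl ← ∈-map⁻ lastAt Γ∈′ with E , v∈ ← ∈-pairs⁻ x∈ =
        loop-edge-disjoint k {j = v} Γ∈ (edgeConfig-edge (λ _ → 0) (λ j → δ j v) E v∈)
      loop-clique : ∀ {Γ} → Γ ∈ loopConfigs (suc k) → Γ ∉ cliques
      loop-clique Γ∈ Γ∈′ with S , p , h , refl ← ∈-cliques⁻ Γ∈′ =
        loop-edge-disjoint k {j = enumerate S p Fin.zero} Γ∈ (≡-∈ (≡.sym (clique-word S p h Fin.zero)) (here refl))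
    totals : ∀ {Γ} → Γ ∈ loopConfigs (suc k) ++ firsts ++ lasts ++ cliques → total Γ ≡ suc k
    totals Γ∈ with ∈-++⁻ (loopConfigs (suc k)) Γ∈
    ... | inj₁ l = loopConfigs-total k l
    ... | inj₂ l with ∈-++⁻ firsts l
    ...   | inj₁ l′ with (e , v) , x∈ , refl ← ∈-map⁻ firstAt l′ with E , v∈ ← ∈-pairs⁻ x∈ =
      marked-total (λ j → δ j v) (λ _ → 0) E v∈ (λ j → ℕₚ.+-identityʳ _)
    ...   | inj₂ l′ with ∈-++⁻ lasts l′
    ...     | inj₁ l″ with (e , v) , x∈ , refl ← ∈-map⁻ lastAt l″ with E , v∈ ← ∈-pairs⁻ x∈ =
      marked-total (λ _ → 0) (λ j → δ j v) E v∈ (λ j → refl)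
    ...     | inj₂ l″ with S , p , h , refl ← ∈-cliques⁻ l″ = clique-total S p h
    shapes : ∀ {Γ} → Shape (suc k) Γ → Γ ∈ loopConfigs (suc k) ++ firsts ++ lasts ++ cliques
    shapes (loop i refl)           = ∈-++⁺ˡ (∈-map⁺ (loopConfig (suc k)) (∈-allFin i))
    shapes (edge _ _ eq _)         = contradiction (≡.sym eq) (ℕₚ.<⇒≢ ℕₚ.≤-refl)
    shapes (first e v E v∈ _ refl) = ∈-++⁺ʳ (loopConfigs (suc k)) (∈-++⁺ˡ (∈-map⁺ firstAt (∈-pairs⁺ E v∈)))
    shapes (last e v E v∈ _ refl)  = ∈-++⁺ʳ (loopConfigs (suc k)) (∈-++⁺ʳ firsts (∈-++⁺ˡ (∈-map⁺ lastAt (∈-pairs⁺ E v∈))))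
    shapes (clique S p h complete h≢ _ refl) = ∈-++⁺ʳ (loopConfigs (suc k)) (∈-++⁺ʳ firsts (∈-++⁺ʳ lasts
      (∈-concatMap⁺ cliquesOf (lose
        (∈-filter⁺ (λ S → (∣ S ∣ ℕₚ.≟ suc k) ×-dec complete? S) (∈-subsets S) (≡.trans (≡.sym (length-elements S)) p , complete))
        (∈-cliquesOf⁺ S p h h≢)))))

-- Normalisation and the three trace formulas

module Traces {c ℓ₁ ℓ₂ : Level} (F : OrderedField c ℓ₁ ℓ₂) (r : ℕ) where
  open OrderedField F hiding (refl; _<_; _≤_)
  open Tensors F
  open FieldLemmas F
  open CliqueWalks
  open import Data.Nat.Base using (zero)
  open import Relation.Binary.Reasoning.Setoid K.setoid
  open ≡ using (cong)

  private
    m k : ℕ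
    m = suc r
    k = suc m

  power : ℕ → ℕ → Carrier
  power n j = [ k -1]^ (n ⊖ j)

  -- The exponent n - j is an integer. Below zero the power is one of 1/(k-1), so the rule is
  -- checked by cases, the first being the passage from exponent 0 to -1.
  power-suc : ∀ n j → power n j ≈ fromℕ m * power n (suc j)
  power-suc zero    zero    = sym (trans (*-congˡ (*-identityʳ (1/ m))) (trans (*-comm _ _) (1/-inverse m)))
  power-suc zero    (suc j) = sym (trans (solve 3 (λ x y z → x :* (y :* z) := y :* x :* z) K.refl (fromℕ m) (1/ m) ((1/ m) ^ suc j))
                                         (trans (*-congʳ (1/-inverse m)) (*-identityˡ _)))
  power-suc (suc n) zero    = *-congˡ (K.reflexive (cong (λ z → [ k -1]^ z) (≡.sym (ℤₚ.[1+m]⊖[1+n]≡m⊖n n 0))))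
  power-suc (suc n) (suc j) = begin
    power (suc n) (suc j)             ≈⟨ K.reflexive (cong (λ z → [ k -1]^ z) (ℤₚ.[1+m]⊖[1+n]≡m⊖n n j)) ⟩
    power n j                         ≈⟨ power-suc n j ⟩
    fromℕ m * power n (suc j)         ≈⟨ *-congˡ (K.reflexive (cong (λ z → [ k -1]^ z) (≡.sym (ℤₚ.[1+m]⊖[1+n]≡m⊖n n (suc j))))) ⟩
    fromℕ m * power (suc n) (suc (suc j)) ∎

  power-+ : ∀ n l j → power n j ≈ fromℕ m ^ l * power n (l ℕ.+ j)
  power-+ n zero    j = sym (*-identityˡ _)
  power-+ n (suc l) j = begin
    power n j                                             ≈⟨ power-suc n j ⟩
    fromℕ m * power n (suc j)                             ≈⟨ *-congˡ (power-+ n l (suc j)) ⟩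
    fromℕ m * (fromℕ m ^ l * power n (l ℕ.+ suc j))       ≈⟨ *-assoc _ _ _ ⟨
    fromℕ m ^ suc l * power n (l ℕ.+ suc j)               ≈⟨ *-congˡ (K.reflexive (cong (power n) (ℕₚ.+-suc l j))) ⟩
    fromℕ m ^ suc l * power n (suc l ℕ.+ j)               ∎

  power-k : ∀ n → power n 1 ≈ fromℕ m ^ m * power n k
  power-k n = trans (power-+ n m 1) (*-congˡ (K.reflexive (cong (power n) (ℕₚ.+-comm m 1))))

  sum≈∑ : ∀ {n} (f : Fin n → Carrier) → sum f ≈ ∑ (allFin n) f
  sum≈∑ {zero}  f = K.refl
  sum≈∑ {suc n} f = +-congˡ (trans (sum≈∑ (λ i → f (Fin.suc i))) (sym (SumF.⨁-tabulate Fin.suc f)))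

  -- Each of the k + 1 vertices of a clique contributes 1/(k-1)!. The power (k-1)^(k-1) is the
  -- quotient of the prefactor (k-1)^(n-1) of the trace and the (k-1)^(n-k) of the statement, and
  -- 1/(k+1) offsets the k + 1 that stands in front there.
  C : Carrier
  C = (1/ suc k) * fromℕ m ^ m * (1/! m) ^ suc k * fromℕ (totalCliqueWalks r)

  module _ {n : ℕ} (G : Hypergraph k n) (α : Carrier) where
    open Hypergraph G
    open Expansion.Configurations F G α using (Tr-expansion)
    open Summation F G α using (sum-below; sum-at; sum-above; β; ι)

    φ : ℕ → Carrier
    φ s = [ k -1]^ (n ⊖ 1) * α ^ s * sum (λ i → fromℕ (degree i) ^ s)

    loops-φ : ∀ s → power n 1 * ∑ (allFin n) (λ i → (α * fromℕ (degree i)) ^ s) ≈ φ s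
    loops-φ s = trans (*-congˡ (begin
      ∑ (allFin n) (λ i → (α * fromℕ (degree i)) ^ s)
        ≈⟨ SumF.⨁-cong (allFin n) (λ i → ^-distrib-* α (fromℕ (degree i)) s) ⟩
      ∑ (allFin n) (λ i → α ^ s * fromℕ (degree i) ^ s)
        ≈⟨ ∑F-*ˡ (α ^ s) (allFin n) (λ i → fromℕ (degree i) ^ s) ⟨
      α ^ s * ∑ (allFin n) (λ i → fromℕ (degree i) ^ s)
        ≈⟨ *-congˡ (sum≈∑ (λ i → fromℕ (degree i) ^ s)) ⟨
      α ^ s * sum (λ i → fromℕ (degree i) ^ s) ∎)) (sym (*-assoc _ _ _))

    m*ι : (fromℕ m * ι) ^ k ≈ 1#
    m*ι = trans (^-congˡ k (trans (*-comm _ _) (1/-inverse m))) (1^ k)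
      where
      1^ : ∀ l → 1# ^ l ≈ 1#
      1^ zero    = K.refl
      1^ (suc l) = trans (*-identityˡ _) (1^ l)

    -- (k-1)ⁿ⁻¹ (k-1) / (k-1)ᵏ = (k-1)ⁿ⁻ᵏ
    cancel : ∀ x → power n 1 * (fromℕ m * (x * ι ^ k)) ≈ power n k * x
    cancel x = begin
      power n 1 * (fromℕ m * (x * ι ^ k))
        ≈⟨ *-congʳ (power-k n) ⟩
      fromℕ m ^ m * power n k * (fromℕ m * (x * ι ^ k))
        ≈⟨ solve 5 (λ M P m x i → M :* P :* (m :* (x :* i)) := P :* x :* (m :* M :* i)) K.refl (fromℕ m ^ m) (power n k) (fromℕ m) x (ι ^ k) ⟩
      power n k * x * (fromℕ m ^ k * ι ^ k)
        ≈⟨ *-congˡ (trans (sym (^-distrib-* (fromℕ m) ι k)) m*ι) ⟩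
      power n k * x * 1#
        ≈⟨ *-identityʳ _ ⟩
      power n k * x ∎

    Tr-below : ∀ d → 1 ℕ.≤ d → d ℕ.≤ m → Tr k d (A[ G ] α) ≈ φ d
    Tr-below (suc d) 1≤d d≤m = trans (Tr-expansion (suc d)) (trans (*-congˡ (sum-below d d≤m)) (loops-φ (suc d)))

    Tr-at : Tr k k (A[ G ] α) ≈ φ k + power n k * fromℕ k ^ m * (1# - α) ^ k * fromℕ numEdges
    Tr-at = begin
      Tr k k (A[ G ] α)
        ≈⟨ trans (Tr-expansion k) (trans (*-congˡ sum-at) (distribˡ _ _ _)) ⟩
      _ ≈⟨ +-cong (loops-φ k) edges ⟩
      φ k + power n k * fromℕ k ^ m * β ^ k * fromℕ numEdges ∎
      where
      E : Carrier
      E = fromℕ numEdges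
      edges : power n 1 * (E * (fromℕ k * fromℕ m * fromℕ k ^ r * (β * ι) ^ k)) ≈ power n k * fromℕ k ^ m * β ^ k * E
      edges = begin
        power n 1 * (E * (fromℕ k * fromℕ m * fromℕ k ^ r * (β * ι) ^ k))
          ≈⟨ *-congˡ (*-congˡ (*-congˡ (^-distrib-* β ι k))) ⟩
        power n 1 * (E * (fromℕ k * fromℕ m * fromℕ k ^ r * (β ^ k * ι ^ k)))
          ≈⟨ *-congˡ (solve 6 (λ E k m kr b i → E :* (k :* m :* kr :* (b :* i)) := m :* (k :* kr :* b :* E :* i)) K.refl
               E (fromℕ k) (fromℕ m) (fromℕ k ^ r) (β ^ k) (ι ^ k)) ⟩
        power n 1 * (fromℕ m * (fromℕ k ^ m * β ^ k * E * ι ^ k))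
          ≈⟨ cancel _ ⟩
        power n k * (fromℕ k ^ m * β ^ k * E)
          ≈⟨ solve 4 (λ P K b E → P :* (K :* b :* E) := P :* K :* b :* E) K.refl (power n k) (fromℕ k ^ m) (β ^ k) E ⟩
        power n k * fromℕ k ^ m * β ^ k * E ∎

    Tr-above : Tr k (suc k) (A[ G ] α) ≈ φ (suc k) + fromℕ (suc k) * power n k *
      (fromℕ k ^ r * α * (1# - α) ^ k * sum (λ i → fromℕ (degree i) ^ 2) + (1# - α) ^ suc k * C * fromℕ numComplete)
    Tr-above = begin
      Tr k (suc k) (A[ G ] α)
        ≈⟨ trans (Tr-expansion (suc k)) (trans (*-congˡ sum-above) (trans (distribˡ _ _ _) (+-congˡ (distribˡ _ _ _)))) ⟩
      _ ≈⟨ +-cong (loops-φ (suc k)) (trans (+-cong squares cliques) (sym (distribˡ _ _ _))) ⟩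
      _ ∎
      where
      S : Carrier
      S = sum (λ i → fromℕ (degree i) ^ 2)
      deg : Fin n → Carrier
      deg v = fromℕ (degree v)
      squares : power n 1 * ∑ (allFin n) (λ v → deg v * (fromℕ (suc k) * fromℕ m * fromℕ k ^ r * ((β * ι) ^ k * (α * deg v)))) ≈
                fromℕ (suc k) * power n k * (fromℕ k ^ r * α * β ^ k * S)
      squares = begin
        power n 1 * ∑ (allFin n) (λ v → deg v * (fromℕ (suc k) * fromℕ m * fromℕ k ^ r * ((β * ι) ^ k * (α * deg v))))
          ≈⟨ *-congˡ (trans (SumF.⨁-cong (allFin n) (λ v → trans (*-congˡ (*-congˡ (*-congʳ (^-distrib-* β ι k))))
               (solve 7 (λ d k m kr b i a → d :* (k :* m :* kr :* (b :* i :* (a :* d))) := k :* m :* kr :* b :* i :* a :* (d :* d)) K.refl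
                  (deg v) (fromℕ (suc k)) (fromℕ m) (fromℕ k ^ r) (β ^ k) (ι ^ k) α)))
               (sym (∑F-*ˡ _ (allFin n) (λ v → deg v * deg v)))) ⟩
        power n 1 * (fromℕ (suc k) * fromℕ m * fromℕ k ^ r * β ^ k * ι ^ k * α * ∑ (allFin n) (λ v → deg v * deg v))
          ≈⟨ *-congˡ (*-congˡ (trans (SumF.⨁-cong (allFin n) (λ v → *-congˡ (sym (*-identityʳ (deg v))))) (sym (sum≈∑ (λ v → deg v ^ 2))))) ⟩
        power n 1 * (fromℕ (suc k) * fromℕ m * fromℕ k ^ r * β ^ k * ι ^ k * α * S)
          ≈⟨ *-congˡ (solve 7 (λ k m kr b i a S → k :* m :* kr :* b :* i :* a :* S := m :* (k :* (kr :* a :* b :* S) :* i)) K.refl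
               (fromℕ (suc k)) (fromℕ m) (fromℕ k ^ r) (β ^ k) (ι ^ k) α S) ⟩
        power n 1 * (fromℕ m * (fromℕ (suc k) * (fromℕ k ^ r * α * β ^ k * S) * ι ^ k))
          ≈⟨ cancel _ ⟩
        power n k * (fromℕ (suc k) * (fromℕ k ^ r * α * β ^ k * S))
          ≈⟨ solve 3 (λ P k x → P :* (k :* x) := k :* P :* x) K.refl (power n k) (fromℕ (suc k)) _ ⟩
        fromℕ (suc k) * power n k * (fromℕ k ^ r * α * β ^ k * S) ∎
      X : Carrier
      X = fromℕ (totalCliqueWalks r)
      cliques : power n 1 * (fromℕ numComplete * (((1/! m) * β) ^ suc k * X)) ≈
                fromℕ (suc k) * power n k * (β ^ suc k * C * fromℕ numComplete)
      cliques = begin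
        power n 1 * (fromℕ numComplete * (((1/! m) * β) ^ suc k * X))
          ≈⟨ *-cong (power-k n) (*-congˡ (*-congʳ (^-distrib-* (1/! m) β (suc k)))) ⟩
        fromℕ m ^ m * power n k * (fromℕ numComplete * ((1/! m) ^ suc k * β ^ suc k * X))
          -- A factor 1 is inserted and then written as (k+1) times its reciprocal: one half goes to
          -- the front, the other into `C`.
          ≈⟨ *-identityˡ _ ⟨
        1# * (fromℕ m ^ m * power n k * (fromℕ numComplete * ((1/! m) ^ suc k * β ^ suc k * X)))
          ≈⟨ *-congʳ (1/-inverse (suc k)) ⟨
        (1/ suc k) * fromℕ (suc k) * (fromℕ m ^ m * power n k * (fromℕ numComplete * ((1/! m) ^ suc k * β ^ suc k * X)))
          ≈⟨ solve 8 (λ i k M P N f b X → i :* k :* (M :* P :* (N :* (f :* b :* X))) := k :* P :* (b :* (i :* M :* f :* X) :* N)) K.refl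
               (1/ suc k) (fromℕ (suc k)) (fromℕ m ^ m) (power n k) (fromℕ numComplete) ((1/! m) ^ suc k) (β ^ suc k) X ⟩
        fromℕ (suc k) * power n k * (β ^ suc k * C * fromℕ numComplete) ∎

corollary3p2 :
    ∀ {c ℓ₁ ℓ₂} (F : OrderedField c ℓ₁ ℓ₂) →
    let open OrderedField F
        open Tensors F
    in
    (k : ℕ) .{{_ : NonTrivial k}} →
    ∃[ C ] ((n : ℕ) (H : Hypergraph k n) (α : Carrier) → 0# ≤ α → α ≤ 1# →
      let open Hypergraph H
          φ : ℕ → Carrier
          φ s = [ k -1]^ (n ⊖ 1) * α ^ s * sum (λ i → fromℕ (degree i) ^ s)
      in
      (∀ d → 1 ℕ.≤ d → d ℕ.≤ k ∸ 1 → Tr k d (A[_] H α) ≈ φ d)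
      ×
      (Tr k k (A[_] H α) ≈
        φ k + [ k -1]^ (n ⊖ k) * fromℕ k ^ (k ∸ 1) * (1# - α) ^ k
              * fromℕ numEdges)
      ×
      (Tr k (suc k) (A[_] H α) ≈
        φ (suc k) + fromℕ (suc k) * [ k -1]^ (n ⊖ k) *
          (fromℕ k ^ (k ∸ 2) * α * (1# - α) ^ k
             * sum (λ i → fromℕ (degree i) ^ 2)
           + (1# - α) ^ suc k * C * fromℕ numComplete)))
corollary3p2 F (suc (suc r)) = Traces.C F r , λ n H α _ _ →
  Traces.Tr-below F r H α , Traces.Tr-at F r H α , Traces.Tr-above F r H α
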